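{- Let $q\in\mathbb{C}$ with $|q|<1$. Then $$1+\sum_{n=1}^\infty \frac{q^{n^2}(-q^3;q^3)_{n-1}}{(-q;q)_n(q;q)_{2n-1}} = \frac{(q^{12},q^{15},q^{27};q^{27})_\infty-2q^2(-q^{33},-q^{75},q^{108};q^{108})_\infty+2q^{7}(-q^{15},-q^{93},q^{108};q^{108})_\infty}{(q;q)_\infty}.$$
   Context: For $|q|<1$, $x\in\mathbb{C}$ and an integer $n\ge 0$: $(x;q)_n=\prod_{j=0}^{n-1}(1-xq^j)$ (so $(x;q)_0=1$), $(x;q)_\infty=\prod_{j=0}^{\infty}(1-xq^j)$, and $(x_1,\dots,x_k;q)_\infty=\prod_{i=1}^k (x_i;q)_\infty$. The same notation is used with base $q^m$ in place of $q$. -}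

module Defs where

open import Algebra.Bundles.Raw using (RawRing)
open import Data.Fin.Base using (toℕ)
open import Data.List.Base using (List; foldr)
open import Data.List.Relation.Binary.Pointwise using (Pointwise)
open import Data.Nat.Base as ℕ using (ℕ; suc)
import Data.Nat.Properties as ℕₚ
open import Data.Product using (_×_; _,_; ∃; ∃-syntax)
open import Data.Rational as ℚ using (ℚ; 0ℚ; 1ℚ; ½; ∣_∣)
import Data.Rational.Properties as ℚₚ
open import Data.Rational.Solver using (module +-*-Solver)
open import Level using (0ℓ)
open import Relation.Binary.PropositionalEquality
  using (_≡_; refl; sym; trans; cong; subst)

-- Real numbers as Cauchy sequences of rationals, with equality _≈ℝ_ below.
-- Moduli of convergence are part of the data, as usual constructively.

Cauchy : (ℕ → ℚ) → Set
Cauchy x = ∀ ε → 0ℚ ℚ.< ε →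
  ∃[ N ] (∀ m n → N ℕ.≤ m → N ℕ.≤ n → ∣ x m ℚ.- x n ∣ ℚ.< ε)

record ℝ : Set where
  field
    seq    : ℕ → ℚ
    cauchy : Cauchy seq

open ℝ public

infix 4 _≈ℝ_ _<ℝ_

_≈ℝ_ : ℝ → ℝ → Set
x ≈ℝ y = ∀ ε → 0ℚ ℚ.< ε →
  ∃[ N ] (∀ n → N ℕ.≤ n → ∣ seq x n ℚ.- seq y n ∣ ℚ.< ε)

_<ℝ_ : ℝ → ℝ → Set
x <ℝ y = ∃[ ε ] 0ℚ ℚ.< ε × ∃[ N ] (∀ n → N ℕ.≤ n → seq x n ℚ.+ ε ℚ.< seq y n)

private
  module S = +-*-Solver

  abstract
    ⊔ˡ : ∀ m n {k} → m ℕ.⊔ n ℕ.≤ k → m ℕ.≤ k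
    ⊔ˡ m n = ℕₚ.m⊔n≤o⇒m≤o m n

    ⊔ʳ : ∀ m n {k} → m ℕ.⊔ n ℕ.≤ k → n ℕ.≤ k
    ⊔ʳ m n = ℕₚ.m⊔n≤o⇒n≤o m n

    0<½ε : ∀ {ε} → 0ℚ ℚ.< ε → 0ℚ ℚ.< ½ ℚ.* ε
    0<½ε {ε} 0<ε = subst (ℚ._< ½ ℚ.* ε) (ℚₚ.*-zeroʳ ½) (ℚₚ.*-monoʳ-<-pos ½ 0<ε)

    ½ε+½ε : ∀ ε → ½ ℚ.* ε ℚ.+ ½ ℚ.* ε ≡ ε
    ½ε+½ε ε = trans (sym (ℚₚ.*-distribʳ-+ ε ½ ½)) (ℚₚ.*-identityˡ ε)

    halves : ∀ a b ε → ∣ a ∣ ℚ.< ½ ℚ.* ε → ∣ b ∣ ℚ.< ½ ℚ.* ε → ∣ a ℚ.+ b ∣ ℚ.< ε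
    halves a b ε p r = subst (∣ a ℚ.+ b ∣ ℚ.<_) (½ε+½ε ε)
      (ℚₚ.≤-<-trans (ℚₚ.∣p+q∣≤∣p∣+∣q∣ a b) (ℚₚ.+-mono-< p r))

    const-cauchy : ∀ r → Cauchy (λ _ → r)
    const-cauchy r ε 0<ε = 0 , λ _ _ _ _ →
      subst (ℚ._< ε) (sym (cong ∣_∣ (ℚₚ.+-inverseʳ r))) 0<ε

    neg-cauchy : ∀ {x} → Cauchy x → Cauchy (λ n → ℚ.- x n)
    neg-cauchy {x} cx ε 0<ε with cx ε 0<ε
    ... | N , p = N , λ m n N≤m N≤n → subst (ℚ._< ε)
      (trans (sym (ℚₚ.∣-p∣≡∣p∣ (x m ℚ.- x n))) (cong ∣_∣ (eq (x m) (x n)))) (p m n N≤m N≤n)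
      where
      eq : ∀ a b → ℚ.- (a ℚ.- b) ≡ (ℚ.- a) ℚ.- (ℚ.- b)
      eq = S.solve 2 (λ a b → S.:- (a S.:- b) S.:= (S.:- a) S.:- (S.:- b)) refl

    +-cauchy : ∀ {x y} → Cauchy x → Cauchy y → Cauchy (λ n → x n ℚ.+ y n)
    +-cauchy {x} {y} cx cy ε 0<ε with cx (½ ℚ.* ε) (0<½ε 0<ε) | cy (½ ℚ.* ε) (0<½ε 0<ε)
    ... | M , p | N , r = M ℕ.⊔ N , λ m n l k → subst (λ e → ∣ e ∣ ℚ.< ε)
      (eq (x m) (x n) (y m) (y n))
      (halves (x m ℚ.- x n) (y m ℚ.- y n) ε
        (p m n (⊔ˡ M N l) (⊔ˡ M N k)) (r m n (⊔ʳ M N l) (⊔ʳ M N k)))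
      where
      eq : ∀ a b c d → (a ℚ.- b) ℚ.+ (c ℚ.- d) ≡ (a ℚ.+ c) ℚ.- (b ℚ.+ d)
      eq = S.solve 4 (λ a b c d →
        (a S.:- b) S.:+ (c S.:- d) S.:= (a S.:+ c) S.:- (b S.:+ d)) refl

    bounded : ∀ {x} → Cauchy x →
      ∃[ B ] 0ℚ ℚ.< B × ∃[ N ] (∀ n → N ℕ.≤ n → ∣ x n ∣ ℚ.≤ B)
    bounded {x} cx with cx 1ℚ (ℚₚ.positive⁻¹ 1ℚ)
    ... | N , p = 1ℚ ℚ.+ ∣ x N ∣ , ℚₚ.+-mono-<-≤ {0ℚ} {1ℚ} (ℚₚ.positive⁻¹ 1ℚ) (ℚₚ.0≤∣p∣ (x N))
      , N , λ n N≤n → subst (λ e → ∣ e ∣ ℚ.≤ 1ℚ ℚ.+ ∣ x N ∣) (eq (x n) (x N))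
          (ℚₚ.≤-trans (ℚₚ.∣p+q∣≤∣p∣+∣q∣ (x n ℚ.- x N) (x N))
            (ℚₚ.+-monoˡ-≤ ∣ x N ∣ (ℚₚ.<⇒≤ (p n N N≤n ℕₚ.≤-refl))))
      where
      eq : ∀ a b → (a ℚ.- b) ℚ.+ b ≡ a
      eq = S.solve 2 (λ a b → (a S.:- b) S.:+ b S.:= a) refl

    scaled : ∀ B → 0ℚ ℚ.< B → ∀ ε → 0ℚ ℚ.< ε →
      ∃[ δ ] 0ℚ ℚ.< δ × (∀ a b → ∣ a ∣ ℚ.< δ → ∣ b ∣ ℚ.≤ B → ∣ a ℚ.* b ∣ ℚ.< ε)
    scaled B 0<B ε 0<ε = ε ℚ.* B⁻¹
      , subst (ℚ._< ε ℚ.* B⁻¹) (ℚₚ.*-zeroˡ B⁻¹) (ℚₚ.*-monoˡ-<-pos B⁻¹ 0<ε)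
      , λ a b a<δ b≤B → subst (∣ a ℚ.* b ∣ ℚ.<_) cancel
          (subst (ℚ._< ε ℚ.* B⁻¹ ℚ.* B) (sym (ℚₚ.∣p*q∣≡∣p∣*∣q∣ a b))
            (ℚₚ.≤-<-trans
              (ℚₚ.*-monoˡ-≤-nonNeg ∣ a ∣ {{ℚₚ.∣-∣-nonNeg a}} b≤B)
              (ℚₚ.*-monoˡ-<-pos B a<δ)))
      where
      instance
        pos : ℚ.Positive B
        pos = ℚ.positive 0<B
        nz : ℚ.NonZero B
        nz = ℚₚ.pos⇒nonZero B
      B⁻¹ : ℚ
      B⁻¹ = ℚ.1/ B
      instance
        pos⁻¹ : ℚ.Positive B⁻¹
        pos⁻¹ = ℚₚ.1/pos⇒pos B
      cancel : ε ℚ.* B⁻¹ ℚ.* B ≡ ε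
      cancel = trans (ℚₚ.*-assoc ε B⁻¹ B)
        (trans (cong (ε ℚ.*_) (ℚₚ.*-inverseˡ B)) (ℚₚ.*-identityʳ ε))

    *-telescope : ∀ a b c d →
      (a ℚ.- b) ℚ.* c ℚ.+ (c ℚ.- d) ℚ.* b ≡ a ℚ.* c ℚ.- b ℚ.* d
    *-telescope = S.solve 4 (λ a b c d →
      (a S.:- b) S.:* c S.:+ (c S.:- d) S.:* b S.:= a S.:* c S.:- b S.:* d) refl

    *-close : ∀ a b c d ε → ∣ (a ℚ.- b) ℚ.* c ∣ ℚ.< ½ ℚ.* ε →
      ∣ (c ℚ.- d) ℚ.* b ∣ ℚ.< ½ ℚ.* ε → ∣ a ℚ.* c ℚ.- b ℚ.* d ∣ ℚ.< ε
    *-close a b c d ε p r = subst (λ e → ∣ e ∣ ℚ.< ε) (*-telescope a b c d)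
      (halves ((a ℚ.- b) ℚ.* c) ((c ℚ.- d) ℚ.* b) ε p r)

    *-cauchy : ∀ {x y} → Cauchy x → Cauchy y → Cauchy (λ n → x n ℚ.* y n)
    *-cauchy {x} {y} cx cy ε 0<ε =
      let A , 0<A , K , x≤A = bounded cx
          B , 0<B , L , y≤B = bounded cy
          δ , 0<δ , f = scaled A 0<A (½ ℚ.* ε) (0<½ε 0<ε)
          η , 0<η , g = scaled B 0<B (½ ℚ.* ε) (0<½ε 0<ε)
          M , p = cy δ 0<δ
          N , r = cx η 0<η
      in (K ℕ.⊔ L) ℕ.⊔ (M ℕ.⊔ N) , λ m n l k →
        let m≥KL = ⊔ˡ (K ℕ.⊔ L) (M ℕ.⊔ N) l
            n≥KL = ⊔ˡ (K ℕ.⊔ L) (M ℕ.⊔ N) k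
            m≥MN = ⊔ʳ (K ℕ.⊔ L) (M ℕ.⊔ N) l
            n≥MN = ⊔ʳ (K ℕ.⊔ L) (M ℕ.⊔ N) k
        in *-close (x m) (x n) (y m) (y n) ε
          (g (x m ℚ.- x n) (y m) (r m n (⊔ʳ M N m≥MN) (⊔ʳ M N n≥MN)) (y≤B m (⊔ʳ K L m≥KL)))
          (f (y m ℚ.- y n) (x n) (p m n (⊔ˡ M N m≥MN) (⊔ˡ M N n≥MN)) (x≤A n (⊔ˡ K L n≥KL)))

infixl 6 _+ℝ_ _-ℝ_
infixl 7 _*ℝ_

fromℚ : ℚ → ℝ
fromℚ r = record { seq = λ _ → r ; cauchy = const-cauchy r }

-ℝ_ : ℝ → ℝ
-ℝ x = record { seq = λ n → ℚ.- seq x n ; cauchy = neg-cauchy {seq x} (cauchy x) }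

_+ℝ_ : ℝ → ℝ → ℝ
x +ℝ y = record { seq    = λ n → seq x n ℚ.+ seq y n
                ; cauchy = +-cauchy {seq x} {seq y} (cauchy x) (cauchy y) }

_*ℝ_ : ℝ → ℝ → ℝ
x *ℝ y = record { seq    = λ n → seq x n ℚ.* seq y n
                ; cauchy = *-cauchy {seq x} {seq y} (cauchy x) (cauchy y) }

_-ℝ_ : ℝ → ℝ → ℝ
x -ℝ y = x +ℝ (-ℝ y)

record ℂ : Set where
  constructor _+i_
  field
    re im : ℝ

open ℂ public

ℂ-rawRing : RawRing 0ℓ 0ℓ
ℂ-rawRing = record
  { Carrier = ℂ
  ; _≈_     = λ z w → re z ≈ℝ re w × im z ≈ℝ im w
  ; _+_     = λ z w → (re z +ℝ re w) +i (im z +ℝ im w)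
  ; _*_     = λ z w → (re z *ℝ re w -ℝ im z *ℝ im w) +i (re z *ℝ im w +ℝ im z *ℝ re w)
  ; -_      = λ z → (-ℝ re z) +i (-ℝ im z)
  ; 0#      = fromℚ 0ℚ +i fromℚ 0ℚ
  ; 1#      = fromℚ 1ℚ +i fromℚ 0ℚ
  }

open RawRing ℂ-rawRing public using (_≈_; _+_; _*_; -_; 0#; 1#)
open import Algebra.Definitions.RawSemiring (RawRing.rawSemiring ℂ-rawRing) public
  using (_^_; sum; product)

infixl 6 _-_

_-_ : ℂ → ℂ → ℂ
z - w = z + (- w)

2# : ℂ
2# = 1# + 1#

∣_∣² : ℂ → ℝ
∣ z ∣² = re z *ℝ re z +ℝ im z *ℝ im z

-- ∣z∣ = √(re² + im²), so for a rational radius the square root can be cleared.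
infix 4 ∣_∣<_

∣_∣<_ : ℂ → ℚ → Set
∣ z ∣< r = 0ℚ ℚ.< r × ∣ z ∣² <ℝ fromℚ (r ℚ.* r)

-- Apartness from zero: the positive constructive form of z ≠ 0, under which
-- division by z is defined.
infix 4 _#0

_#0 : ℂ → Set
z #0 = fromℚ 0ℚ <ℝ ∣ z ∣²

infix 4 _⟶_

_⟶_ : (ℕ → ℂ) → ℂ → Set
f ⟶ L = ∀ ε → 0ℚ ℚ.< ε → ∃[ N ] (∀ n → N ℕ.≤ n → ∣ f n - L ∣< ε)

-- Quotients, infinite series and infinite products are partial, so "z is
-- (defined and) equal to …" is expressed by a relation.  Each relation
-- determines z up to _≈_.
infix 4 _is_÷_ _is∑₁_ _is⟨_⨾_⟩∞

_is_÷_ : ℂ → ℂ → ℂ → Set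
z is a ÷ b = b #0 × z * b ≈ a

-- The series starts at index 1.
_is∑₁_ : ℂ → (ℕ → ℂ) → Set
S is∑₁ t = (λ N → sum {N} (λ j → t (suc (toℕ j)))) ⟶ S

⟨_⨾_⟩ : ℂ → ℂ → ℕ → ℂ
⟨ x ⨾ q ⟩ n = product {n} (λ j → 1# - x * q ^ toℕ j)

_is⟨_⨾_⟩∞ : ℂ → List ℂ → ℂ → Set
P is⟨ xs ⨾ q ⟩∞ =
  ∃[ Ls ] Pointwise (λ x L → ⟨ x ⨾ q ⟩ ⟶ L) xs Ls × P ≈ foldr _*_ 1# Ls

-- Write u_n = 1/(q;q)_n.  A q-Vandermonde sum gives the limiting Bailey lemma
--   ∑_n q^(n²) β_n u_(N-n) = ∑_r q^(r²) α_r u_(N-r) u_(N+r)   if   β_n = ∑_r α_r u_(n-r) u_(n+r).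
-- The summand of the theorem is q^(n²) β_n for the β belonging to the terms
--   χ(r) q^(r(r-1)/2)   (r ∈ ℤ),   χ the quadratic character modulo 3:
-- this is a finite triple product at a primitive sixth root of unity, proved without that root
-- from a three-term recurrence in r.  The leading 1 comes from the unit pair
-- (-1)ʳ q^(r(r-1)/2), whose β_n is 1 at n = 0 and 0 otherwise.  Letting N → ∞,
--   (1 + S) (q;q)_∞ = ∑_(r ∈ ℤ) ((-1)ʳ + χ(r)) q^(r(3r-1)/2).
-- Modulo 6 the coefficient is 1, 0, 0, -1, 2, -2, so r ≡ 0 (3), r ≡ 5 (6) and r ≡ 4 (6) give three
-- theta series, which the triple product identity turns into the products A, -2q²B and 2q⁷C.
-- Limits are taken in an abstract complete normed ring, of which ℂ is an instance.

module Submission where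

open import Algebra.Bundles using (CommutativeRing; Semiring)
import Algebra.Properties.Semiring.Exp as Exp
open import Data.List.Base using ([]; _∷_; foldr)
open import Data.Nat.Base as ℕ using (ℕ; zero; suc)
open import Data.Product using (_×_; _,_; ∃-syntax; proj₁; proj₂)
open import Data.Rational.Base as ℚ using (ℚ; 0ℚ; 1ℚ; ½)
open import Level using (0ℓ) renaming (suc to lsuc)

-- The cubes arise from (1 - q^(j+1) + q^(2j+2)) (1 + q^(j+1)) = 1 + q^(3j+3): the quotient of
-- (-q^3;q^3)_(n-1) by (-q;q)_(n-1) is a product of factors 1 + Λ q^j + q^2 q^(2j) with Λ = -q. For
-- Λ = -(x + y q) and x y = q the same factor is (1 - x q^j) (1 - y q^(j+1)), the one of the triple
-- product. Only Λ enters the induction in `ThreeTerm`, which therefore serves both. Every two-sided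
-- sum is folded onto ℕ: r with -r for the Bailey pairs, s with -1-s for the theta series and for
-- `ThreeTerm`. The symmetries turn into boundary conditions at index 0, and changing from one
-- folding to the other leaves a single unpaired term. Index differences are truncated, and `û`
-- vanishes where the true difference is negative; the degenerate cases then hold because a factor
-- is zero on both sides. The algebra assumes inverses of 1 - q^n only; 1 + q^n is inverted through
-- 1 - q^(2n).

module IntSolver {c ℓ} (R : CommutativeRing c ℓ) where

  open import Algebra.Solver.Ring.AlmostCommutativeRing
    using (fromCommutativeRing; _-Raw-AlmostCommutative⟶_)
  open import Data.Integer.Base as ℤ using (ℤ; +_; -[1+_])
  import Data.Integer.Properties as ℤₚ
  open import Data.Nat.Base as ℕ using (ℕ; zero; suc)
  import Data.Nat.Properties as ℕₚ
  open import Data.Maybe.Base using (Maybe; just; nothing)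
  open import Relation.Nullary using (yes; no)
  import Relation.Binary.PropositionalEquality as ≡
  open CommutativeRing R
  open import Algebra.Properties.Ring ring
    using (-0#≈0#; -‿involutive; -‿distribˡ-*; -‿distribʳ-*)
  open import Algebra.Properties.AbelianGroup +-abelianGroup
    using () renaming (⁻¹-∙-comm to -‿+-comm)
  open import Algebra.Properties.Semiring.Mult.TCOptimised semiring
    using (×-homo-+; ×1-homo-*; 1+×) renaming (_×_ to _×ᴿ_)
  open import Relation.Binary.Reasoning.Setoid setoid

  private
    ι : ℕ → Carrier
    ι n = n ×ᴿ 1#

    φ : ℤ → Carrier
    φ (+ n)    = ι n
    φ -[1+ n ] = - ι (suc n)

    φ-neg : ∀ i → φ (ℤ.- i) ≈ - φ i
    φ-neg (+ zero)  = sym -0#≈0#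
    φ-neg (+ suc n) = refl
    φ-neg -[1+ n ]  = sym (-‿involutive _)

    cancel-suc : ∀ m n → ι m - ι n ≈ ι (suc m) - ι (suc n)
    cancel-suc m n = sym (begin
      ι (suc m) - ι (suc n)              ≈⟨ +-cong (1+× m 1#) (-‿cong (1+× n 1#)) ⟩
      (1# + ι m) - (1# + ι n)            ≈⟨ +-cong (+-comm 1# (ι m)) (sym (-‿+-comm 1# (ι n))) ⟩
      (ι m + 1#) + (- 1# - ι n)          ≈⟨ +-assoc (ι m) 1# _ ⟩
      ι m + (1# + (- 1# - ι n))          ≈⟨ +-congˡ (sym (+-assoc 1# (- 1#) _)) ⟩
      ι m + ((1# - 1#) - ι n)            ≈⟨ +-congˡ (+-congʳ (-‿inverseʳ 1#)) ⟩
      ι m + (0# - ι n)                   ≈⟨ +-congˡ (+-identityˡ _) ⟩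
      ι m - ι n ∎)

    φ-⊖ : ∀ m n → φ (m ℤ.⊖ n) ≈ ι m - ι n
    φ-⊖ m zero = begin
      φ (m ℤ.⊖ 0) ≡⟨ ≡.cong φ (ℤₚ.⊖-≥ {m} ℕ.z≤n) ⟩
      ι m         ≈⟨ sym (+-identityʳ _) ⟩
      ι m + 0#    ≈⟨ +-congˡ (sym -0#≈0#) ⟩
      ι m - 0#    ∎
    φ-⊖ zero (suc n) = sym (+-identityˡ _)
    φ-⊖ (suc m) (suc n) = begin
      φ (suc m ℤ.⊖ suc n)   ≡⟨ ≡.cong φ (ℤₚ.[1+m]⊖[1+n]≡m⊖n m n) ⟩
      φ (m ℤ.⊖ n)           ≈⟨ φ-⊖ m n ⟩
      ι m - ι n             ≈⟨ cancel-suc m n ⟩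
      ι (suc m) - ι (suc n) ∎

    φ-+ : ∀ i j → φ (i ℤ.+ j) ≈ φ i + φ j
    φ-+ (+ m)    (+ n)    = ×-homo-+ 1# m n
    φ-+ (+ m)    -[1+ n ] = φ-⊖ m (suc n)
    φ-+ -[1+ m ] (+ n)    = trans (φ-⊖ n (suc m)) (+-comm _ _)
    φ-+ -[1+ m ] -[1+ n ] = begin
      - ι (suc (suc (m ℕ.+ n)))   ≡⟨ ≡.cong (λ k → - ι (suc k)) (≡.sym (ℕₚ.+-suc m n)) ⟩
      - ι (suc m ℕ.+ suc n)       ≈⟨ -‿cong (×-homo-+ 1# (suc m) (suc n)) ⟩
      - (ι (suc m) + ι (suc n))   ≈⟨ sym (-‿+-comm _ _) ⟩
      - ι (suc m) - ι (suc n)     ∎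

    φ-pos* : ∀ m j → φ (+ m ℤ.* j) ≈ ι m * φ j
    φ-pos* m (+ n) = trans (reflexive (≡.cong φ (≡.sym (ℤₚ.pos-* m n)))) (×1-homo-* m n)
    φ-pos* m -[1+ n ] = begin
      φ (+ m ℤ.* -[1+ n ])       ≡⟨ ≡.cong φ (≡.sym (ℤₚ.neg-distribʳ-* (+ m) (+ suc n))) ⟩
      φ (ℤ.- (+ m ℤ.* + suc n))  ≈⟨ φ-neg (+ m ℤ.* + suc n) ⟩
      - φ (+ m ℤ.* + suc n)      ≈⟨ -‿cong (φ-pos* m (+ suc n)) ⟩
      - (ι m * ι (suc n))        ≈⟨ -‿distribʳ-* _ _ ⟩
      ι m * - ι (suc n)          ∎

    φ-* : ∀ i j → φ (i ℤ.* j) ≈ φ i * φ j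
    φ-* (+ m) j = φ-pos* m j
    φ-* -[1+ m ] j = begin
      φ (-[1+ m ] ℤ.* j)         ≡⟨ ≡.cong φ (≡.sym (ℤₚ.neg-distribˡ-* (+ suc m) j)) ⟩
      φ (ℤ.- (+ suc m ℤ.* j))    ≈⟨ φ-neg (+ suc m ℤ.* j) ⟩
      - φ (+ suc m ℤ.* j)        ≈⟨ -‿cong (φ-pos* (suc m) j) ⟩
      - (ι (suc m) * φ j)        ≈⟨ -‿distribˡ-* _ _ ⟩
      - ι (suc m) * φ j          ∎

    morphism : ℤ.+-*-rawRing -Raw-AlmostCommutative⟶ fromCommutativeRing R
    morphism = record
      { ⟦_⟧ = φ ; +-homo = φ-+ ; *-homo = φ-* ; -‿homo = φ-neg
      ; 0-homo = refl ; 1-homo = refl }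

    -- Equality in the ring is undecidable, so numerals are compared as integers. Answering
    -- `nothing` for distinct integers stays sound even if their images agree.
    _≟φ_ : ∀ i j → Maybe (φ i ≈ φ j)
    i ≟φ j with i ℤₚ.≟ j
    ... | yes eq = just (reflexive (≡.cong φ eq))
    ... | no  _  = nothing

  open import Algebra.Solver.Ring ℤ.+-*-rawRing (fromCommutativeRing R) morphism _≟φ_
    public

  :1 : ∀ {n} → Polynomial n
  :1 = con (+ 1)

-- Finite sums and products.

module Sums {c ℓ} (R : CommutativeRing c ℓ) where

  open import Algebra.Definitions.RawSemiring (Semiring.rawSemiring (CommutativeRing.semiring R)) using (sum; product)
  open import Data.Fin.Base using (toℕ)
  open import Data.Nat.Base as ℕ using (ℕ; zero; suc; _<_)
  import Data.Nat.Properties as ℕₚ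
  import Relation.Binary.PropositionalEquality as ≡
  open CommutativeRing R
  open import Algebra.Properties.CommutativeSemigroup +-commutativeSemigroup using (interchange)
  open import Algebra.Properties.CommutativeSemigroup *-commutativeSemigroup
    using () renaming (interchange to *-interchange)
  open import Algebra.Properties.Ring ring using (-0#≈0#)
  open import Algebra.Properties.AbelianGroup +-abelianGroup
    using () renaming (⁻¹-∙-comm to -‿+-comm)
  open import Relation.Binary.Reasoning.Setoid setoid

  -- Unfolds at the last term, the direction in which partial sums grow. The library's `sum` unfolds
  -- at index 0; `sum≈Σ` mediates.
  Σ : ℕ → (ℕ → Carrier) → Carrier
  Σ zero    f = 0#
  Σ (suc n) f = Σ n f + f n

  Π : ℕ → (ℕ → Carrier) → Carrier
  Π zero    f = 1#
  Π (suc n) f = Π n f * f n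

  Σ-cong< : ∀ n {f g} → (∀ k → k < n → f k ≈ g k) → Σ n f ≈ Σ n g
  Σ-cong< zero    eq = refl
  Σ-cong< (suc n) eq =
    +-cong (Σ-cong< n (λ k k<n → eq k (ℕₚ.m<n⇒m<1+n k<n))) (eq n (ℕₚ.n<1+n n))

  Σ-cong : ∀ n {f g} → (∀ k → f k ≈ g k) → Σ n f ≈ Σ n g
  Σ-cong n eq = Σ-cong< n (λ k _ → eq k)

  Π-cong : ∀ n {f g} → (∀ k → f k ≈ g k) → Π n f ≈ Π n g
  Π-cong zero    eq = refl
  Π-cong (suc n) eq = *-cong (Π-cong n eq) (eq n)

  Π-* : ∀ n f g → Π n f * Π n g ≈ Π n (λ k → f k * g k)
  Π-* zero    f g = *-identityˡ 1#
  Π-* (suc n) f g = trans (*-interchange (Π n f) (f n) (Π n g) (g n)) (*-congʳ (Π-* n f g))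

  Σ-+ : ∀ n f g → Σ n f + Σ n g ≈ Σ n (λ k → f k + g k)
  Σ-+ zero    f g = +-identityˡ 0#
  Σ-+ (suc n) f g = trans (interchange (Σ n f) (f n) (Σ n g) (g n)) (+-congʳ (Σ-+ n f g))

  Σ-neg : ∀ n f → - Σ n f ≈ Σ n (λ k → - f k)
  Σ-neg zero    f = -0#≈0#
  Σ-neg (suc n) f = trans (sym (-‿+-comm (Σ n f) (f n))) (+-congʳ (Σ-neg n f))

  Σ-*ˡ : ∀ n x f → x * Σ n f ≈ Σ n (λ k → x * f k)
  Σ-*ˡ zero    x f = zeroʳ x
  Σ-*ˡ (suc n) x f = trans (distribˡ x (Σ n f) (f n)) (+-congʳ (Σ-*ˡ n x f))

  Σ-*ʳ : ∀ n x f → Σ n f * x ≈ Σ n (λ k → f k * x)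
  Σ-*ʳ zero    x f = zeroˡ x
  Σ-*ʳ (suc n) x f = trans (distribʳ x (Σ n f) (f n)) (+-congʳ (Σ-*ʳ n x f))

  Σ-head : ∀ n f → Σ (suc n) f ≈ f 0 + Σ n (λ k → f (suc k))
  Σ-head zero    f = +-comm 0# (f 0)
  Σ-head (suc n) f = trans (+-congʳ (Σ-head n f)) (+-assoc (f 0) _ (f (suc n)))

  Π-head : ∀ n f → Π (suc n) f ≈ f 0 * Π n (λ k → f (suc k))
  Π-head zero    f = *-comm 1# (f 0)
  Π-head (suc n) f = trans (*-congʳ (Π-head n f)) (*-assoc (f 0) _ (f (suc n)))

  sum≈Σ : ∀ n f → sum {n} (λ i → f (toℕ i)) ≈ Σ n f
  sum≈Σ zero    f = refl
  sum≈Σ (suc n) f = trans (+-congˡ (sum≈Σ n (λ k → f (suc k)))) (sym (Σ-head n f))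

  product≈Π : ∀ n f → product {n} (λ i → f (toℕ i)) ≈ Π n f
  product≈Π zero    f = refl
  product≈Π (suc n) f = trans (*-congˡ (product≈Π n (λ k → f (suc k)))) (sym (Π-head n f))

  -- The triangle r ≤ n < N is summed by columns, with n = r + j. In the induction the new row adds
  -- one entry to every old column and opens a column with a single entry.
  Σ-triangle : ∀ N (f : ℕ → ℕ → Carrier) →
    Σ N (λ n → Σ (suc n) (λ r → f n r)) ≈ Σ N (λ r → Σ (N ℕ.∸ r) (λ j → f (r ℕ.+ j) r))
  Σ-triangle zero    f = refl
  Σ-triangle (suc N) f = begin
    Σ N (λ n → Σ (suc n) (f n)) + Σ (suc N) (f N)
      ≈⟨ +-congʳ (Σ-triangle N f) ⟩
    Σ N (column N) + (Σ N (f N) + f N N)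
      ≈⟨ sym (+-assoc (Σ N (column N)) _ _) ⟩
    (Σ N (column N) + Σ N (f N)) + f N N
      ≈⟨ +-cong (trans (Σ-+ N (column N) (f N)) (Σ-cong< N (λ r r<N → sym (grow r r<N)))) last ⟩
    Σ N (column (suc N)) + column (suc N) N ∎
    where
    column : ℕ → ℕ → Carrier
    column M r = Σ (M ℕ.∸ r) (λ j → f (r ℕ.+ j) r)
    grow : ∀ r → r < N → column (suc N) r ≈ column N r + f N r
    grow r r<N = begin
      Σ (suc N ℕ.∸ r) (λ j → f (r ℕ.+ j) r)
        ≡⟨ ≡.cong (λ k → Σ k (λ j → f (r ℕ.+ j) r)) (ℕₚ.+-∸-assoc 1 (ℕₚ.<⇒≤ r<N)) ⟩
      column N r + f (r ℕ.+ (N ℕ.∸ r)) r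
        ≡⟨ ≡.cong (λ k → column N r + f k r) (ℕₚ.m+[n∸m]≡n (ℕₚ.<⇒≤ r<N)) ⟩
      column N r + f N r ∎
    last : f N N ≈ column (suc N) N
    last = begin
      f N N            ≈⟨ sym (+-identityˡ _) ⟩
      0# + f N N       ≡⟨ ≡.cong (λ k → 0# + f k N) (≡.sym (ℕₚ.+-identityʳ N)) ⟩
      0# + f (N ℕ.+ 0) N  ≡⟨ ≡.cong (λ k → Σ k (λ j → f (N ℕ.+ j) N)) (≡.sym (ℕₚ.m+n∸n≡m 1 N)) ⟩
      column (suc N) N ∎

-- Exponents and coefficient sequences; `tri n` is n(n-1)/2.

tri : ℕ → ℕ
tri zero    = 0
tri (suc n) = n ℕ.+ tri n

module Exponents where

  open import Data.Nat.Base using (_+_; _*_)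
  open import Data.Nat.Solver using (module +-*-Solver)
  open import Relation.Binary.PropositionalEquality using (_≡_; refl)
  open +-*-Solver

  rotate : ∀ a b c → a + b + c ≡ c + a + b
  rotate = solve 3 (λ a b c → a :+ b :+ c := c :+ a :+ b) refl

  square-shift : ∀ i s d →
    suc i * suc i + s * suc i + d ≡ suc (d + i + s) + (i * i + suc s * i)
  square-shift = solve 3 (λ i s d →
    (con 1 :+ i) :* (con 1 :+ i) :+ s :* (con 1 :+ i) :+ d
    := con 1 :+ (d :+ i :+ s) :+ (i :* i :+ (con 1 :+ s) :* i)) refl

  square-+ : ∀ r j → (r + j) * (r + j) ≡ r * r + (j * j + (r + r) * j)
  square-+ = solve 2 (λ r j →
    (r :+ j) :* (r :+ j) := r :* r :+ (j :* j :+ (r :+ r) :* j)) refl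

module Coefficients {a ℓ} (R : CommutativeRing a ℓ) where

  open CommutativeRing R
  open Exp semiring using (_^_)

  -- Inverses enter as data, so the algebra works in any commutative ring. The index is shifted by
  -- one to leave out the zero factor 1 - q^0.
  InvertsOneMinusPowers : Carrier → (ℕ → Carrier) → Set ℓ
  InvertsOneMinusPowers q inv = ∀ n → (1# - q ^ suc n) * inv n ≈ 1#

  sgn : ℕ → Carrier
  sgn zero    = 1#
  sgn (suc n) = - sgn n

  χ : ℕ → Carrier
  χ 0 = 0#
  χ 1 = 1#
  χ 2 = - 1#
  χ (suc (suc (suc n))) = χ n

  thetaCoeff : Carrier → Carrier → Carrier → ℕ → Carrier
  thetaCoeff x y p s = sgn s * (x ^ s - y ^ suc s * p ^ s)

  -- The terms of index s and -1-s of the two-sided series ∑ (-1)ʳ xʳ p^(r(r-1)/2), where p = x y.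
  theta : Carrier → Carrier → Carrier → ℕ → Carrier
  theta x y p s = p ^ tri s * thetaCoeff x y p s

-- Finite q-series identities: triple product, Vandermonde sum, Bailey pairs.

module QIdentities {a ℓ} (R : CommutativeRing a ℓ)
  (q : CommutativeRing.Carrier R) (inv : ℕ → CommutativeRing.Carrier R)
  (inv-spec : Coefficients.InvertsOneMinusPowers R q inv) where

  open CommutativeRing R
  open import Data.Nat.Base using (_<_; _≤_; s≤s)
  open import Data.Integer.Base using (0ℤ)
  import Data.Nat.Properties as ℕₚ
  open import Data.Sum.Base using (inj₁; inj₂)
  open import Relation.Binary.PropositionalEquality as ≡ using (_≡_)
  open import Relation.Nullary using (yes; no)
  open Exp semiring using (_^_; ^-homo-*; ^-congʳ; ^-assocʳ)
  open import Relation.Binary.Reasoning.Setoid setoid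
  open IntSolver R
  open Sums R
  open Coefficients R

  u : ℕ → Carrier
  u zero    = 1#
  u (suc n) = u n * inv n

  -- u at the integer m − s; by convention u vanishes at negative integers.
  û : ℕ → ℕ → Carrier
  û m       zero    = u m
  û zero    (suc s) = 0#
  û (suc m) (suc s) = û m s

  u-step : ∀ n → u n ≈ (1# - q ^ suc n) * u (suc n)
  u-step n = begin
    u n                               ≈⟨ sym (*-identityʳ _) ⟩
    u n * 1#                          ≈⟨ *-congˡ (sym (inv-spec n)) ⟩
    u n * ((1# - q ^ suc n) * inv n)  ≈⟨ solve 3 (λ a b c → a :* (b :* c) := b :* (a :* c)) refl (u n) _ _ ⟩
    (1# - q ^ suc n) * (u n * inv n)  ∎

  -- At s = m the factor is 1 - q^0 = 0, and beyond it `û` is zero on both sides; the truncated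
  -- difference thus agrees with the convention for `û`.
  û-step : ∀ m s → û m (suc s) ≈ (1# - q ^ (m ℕ.∸ s)) * û m s
  û-step zero zero = solve 0 (con 0ℤ := (:1 :- :1) :* :1) refl
  û-step zero (suc s) = sym (zeroʳ _)
  û-step (suc m) zero = u-step m
  û-step (suc m) (suc s) = û-step m s

  û-above : ∀ m s → m < s → û m s ≈ 0#
  û-above zero    (suc s) _       = refl
  û-above (suc m) (suc s) (s≤s p) = û-above m s p

  û-+ : ∀ t d → û (t ℕ.+ d) t ≡ u d
  û-+ zero    d = ≡.refl
  û-+ (suc t) d = û-+ t d

  pow-≡ : ∀ {m n} → m ≡ n → q ^ m ≈ q ^ n
  pow-≡ = ^-congʳ q

  cancel : ∀ n {x y} → (1# - q ^ suc n) * x ≈ (1# - q ^ suc n) * y → x ≈ y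
  cancel n {x} {y} eq = begin
    x                                    ≈⟨ unfold x ⟩
    inv n * ((1# - q ^ suc n) * x)       ≈⟨ *-congˡ eq ⟩
    inv n * ((1# - q ^ suc n) * y)       ≈⟨ sym (unfold y) ⟩
    y                                    ∎
    where
    unfold : ∀ z → z ≈ inv n * ((1# - q ^ suc n) * z)
    unfold z = begin
      z                                ≈⟨ sym (*-identityˡ z) ⟩
      1# * z                           ≈⟨ *-congʳ (sym (inv-spec n)) ⟩
      (1# - q ^ suc n) * inv n * z     ≈⟨ solve 3 (λ a b c → a :* b :* c := b :* (a :* c)) refl _ _ z ⟩
      inv n * ((1# - q ^ suc n) * z)   ∎

  private
    -- The q-binomial coefficient of 2m+1 over m-s, divided by (q;q)_(2m+1). It is invariant under s
    -- ↔ -1-s.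
    b : ℕ → ℕ → Carrier
    b m s = û m s * u (suc (m ℕ.+ s))

    -- (1 - q^(2m+2)) (1 - q^(2m+3)), the quotient of `u` at 2m+1 by `u` at 2m+3, written as a
    -- polynomial in q and `q ^ m` for the ring solver.
    E : ℕ → Carrier
    E m = (1# - q * (q * (q ^ m * q ^ m))) * (1# - q * (q * (q * (q ^ m * q ^ m))))

  private
    E-pow : ∀ m → E m ≈ (1# - q ^ suc (suc (m ℕ.+ m))) * (1# - q ^ suc (suc (suc (m ℕ.+ m))))
    E-pow m = *-cong (+-congˡ (-‿cong (*-congˡ (*-congˡ qᵐᵐ)))) (+-congˡ (-‿cong (*-congˡ (*-congˡ (*-congˡ qᵐᵐ)))))
      where
      qᵐᵐ : q ^ m * q ^ m ≈ q ^ (m ℕ.+ m)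
      qᵐᵐ = sym (^-homo-* q m m)

    E-cancel : ∀ m {x y} → E m * x ≈ E m * y → x ≈ y
    E-cancel m {x} {y} eq = cancel (suc (suc (m ℕ.+ m))) (cancel (suc (m ℕ.+ m)) (begin
      _ * (_ * x)   ≈⟨ sym (*-assoc _ _ x) ⟩
      _ * _ * x     ≈⟨ *-congʳ (sym (E-pow m)) ⟩
      E m * x       ≈⟨ eq ⟩
      E m * y       ≈⟨ *-congʳ (E-pow m) ⟩
      _ * _ * y     ≈⟨ *-assoc _ _ y ⟩
      _ * (_ * y)   ∎))

    u-E : ∀ m → u (suc (m ℕ.+ m)) ≈ E m * u (suc (suc m ℕ.+ suc m))
    u-E m = begin
      u (suc (m ℕ.+ m))       ≈⟨ trans (u-step _) (*-congˡ (u-step _)) ⟩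
      _ * (_ * u (suc (suc (suc (m ℕ.+ m)))))
        ≈⟨ sym (*-assoc _ _ _) ⟩
      _ * _ * u (suc (suc (suc (m ℕ.+ m))))
        ≈⟨ *-cong (sym (E-pow m)) (reflexive (≡.cong (λ k → u (suc (suc k))) (≡.sym (ℕₚ.+-suc m m)))) ⟩
      E m * u (suc (suc m ℕ.+ suc m)) ∎

  -- The Pascal rule applied twice to the q-binomial coefficient of 2m+3 over m-t.
  b-recurrence : ∀ m t → t ≤ m →
    E m * b (suc m) (suc t) ≈
      (1# + q * (q * (q ^ m * q ^ m))) * b m (suc t)
      + q * (q * (q * (q ^ m * q ^ t))) * b m (suc (suc t)) + q ^ (m ℕ.∸ t) * b m t
  b-recurrence m t t≤m = begin
    E m * b (suc m) (suc t)
      ≈⟨ *-cong (*-cong (+-congˡ (-‿cong (*-congˡ (*-congˡ (*-cong qᵐ qᵐ))))) (+-congˡ (-‿cong (*-congˡ (*-congˡ (*-congˡ (*-cong qᵐ qᵐ)))))))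
                (*-congˡ (reflexive (≡.cong u (≡.cong (λ k → suc (suc k)) (ℕₚ.+-suc m t))))) ⟩
    (1# - q * (q * ((P * Z) * (P * Z)))) * (1# - q * (q * (q * ((P * Z) * (P * Z))))) * (X * Y)
      ≈⟨ solve 5 (λ q P Z X Y → let W = q :* (q :* (P :* (Z :* Z))) in
           (:1 :- q :* (q :* ((P :* Z) :* (P :* Z)))) :* (:1 :- q :* (q :* (q :* ((P :* Z) :* (P :* Z))))) :* (X :* Y)
           := (:1 :+ P :* W) :* (((:1 :- P) :* X) :* ((:1 :- q :* W) :* Y))
              :+ (W :* (q :* (:1 :- P) :- (:1 :- P) :* P) :* (X :* Y)
                  :+ P :* (X :* ((:1 :- W) :* ((:1 :- q :* W) :* Y))))) refl q P Z X Y ⟩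
    (1# + P * W) * (((1# - P) * X) * ((1# - q * W) * Y))
      + (W * (q * (1# - P) - (1# - P) * P) * (X * Y) + P * (X * ((1# - W) * ((1# - q * W) * Y))))
      ≈⟨ +-cong
           (*-cong (+-congˡ PW) (sym (*-cong (û-step m t) u-suc)))
           (+-cong middle (*-congˡ (*-congˡ (sym (trans (u-+suc′ W₁) (*-congˡ (u-+suc′ qW))))))) ⟩
    (1# + q * (q * (q ^ m * q ^ m))) * b m (suc t)
      + (q * (q * (q * (q ^ m * q ^ t))) * b m (suc (suc t)) + P * b m t)
      ≈⟨ sym (+-assoc _ _ _) ⟩
    (1# + q * (q * (q ^ m * q ^ m))) * b m (suc t)
      + q * (q * (q * (q ^ m * q ^ t))) * b m (suc (suc t)) + P * b m t ∎
    where
    X = û m t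
    Y = u (suc (suc (suc (m ℕ.+ t))))
    P = q ^ (m ℕ.∸ t)
    P′ = q ^ (m ℕ.∸ suc t)
    Z = q ^ t
    W = q * (q * (P * (Z * Z)))
    qᵐ : q ^ m ≈ P * Z
    qᵐ = trans (pow-≡ (≡.sym (ℕₚ.m∸n+n≡m t≤m))) (^-homo-* q (m ℕ.∸ t) t)
    PW : P * W ≈ q * (q * (q ^ m * q ^ m))
    PW = trans
      (solve 3 (λ q P Z → P :* (q :* (q :* (P :* (Z :* Z)))) := q :* (q :* ((P :* Z) :* (P :* Z)))) refl q P Z)
      (sym (*-congˡ (*-congˡ (*-cong qᵐ qᵐ))))
    qᵐᵗ : P * (Z * Z) ≈ q ^ (m ℕ.+ t)
    qᵐᵗ = trans (sym (*-assoc P Z Z)) (trans (*-congʳ (sym qᵐ)) (sym (^-homo-* q m t)))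
    W₁ : W ≈ q ^ suc (suc (m ℕ.+ t))
    W₁ = *-congˡ (*-congˡ qᵐᵗ)
    qW : q * W ≈ q ^ suc (suc (suc (m ℕ.+ t)))
    qW = *-congˡ W₁
    u-+suc′ : ∀ {n x} → x ≈ q ^ suc n → u n ≈ (1# - x) * u (suc n)
    u-+suc′ {n} eq = trans (u-step n) (*-congʳ (+-congˡ (-‿cong (sym eq))))
    u-suc : u (suc (m ℕ.+ suc t)) ≈ (1# - q * W) * Y
    u-suc = trans (reflexive (≡.cong (λ k → u (suc k)) (ℕₚ.+-suc m t))) (u-+suc′ qW)
    -- P = q P′ fails at t = m, where truncation gives P′ = 1; but there 1 - P = 0. The solver step
    -- above keeps the factor 1 - P unexpanded for this purpose.
    vanish : (1# - P) * (q * P′) ≈ (1# - P) * P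
    vanish with ℕₚ.m≤n⇒m<n∨m≡n t≤m
    ... | inj₁ t<m = *-congˡ (sym (pow-≡ (ℕₚ.+-∸-assoc 1 t<m)))
    ... | inj₂ ≡.refl = trans (*-congʳ 1-P≈0) (trans (zeroˡ _) (sym (trans (*-congʳ 1-P≈0) (zeroˡ _))))
      where
      1-P≈0 : 1# - P ≈ 0#
      1-P≈0 = trans (+-congˡ (-‿cong (pow-≡ (ℕₚ.n∸n≡0 t)))) (-‿inverseʳ 1#)
    middle : W * (q * (1# - P) - (1# - P) * P) * (X * Y)
      ≈ q * (q * (q * (q ^ m * q ^ t))) * b m (suc (suc t))
    middle = begin
      W * (q * (1# - P) - (1# - P) * P) * (X * Y)
        ≈⟨ *-congʳ (*-congˡ (+-congˡ (-‿cong (sym vanish)))) ⟩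
      W * (q * (1# - P) - (1# - P) * (q * P′)) * (X * Y)
        ≈⟨ solve 6 (λ q P Z P′ X Y → let W = q :* (q :* (P :* (Z :* Z))) in
             W :* (q :* (:1 :- P) :- (:1 :- P) :* (q :* P′)) :* (X :* Y)
             := q :* (q :* (q :* ((P :* Z) :* Z))) :* (((:1 :- P′) :* ((:1 :- P) :* X)) :* Y)) refl q P Z P′ X Y ⟩
      q * (q * (q * ((P * Z) * Z))) * (((1# - P′) * ((1# - P) * X)) * Y)
        ≈⟨ *-cong (*-congˡ (*-congˡ (*-congˡ (*-congʳ (sym qᵐ)))))
             (*-cong (sym (trans (û-step m (suc t)) (*-congˡ (û-step m t))))
                     (reflexive (≡.cong (λ k → u (suc k)) (≡.sym (≡.trans (ℕₚ.+-suc m (suc t)) (≡.cong suc (ℕₚ.+-suc m t))))))) ⟩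
      q * (q * (q * (q ^ m * q ^ t))) * b m (suc (suc t)) ∎

  -- The previous recurrence at t = -1: the neighbour at index -1 equals `b m 0` by the symmetry s ↔
  -- -1-s, and its weight is q^(m+1).
  b-recurrence₀ : ∀ m →
    E m * b (suc m) 0 ≈
      (1# + q * (q * (q ^ m * q ^ m))) * b m 0 + q * (q * q ^ m) * b m 1 + q * q ^ m * b m 0
  b-recurrence₀ m = begin
    E m * (X * u (suc (suc m ℕ.+ 0)))
      ≈⟨ *-congˡ (*-congˡ (reflexive (≡.cong (λ k → u (suc (suc k))) (ℕₚ.+-identityʳ m)))) ⟩
    E m * (X * Y)
      ≈⟨ solve 4 (λ q P X Y →
           (:1 :- q :* (q :* (P :* P))) :* (:1 :- q :* (q :* (q :* (P :* P)))) :* (X :* Y)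
           := (:1 :+ q :* (q :* (P :* P))) :* (((:1 :- q :* P) :* X) :* ((:1 :- q :* (q :* P)) :* Y))
              :+ q :* (q :* P) :* (((:1 :- P) :* ((:1 :- q :* P) :* X)) :* Y)
              :+ q :* P :* (((:1 :- q :* P) :* X) :* ((:1 :- q :* (q :* P)) :* Y))) refl q P X Y ⟩
    (1# + q * (q * (P * P))) * (((1# - q * P) * X) * ((1# - q * (q * P)) * Y))
      + q * (q * P) * (((1# - P) * ((1# - q * P) * X)) * Y)
      + q * P * (((1# - q * P) * X) * ((1# - q * (q * P)) * Y))
      ≈⟨ +-cong (+-cong (*-congˡ b₀) (*-congˡ b₁)) (*-congˡ b₀) ⟩
    (1# + q * (q * (P * P))) * b m 0 + q * (q * P) * b m 1 + q * P * b m 0 ∎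
    where
    X = u (suc m)
    Y = u (suc (suc m))
    P = q ^ m
    b₀ : ((1# - q * P) * X) * ((1# - q * (q * P)) * Y) ≈ b m 0
    b₀ = *-cong (sym (u-step m))
      (trans (sym (u-step (suc m))) (reflexive (≡.cong (λ k → u (suc k)) (≡.sym (ℕₚ.+-identityʳ m)))))
    b₁ : ((1# - P) * ((1# - q * P) * X)) * Y ≈ b m 1
    b₁ = *-cong (sym (trans (û-step m 0) (*-congˡ (u-step m))))
      (reflexive (≡.cong (λ k → u (suc k)) (≡.sym (ℕₚ.+-comm m 1))))

  -- γ satisfies a linear recurrence with characteristic polynomial z^2 - Λ z + q^2. `γ₀` is the
  -- same recurrence at s = -1 with γ(-1) read as γ(0)/q, cleared of the division; it encodes the
  -- folding of s with -1-s.
  module ThreeTerm (γ : ℕ → Carrier) (Λ : Carrier)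
    (γ₀ : γ 1 + q * γ 0 ≈ Λ * γ 0)
    (γ₊ : ∀ s → γ (suc (suc s)) + q * (q * γ s) ≈ Λ * γ (suc s)) where

    F : ℕ → Carrier
    F m = Σ (suc m) (λ s → q ^ tri s * γ s * b m s)

    private
      w : ℕ → ℕ → Carrier
      w m s = q ^ tri s * b m s

      w-above : ∀ m s → m < s → w m s ≈ 0#
      w-above m s m<s = trans (*-congˡ (trans (*-congʳ (û-above m s m<s)) (zeroˡ _))) (zeroʳ _)

      term₀ : ∀ m → E m * (q ^ tri 0 * γ 0 * b (suc m) 0)
        ≈ (1# + q * (q * (q ^ m * q ^ m))) * (γ 0 * w m 0)
          + q ^ m * (q * (q * γ 0) * w m 1) + q ^ m * (q * γ 0 * w m 0)
      term₀ m = begin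
        E m * (1# * γ 0 * b (suc m) 0)
          ≈⟨ solve 3 (λ e g b → e :* (:1 :* g :* b) := g :* (e :* b)) refl (E m) (γ 0) (b (suc m) 0) ⟩
        γ 0 * (E m * b (suc m) 0) ≈⟨ *-congˡ (b-recurrence₀ m) ⟩
        γ 0 * ((1# + q * (q * (q ^ m * q ^ m))) * b m 0 + q * (q * q ^ m) * b m 1 + q * q ^ m * b m 0)
          ≈⟨ solve 5 (λ q P g b₀ b₁ →
               g :* ((:1 :+ q :* (q :* (P :* P))) :* b₀ :+ q :* (q :* P) :* b₁ :+ q :* P :* b₀)
               := (:1 :+ q :* (q :* (P :* P))) :* (g :* (:1 :* b₀))
                  :+ P :* (q :* (q :* g) :* (:1 :* b₁)) :+ P :* (q :* g :* (:1 :* b₀)))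
               refl q (q ^ m) (γ 0) (b m 0) (b m 1) ⟩
        (1# + q * (q * (q ^ m * q ^ m))) * (γ 0 * w m 0)
          + q ^ m * (q * (q * γ 0) * w m 1) + q ^ m * (q * γ 0 * w m 0) ∎

      -- The weight q^(tri s) is chosen for this step: it absorbs the powers q^t and q^(m-t) of
      -- `b-recurrence`, so that both neighbours appear with the same factor q^m, whatever t is.
      term₊ : ∀ m t → t ≤ m → E m * (q ^ tri (suc t) * γ (suc t) * b (suc m) (suc t))
        ≈ (1# + q * (q * (q ^ m * q ^ m))) * (γ (suc t) * w m (suc t))
          + q ^ m * (q * (q * γ (suc t)) * w m (suc (suc t))) + q ^ m * (γ (suc t) * w m t)
      term₊ m t t≤m = begin
        E m * (q ^ (t ℕ.+ tri t) * G * b (suc m) (suc t))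
          ≈⟨ solve 4 (λ e T g b → e :* (T :* g :* b) := T :* g :* (e :* b)) refl (E m) _ G (b (suc m) (suc t)) ⟩
        q ^ (t ℕ.+ tri t) * G * (E m * b (suc m) (suc t)) ≈⟨ *-congˡ (b-recurrence m t t≤m) ⟩
        q ^ (t ℕ.+ tri t) * G * ((1# + q * (q * (q ^ m * q ^ m))) * b₁
          + q * (q * (q * (q ^ m * q ^ t))) * b₂ + q ^ (m ℕ.∸ t) * b₀)
          ≈⟨ solve 9 (λ q P Z T′ M g b₀ b₁ b₂ →
               T′ :* g :* ((:1 :+ q :* (q :* (P :* P))) :* b₁ :+ q :* (q :* (q :* (P :* Z))) :* b₂ :+ M :* b₀)
               := (:1 :+ q :* (q :* (P :* P))) :* (g :* (T′ :* b₁))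
                  :+ P :* (q :* (q :* g) :* ((q :* (Z :* T′)) :* b₂)) :+ (T′ :* M) :* (g :* b₀))
               refl q (q ^ m) (q ^ t) (q ^ (t ℕ.+ tri t)) (q ^ (m ℕ.∸ t)) G b₀ b₁ b₂ ⟩
        (1# + q * (q * (q ^ m * q ^ m))) * (G * (q ^ (t ℕ.+ tri t) * b₁))
          + q ^ m * (q * (q * G) * ((q * (q ^ t * q ^ (t ℕ.+ tri t))) * b₂))
          + (q ^ (t ℕ.+ tri t) * q ^ (m ℕ.∸ t)) * (G * b₀)
          ≈⟨ +-cong (+-congˡ (*-congˡ (*-congˡ (*-congʳ (*-congˡ (sym (^-homo-* q t _))))))) last ⟩
        (1# + q * (q * (q ^ m * q ^ m))) * (G * w m (suc t))
          + q ^ m * (q * (q * G) * w m (suc (suc t))) + q ^ m * (G * w m t) ∎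
        where
        G = γ (suc t)
        b₀ = b m t
        b₁ = b m (suc t)
        b₂ = b m (suc (suc t))
        exponent : t ℕ.+ tri t ℕ.+ (m ℕ.∸ t) ≡ m ℕ.+ tri t
        exponent = ≡.trans
          (Exponents.rotate t (tri t) (m ℕ.∸ t))
          (≡.cong (ℕ._+ tri t) (ℕₚ.m∸n+n≡m t≤m))
        last : (q ^ (t ℕ.+ tri t) * q ^ (m ℕ.∸ t)) * (G * b₀) ≈ q ^ m * (G * w m t)
        last = begin
          (q ^ (t ℕ.+ tri t) * q ^ (m ℕ.∸ t)) * (G * b₀)
            ≈⟨ *-congʳ (trans (sym (^-homo-* q (t ℕ.+ tri t) _)) (trans (pow-≡ exponent) (^-homo-* q m (tri t)))) ⟩
          (q ^ m * q ^ tri t) * (G * b₀)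
            ≈⟨ solve 4 (λ P T g b → (P :* T) :* (g :* b) := P :* (g :* (T :* b))) refl _ _ G b₀ ⟩
          q ^ m * (G * w m t) ∎

    -- Collect the coefficient of each `w m s`. The contributions of the two neighbours carry the
    -- factor q^m and add up to Λ γ(s) by the recurrence of γ, with `γ₀` at s = 0; indices above m
    -- drop out since `w` vanishes there.
    F-recurrence : ∀ m → E m * F (suc m) ≈ (1# + Λ * q ^ m + q * (q * (q ^ m * q ^ m))) * F m
    F-recurrence m = begin
      E m * F (suc m)
        ≈⟨ *-congˡ (Σ-head (suc m) (λ s → q ^ tri s * γ s * b (suc m) s)) ⟩
      E m * (q ^ tri 0 * γ 0 * b (suc m) 0 + Σ (suc m) (λ t → q ^ tri (suc t) * γ (suc t) * b (suc m) (suc t)))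
        ≈⟨ trans (distribˡ _ _ _) (+-cong (term₀ m) (trans (Σ-*ˡ (suc m) _ _) (Σ-cong< (suc m) (λ { t (s≤s t≤m) → term₊ m t t≤m })))) ⟩
      (A * (γ 0 * w m 0) + P * (q * (q * γ 0) * w m 1) + P * (q * γ 0 * w m 0))
        + Σ (suc m) (λ t → A * (γ (suc t) * w m (suc t)) + P * (q * (q * γ (suc t)) * w m (suc (suc t))) + P * (γ (suc t) * w m t))
        ≈⟨ +-congˡ (trans (sym (Σ-+ (suc m) _ _)) (+-cong (trans (sym (Σ-+ (suc m) _ _)) (+-cong (sym (Σ-*ˡ (suc m) A _)) (sym (Σ-*ˡ (suc m) P _)))) (sym (Σ-*ˡ (suc m) P _)))) ⟩
      (A * (γ 0 * w m 0) + P * (q * (q * γ 0) * w m 1) + P * (q * γ 0 * w m 0))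
        + (A * Σ (suc m) (λ t → γ (suc t) * w m (suc t))
           + P * Σ (suc m) (λ t → q * (q * γ (suc t)) * w m (suc (suc t)))
           + P * Σ (suc m) (λ t → γ (suc t) * w m t))
        ≈⟨ solve 9 (λ A P q g₀ c₀ c₁ S₁ S₂ S₃ →
             (A :* (g₀ :* c₀) :+ P :* (q :* (q :* g₀) :* c₁) :+ P :* (q :* g₀ :* c₀)) :+ (A :* S₁ :+ P :* S₂ :+ P :* S₃)
             := A :* (g₀ :* c₀ :+ S₁) :+ P :* ((q :* (q :* g₀) :* c₁ :+ S₂) :+ (q :* g₀ :* c₀ :+ S₃)))
             refl A P q (γ 0) (w m 0) (w m 1) _ _ _ ⟩
      A * (γ 0 * w m 0 + Σ (suc m) (λ t → γ (suc t) * w m (suc t)))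
        + P * ((q * (q * γ 0) * w m 1 + Σ (suc m) (λ t → q * (q * γ (suc t)) * w m (suc (suc t))))
               + (q * γ 0 * w m 0 + Σ (suc m) (λ t → γ (suc t) * w m t)))
        ≈⟨ +-cong (*-congˡ diagonal) (*-congˡ (trans (+-cong above below) off-diagonal)) ⟩
      A * F m + P * (Λ * F m)
        ≈⟨ solve 4 (λ B P Λ F → (:1 :+ B) :* F :+ P :* (Λ :* F) := (:1 :+ Λ :* P :+ B) :* F) refl _ P Λ (F m) ⟩
      (1# + Λ * P + q * (q * (P * P))) * F m ∎
      where
      P = q ^ m
      A = 1# + q * (q * (P * P))
      F′ : F m ≈ Σ (suc m) (λ s → γ s * w m s)
      F′ = Σ-cong (suc m) (λ s → solve 3 (λ T g b → T :* g :* b := g :* (T :* b)) refl (q ^ tri s) (γ s) (b m s))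
      dead : ∀ s x → m < s → x * w m s ≈ 0#
      dead s x m<s = trans (*-congˡ (w-above m s m<s)) (zeroʳ x)
      diagonal : γ 0 * w m 0 + Σ (suc m) (λ t → γ (suc t) * w m (suc t)) ≈ F m
      diagonal = begin
        γ 0 * w m 0 + Σ (suc m) (λ t → γ (suc t) * w m (suc t))
          ≈⟨ +-congˡ (trans (+-congˡ (dead (suc m) _ (ℕₚ.n<1+n m))) (+-identityʳ _)) ⟩
        γ 0 * w m 0 + Σ m (λ t → γ (suc t) * w m (suc t)) ≈⟨ sym (Σ-head m (λ s → γ s * w m s)) ⟩
        Σ (suc m) (λ s → γ s * w m s)                     ≈⟨ sym F′ ⟩
        F m ∎
      above : q * (q * γ 0) * w m 1 + Σ (suc m) (λ t → q * (q * γ (suc t)) * w m (suc (suc t)))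
        ≈ Σ m (λ t → q * (q * γ t) * w m (suc t))
      above = begin
        q * (q * γ 0) * w m 1 + Σ (suc m) (λ t → q * (q * γ (suc t)) * w m (suc (suc t)))
          ≈⟨ sym (Σ-head (suc m) (λ t → q * (q * γ t) * w m (suc t))) ⟩
        Σ m (λ t → q * (q * γ t) * w m (suc t)) + _ + _
          ≈⟨ trans (+-cong (trans (+-congˡ (dead (suc m) _ (ℕₚ.n<1+n m))) (+-identityʳ _)) (dead (suc (suc m)) _ (ℕₚ.m<n⇒m<1+n (ℕₚ.n<1+n m)))) (+-identityʳ _) ⟩
        Σ m (λ t → q * (q * γ t) * w m (suc t)) ∎
      below : q * γ 0 * w m 0 + Σ (suc m) (λ t → γ (suc t) * w m t)
        ≈ Λ * γ 0 * w m 0 + Σ m (λ t → γ (suc (suc t)) * w m (suc t))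
      below = begin
        q * γ 0 * w m 0 + Σ (suc m) (λ t → γ (suc t) * w m t)
          ≈⟨ +-congˡ (Σ-head m (λ t → γ (suc t) * w m t)) ⟩
        q * γ 0 * w m 0 + (γ 1 * w m 0 + Σ m (λ t → γ (suc (suc t)) * w m (suc t)))
          ≈⟨ solve 5 (λ q g₀ g₁ c S → q :* g₀ :* c :+ (g₁ :* c :+ S) := (g₁ :+ q :* g₀) :* c :+ S) refl q (γ 0) (γ 1) (w m 0) _ ⟩
        (γ 1 + q * γ 0) * w m 0 + Σ m (λ t → γ (suc (suc t)) * w m (suc t))
          ≈⟨ +-congʳ (*-congʳ γ₀) ⟩
        Λ * γ 0 * w m 0 + Σ m (λ t → γ (suc (suc t)) * w m (suc t)) ∎
      off-diagonal : Σ m (λ t → q * (q * γ t) * w m (suc t))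
          + (Λ * γ 0 * w m 0 + Σ m (λ t → γ (suc (suc t)) * w m (suc t)))
        ≈ Λ * F m
      off-diagonal = begin
        S₁ + (Λ * γ 0 * w m 0 + S₂)
          ≈⟨ solve 3 (λ a b c → a :+ (b :+ c) := b :+ (a :+ c)) refl S₁ _ S₂ ⟩
        Λ * γ 0 * w m 0 + (S₁ + S₂)
          ≈⟨ +-congˡ (trans (Σ-+ m _ _) (Σ-cong m (λ t → trans (sym (distribʳ _ _ _)) (*-congʳ (trans (+-comm _ _) (γ₊ t)))))) ⟩
        Λ * γ 0 * w m 0 + Σ m (λ t → Λ * γ (suc t) * w m (suc t))
          ≈⟨ sym (Σ-head m (λ t → Λ * γ t * w m t)) ⟩
        Σ (suc m) (λ s → Λ * γ s * w m s)
          ≈⟨ trans (Σ-cong (suc m) (λ s → *-assoc Λ (γ s) (w m s))) (sym (Σ-*ˡ (suc m) Λ _)) ⟩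
        Λ * Σ (suc m) (λ s → γ s * w m s) ≈⟨ *-congˡ (sym F′) ⟩
        Λ * F m ∎
        where
        S₁ = Σ m (λ t → q * (q * γ t) * w m (suc t))
        S₂ = Σ m (λ t → γ (suc (suc t)) * w m (suc t))

    F-closed : ∀ m → F m ≈
      γ 0 * Π m (λ j → 1# + Λ * q ^ j + q * (q * (q ^ j * q ^ j))) * u (suc (m ℕ.+ m))
    F-closed zero = solve 2 (λ g v → con 0ℤ :+ :1 :* g :* (:1 :* v) := g :* :1 :* v) refl (γ 0) (u 1)
    F-closed (suc m) = E-cancel m (begin
      E m * F (suc m)         ≈⟨ F-recurrence m ⟩
      L m * F m               ≈⟨ *-congˡ (trans (F-closed m) (*-congˡ (u-E m))) ⟩
      L m * (γ 0 * Π m L * (E m * u (suc (suc m ℕ.+ suc m))))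
        ≈⟨ solve 5 (λ l g p e v → l :* (g :* p :* (e :* v)) := e :* (g :* (p :* l) :* v)) refl (L m) (γ 0) (Π m L) (E m) _ ⟩
      E m * (γ 0 * Π (suc m) L * u (suc (suc m ℕ.+ suc m))) ∎)
      where
      L : ℕ → Carrier
      L j = 1# + Λ * q ^ j + q * (q * (q ^ j * q ^ j))

  module TripleProduct (x y : Carrier) (xy : x * y ≈ q) where

    private
      θ : ℕ → Carrier
      θ = thetaCoeff x y q

    private
      -- θ combines the powers of -x and of -y q; their sum is Λ, and their product x y q is q^2.
      Λ : Carrier
      Λ = - (x + y * q)

      θ₀ : θ 1 + q * θ 0 ≈ Λ * θ 0
      θ₀ = begin
        - 1# * (x * 1# - y * (y * 1#) * (q * 1#)) + q * (1# * (1# - y * 1# * 1#))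
          ≈⟨ solve 3 (λ q x y → :- :1 :* (x :* :1 :- y :* (y :* :1) :* (q :* :1)) :+ q :* (:1 :* (:1 :- y :* :1 :* :1))
               := :- x :+ y :* y :* q :- q :* y :+ q) refl q x y ⟩
        - x + y * y * q - q * y + q ≈⟨ +-congˡ (sym xy) ⟩
        - x + y * y * q - q * y + x * y
          ≈⟨ solve 3 (λ q x y → :- x :+ y :* y :* q :- q :* y :+ x :* y
               := :- (x :+ y :* q) :* (:1 :* (:1 :- y :* :1 :* :1))) refl q x y ⟩
        Λ * θ 0 ∎

      θ₊ : ∀ s → θ (suc (suc s)) + q * (q * θ s) ≈ Λ * θ (suc s)
      θ₊ s = begin
        - (- g) * (x * (x * X) - y * (y * (y * Y)) * (q * (q * P))) + q * (q * (g * (X - y * Y * P)))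
          ≈⟨ solve 7 (λ q x y g X Y P →
               :- (:- g) :* (x :* (x :* X) :- y :* (y :* (y :* Y)) :* (q :* (q :* P))) :+ q :* (q :* (g :* (X :- y :* Y :* P)))
               := g :* (x :* (x :* X) :- y :* (y :* (y :* Y)) :* (q :* (q :* P)) :- q :* (q :* (y :* Y :* P)) :+ q :* (q :* X)))
               refl q x y g X Y P ⟩
        g * (x * (x * X) - y * (y * (y * Y)) * (q * (q * P)) - q * (q * (y * Y * P)) + q * (q * X))
          ≈⟨ *-congˡ (+-cong (+-congˡ (-‿cong (*-congʳ (sym xy)))) (*-congˡ (*-congʳ (sym xy)))) ⟩
        g * (x * (x * X) - y * (y * (y * Y)) * (q * (q * P)) - x * y * (q * (y * Y * P)) + q * (x * y * X))
          ≈⟨ solve 7 (λ q x y g X Y P →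
               g :* (x :* (x :* X) :- y :* (y :* (y :* Y)) :* (q :* (q :* P)) :- x :* y :* (q :* (y :* Y :* P)) :+ q :* (x :* y :* X))
               := :- (x :+ y :* q) :* (:- g :* (x :* X :- y :* (y :* Y) :* (q :* P))))
               refl q x y g X Y P ⟩
        Λ * θ (suc s) ∎
        where
        g = sgn s
        X = x ^ s
        Y = y ^ s
        P = q ^ s

    open ThreeTerm θ Λ θ₀ θ₊ using (F-closed)

    -- The quadratic factors of `F-closed` split as (1 - x q^j) (1 - y q^(j+1)), and the initial
    -- value θ 0 = 1 - y supplies the missing first factor in y. This is the finite form of the
    -- Jacobi triple product with 2m+1 factors.
    finite-triple-product : ∀ m →
      Π m (λ j → 1# - x * q ^ j) * Π (suc m) (λ j → 1# - y * q ^ j) * u (suc (m ℕ.+ m))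
      ≈ Σ (suc m) (λ s → theta x y q s * (û m s * u (suc (m ℕ.+ s))))
    finite-triple-product m = sym (trans (F-closed m) (*-congʳ (begin
      θ 0 * Π m (λ j → 1# + Λ * q ^ j + q * (q * (q ^ j * q ^ j)))
        ≈⟨ *-cong (solve 1 (λ y → :1 :* (:1 :- y :* :1 :* :1) := :1 :- y :* :1) refl y)
             (trans (Π-cong m factor) (sym (Π-* m _ _))) ⟩
      (1# - y * 1#) * (Π m (λ j → 1# - x * q ^ j) * Π m (λ j → 1# - y * q ^ suc j))
        ≈⟨ solve 3 (λ a b c → a :* (b :* c) := b :* (a :* c)) refl _ _ _ ⟩
      Π m (λ j → 1# - x * q ^ j) * ((1# - y * 1#) * Π m (λ j → 1# - y * q ^ suc j))
        ≈⟨ *-congˡ (sym (Π-head m (λ j → 1# - y * q ^ j))) ⟩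
      Π m (λ j → 1# - x * q ^ j) * Π (suc m) (λ j → 1# - y * q ^ j) ∎)))
      where
      factor : ∀ j → 1# + Λ * q ^ j + q * (q * (q ^ j * q ^ j)) ≈ (1# - x * q ^ j) * (1# - y * q ^ suc j)
      factor j = begin
        1# + Λ * q ^ j + q * (q * (q ^ j * q ^ j)) ≈⟨ +-congˡ (*-congʳ (sym xy)) ⟩
        1# + Λ * q ^ j + x * y * (q * (q ^ j * q ^ j))
          ≈⟨ solve 4 (λ q x y P → :1 :+ :- (x :+ y :* q) :* P :+ x :* y :* (q :* (P :* P))
               := (:1 :- x :* P) :* (:1 :- y :* (q :* P))) refl q x y (q ^ j) ⟩
        (1# - x * q ^ j) * (1# - y * q ^ suc j) ∎

  -- The exponents add up correctly unless r > n, and there `û n r` is zero.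
  pow-û : ∀ n r → q ^ r * q ^ (n ℕ.∸ r) * û n r ≈ q ^ n * û n r
  pow-û n r with r ℕₚ.≤? n
  ... | yes r≤n = *-congʳ (trans (sym (^-homo-* q r _)) (pow-≡ (ℕₚ.m+[n∸m]≡n r≤n)))
  ... | no  r≰n = trans (*-congˡ dead) (trans (zeroʳ _) (sym (trans (*-congˡ dead) (zeroʳ _))))
    where
    dead : û n r ≈ 0#
    dead = û-above n r (ℕₚ.≰⇒> r≰n)

  -- Split 1 - q^(M+1) = (1 - q^(M+1-j)) + q^(M+1-j) (1 - q^j). The first part lowers M; the second
  -- lowers j, which gives the sum for M and s+1. Hence the induction on M needs s arbitrary.
  limiting-Vandermonde : ∀ M s →
    Σ (suc M) (λ j → q ^ (j ℕ.* j ℕ.+ s ℕ.* j) * (û M j * (u j * u (j ℕ.+ s)))) ≈ u M * u (M ℕ.+ s)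
  limiting-Vandermonde zero s = begin
    0# + q ^ (s ℕ.* 0) * (1# * (1# * u s)) ≈⟨ +-congˡ (*-congʳ (pow-≡ (ℕₚ.*-zeroʳ s))) ⟩
    0# + 1# * (1# * (1# * u s))
      ≈⟨ solve 1 (λ v → con 0ℤ :+ :1 :* (:1 :* (:1 :* v)) := :1 :* v) refl (u s) ⟩
    1# * u s ∎
  limiting-Vandermonde (suc M) s = cancel M (begin
    (1# - Q) * Σ (suc (suc M)) (λ j → v s j * (û (suc M) j * (u j * u (j ℕ.+ s))))
      ≈⟨ trans (Σ-*ˡ (suc (suc M)) _ _) (trans (Σ-cong (suc (suc M)) split) (sym (Σ-+ (suc (suc M)) left right))) ⟩
    Σ (suc (suc M)) left + Σ (suc (suc M)) right
      ≈⟨ +-cong (trans (+-congˡ left-top) (+-identityʳ _)) (trans (Σ-head (suc M) right) (trans (+-congʳ right₀) (+-identityˡ _))) ⟩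
    Σ (suc M) left + Σ (suc M) (λ i → right (suc i))
      ≈⟨ +-cong (limiting-Vandermonde M s)
           (trans (Σ-cong< (suc M) right₊) (trans (sym (Σ-*ˡ (suc M) (q ^ suc (M ℕ.+ s)) _)) (*-congˡ (limiting-Vandermonde M (suc s))))) ⟩
    u M * u (M ℕ.+ s) + q ^ suc (M ℕ.+ s) * (u M * u (M ℕ.+ suc s))
      ≈⟨ +-cong (*-congˡ (u-step (M ℕ.+ s))) (*-congˡ (*-congˡ (reflexive (≡.cong u (ℕₚ.+-suc M s))))) ⟩
    u M * ((1# - q ^ suc (M ℕ.+ s)) * Y) + q ^ suc (M ℕ.+ s) * (u M * Y)
      ≈⟨ solve 3 (λ a p y → a :* ((:1 :- p) :* y) :+ p :* (a :* y) := a :* y) refl (u M) _ Y ⟩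
    u M * Y ≈⟨ *-congʳ (u-step M) ⟩
    (1# - Q) * u (suc M) * Y ≈⟨ *-assoc _ _ _ ⟩
    (1# - Q) * (u (suc M) * u (suc M ℕ.+ s)) ∎)
    where
    Q = q ^ suc M
    Y = u (suc (M ℕ.+ s))
    v : ℕ → ℕ → Carrier
    v s j = q ^ (j ℕ.* j ℕ.+ s ℕ.* j)
    left right : ℕ → Carrier
    left j = v s j * (û M j * (u j * u (j ℕ.+ s)))
    right j = v s j * (q ^ (suc M ℕ.∸ j) * û (suc M) j * ((1# - q ^ j) * u j * u (j ℕ.+ s)))
    split : ∀ j → (1# - Q) * (v s j * (û (suc M) j * (u j * u (j ℕ.+ s)))) ≈ left j + right j
    split j = begin
      (1# - Q) * (V * (X * (U * T)))
        ≈⟨ solve 5 (λ Q V X U T → (:1 :- Q) :* (V :* (X :* (U :* T))) := V :* ((X :- Q :* X) :* (U :* T))) refl Q V X U T ⟩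
      V * ((X - Q * X) * (U * T)) ≈⟨ *-congˡ (*-congʳ (+-congˡ (-‿cong (sym (pow-û (suc M) j))))) ⟩
      V * ((X - q ^ j * K * X) * (U * T))
        ≈⟨ solve 6 (λ q K V X U T → V :* ((X :- q :* K :* X) :* (U :* T))
             := V :* (((:1 :- K) :* X) :* (U :* T)) :+ V :* (K :* X :* ((:1 :- q) :* U :* T))) refl (q ^ j) K V X U T ⟩
      V * (((1# - K) * X) * (U * T)) + right j ≈⟨ +-congʳ (*-congˡ (*-congʳ (sym (û-step (suc M) j)))) ⟩
      left j + right j ∎
      where
      V = v s j
      X = û (suc M) j
      U = u j
      T = u (j ℕ.+ s)
      K = q ^ (suc M ℕ.∸ j)
    left-top : left (suc M) ≈ 0#
    left-top = trans (*-congˡ (trans (*-congʳ (û-above M (suc M) (ℕₚ.n<1+n M))) (zeroˡ _))) (zeroʳ _)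
    right₀ : right 0 ≈ 0#
    right₀ = solve 4 (λ a b c d → a :* (b :* ((:1 :- :1) :* c :* d)) := con 0ℤ) refl _ _ _ _
    right₊ : ∀ i → i < suc M → right (suc i) ≈ q ^ suc (M ℕ.+ s) * (v (suc s) i * (û M i * (u i * u (i ℕ.+ suc s))))
    right₊ i (s≤s i≤M) = begin
      v s (suc i) * (q ^ (M ℕ.∸ i) * û M i * ((1# - q ^ suc i) * u (suc i) * u (suc (i ℕ.+ s))))
        ≈⟨ *-congˡ (*-congˡ (*-cong (sym (u-step i)) (reflexive (≡.cong u (≡.sym (ℕₚ.+-suc i s)))))) ⟩
      v s (suc i) * (q ^ (M ℕ.∸ i) * û M i * (u i * u (i ℕ.+ suc s)))
        ≈⟨ solve 4 (λ a b c d → a :* (b :* c :* d) := a :* b :* (c :* d)) refl _ _ _ _ ⟩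
      v s (suc i) * q ^ (M ℕ.∸ i) * (û M i * (u i * u (i ℕ.+ suc s)))
        ≈⟨ *-congʳ (trans (sym (^-homo-* q (suc i ℕ.* suc i ℕ.+ s ℕ.* suc i) (M ℕ.∸ i))) (trans (pow-≡ exponent) (^-homo-* q (suc (M ℕ.+ s)) _))) ⟩
      q ^ suc (M ℕ.+ s) * v (suc s) i * (û M i * (u i * u (i ℕ.+ suc s)))
        ≈⟨ *-assoc _ _ _ ⟩
      q ^ suc (M ℕ.+ s) * (v (suc s) i * (û M i * (u i * u (i ℕ.+ suc s)))) ∎
      where
      exponent : suc i ℕ.* suc i ℕ.+ s ℕ.* suc i ℕ.+ (M ℕ.∸ i) ≡ suc (M ℕ.+ s) ℕ.+ (i ℕ.* i ℕ.+ suc s ℕ.* i)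
      exponent = ≡.trans
        (Exponents.square-shift i s (M ℕ.∸ i))
        (≡.cong (λ k → suc (k ℕ.+ s) ℕ.+ (i ℕ.* i ℕ.+ suc s ℕ.* i)) (ℕₚ.m∸n+n≡m i≤M))

  module UnitPair where

    -- The terms r and -r of the two-sided sequence (-1)^r q^(r(r-1)/2); the term 0 is counted once.
    α : ℕ → Carrier
    α zero      = 1#
    α r@(suc _) = sgn r * q ^ tri r * (1# + q ^ r)

    -- Every partial sum has a closed form, the step being 1 - N P - (1 - N) (1 + P) = N - P. The
    -- factor `û n (suc k)` makes the complete sum, k = n, vanish.
    telescope : ∀ n k → (1# - q ^ n) * Σ (suc k) (λ r → α r * (û n r * u (n ℕ.+ r)))
      ≈ sgn k * q ^ tri (suc k) * (û n (suc k) * u (n ℕ.+ k))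
    telescope n zero = begin
      (1# - q ^ n) * (0# + 1# * (u n * u (n ℕ.+ 0)))
        ≈⟨ solve 3 (λ p a b → (:1 :- p) :* (con 0ℤ :+ :1 :* (a :* b)) := :1 :* :1 :* (((:1 :- p) :* a) :* b)) refl (q ^ n) (u n) _ ⟩
      1# * 1# * (((1# - q ^ n) * u n) * u (n ℕ.+ 0)) ≈⟨ *-congˡ (*-congʳ (sym (û-step n 0))) ⟩
      1# * 1# * (û n 1 * u (n ℕ.+ 0)) ∎
    telescope n (suc k) = begin
      (1# - N) * (Σ r (λ r → α r * (û n r * u (n ℕ.+ r))) + g * T * (1# + P) * (X * u (n ℕ.+ r)))
        ≈⟨ trans (distribˡ _ _ _) (+-cong (telescope n k) (*-congˡ (*-congˡ (*-congˡ uY)))) ⟩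
      sgn k * T * (X * u (n ℕ.+ k)) + (1# - N) * (g * T * (1# + P) * (X * Y))
        ≈⟨ +-congʳ (*-congˡ (*-congˡ (trans (u-step (n ℕ.+ k)) (*-congʳ (+-congˡ (-‿cong NP)))))) ⟩
      sgn k * T * (X * ((1# - N * P) * Y)) + (1# - N) * (- sgn k * T * (1# + P) * (X * Y))
        ≈⟨ solve 6 (λ N P T X Y g →
             g :* T :* (X :* ((:1 :- N :* P) :* Y)) :+ (:1 :- N) :* (:- g :* T :* (:1 :+ P) :* (X :* Y))
             := :- g :* T :* ((P :* X :- N :* X) :* Y)) refl N P T X Y (sgn k) ⟩
      g * T * ((P * X - N * X) * Y)
        ≈⟨ *-congˡ (*-congʳ (+-congˡ (-‿cong (sym (pow-û n r))))) ⟩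
      g * T * ((P * X - P * D * X) * Y)
        ≈⟨ solve 6 (λ g T P D X Y → g :* T :* ((P :* X :- P :* D :* X) :* Y) := g :* (P :* T) :* (((:1 :- D) :* X) :* Y)) refl g T P D X Y ⟩
      g * (P * T) * (((1# - D) * X) * Y)
        ≈⟨ *-cong (*-congˡ (sym (^-homo-* q r (tri r)))) (*-cong (sym (û-step n r)) (sym uY)) ⟩
      g * q ^ tri (suc r) * (û n (suc r) * u (n ℕ.+ r)) ∎
      where
      r = suc k
      g = sgn r
      N = q ^ n
      P = q ^ r
      T = q ^ tri r
      D = q ^ (n ℕ.∸ r)
      X = û n r
      Y = u (suc (n ℕ.+ k))
      uY : u (n ℕ.+ r) ≈ Y
      uY = reflexive (≡.cong u (ℕₚ.+-suc n k))
      NP : q ^ suc (n ℕ.+ k) ≈ N * P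
      NP = trans (pow-≡ (≡.sym (ℕₚ.+-suc n k))) (^-homo-* q n r)

    unit-pair : ∀ m → Σ (suc (suc m)) (λ r → α r * (û (suc m) r * u (suc m ℕ.+ r))) ≈ 0#
    unit-pair m = cancel m (begin
      _ ≈⟨ telescope (suc m) (suc m) ⟩
      sgn (suc m) * q ^ tri (suc (suc m)) * (û m (suc m) * u (suc m ℕ.+ suc m))
        ≈⟨ *-congˡ (trans (*-congʳ (û-above m (suc m) (ℕₚ.n<1+n m))) (zeroˡ _)) ⟩
      sgn (suc m) * q ^ tri (suc (suc m)) * 0# ≈⟨ trans (zeroʳ _) (sym (zeroʳ _)) ⟩
      (1# - q ^ suc m) * 0# ∎)

  module CharacterPair where

    -- Again r folded with -r; the minus sign in 1 - q^r is the oddness of χ.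
    α : ℕ → Carrier
    α r = χ r * q ^ tri r * (1# - q ^ r)

    Q : ℕ → Carrier
    Q m = Π m (λ j → 1# + - q * q ^ j + q * (q * (q ^ j * q ^ j)))

    private
      -- The coefficients that summation by parts produces in `F-sum`.
      γ : ℕ → Carrier
      γ s = (χ (suc s) - χ s) * q ^ s

      γ₀ : γ 1 + q * γ 0 ≈ - q * γ 0
      γ₀ = solve 1 (λ q → (:- :1 :- :1) :* (q :* :1) :+ q :* ((:1 :- con 0ℤ) :* :1)
             := :- q :* ((:1 :- con 0ℤ) :* :1)) refl q

      -- By the period 3 of χ, any three consecutive differences of χ sum to zero.
      γ₊ : ∀ s → γ (suc (suc s)) + q * (q * γ s) ≈ - q * γ (suc s)
      γ₊ s = solve 5 (λ q P a b c → (a :- c) :* (q :* (q :* P)) :+ q :* (q :* ((b :- a) :* P))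
               := :- q :* ((c :- b) :* (q :* P))) refl q (q ^ s) (χ s) (χ (suc s)) (χ (suc (suc s)))

      open ThreeTerm γ (- q) γ₀ γ₊ using (F; F-closed)

      d : ℕ → ℕ → Carrier
      d m t = q ^ t * q ^ tri t * b m t

      d-above : ∀ m → d m (suc m) ≈ 0#
      d-above m = trans (*-congˡ (trans (*-congʳ (û-above m (suc m) (ℕₚ.n<1+n m))) (zeroˡ _))) (zeroʳ _)

      -- The factor 1 + q^(m+1) turns a term of the Bailey sum into χ(t+1) times a difference of
      -- consecutive `d m`, because (1 + N) (1 - P) = (1 - N P) - (P - N).
      split : ∀ m t → (1# + q ^ suc m) * (α (suc t) * (û (suc m) (suc t) * u (suc m ℕ.+ suc t)))
        ≈ χ (suc t) * d m t + - (χ (suc t) * d m (suc t))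
      split m t = begin
        (1# + N) * (c * T * (1# - P) * (X * u (suc m ℕ.+ suc t)))
          ≈⟨ *-congˡ (*-congˡ (*-congˡ uY)) ⟩
        (1# + N) * (c * T * (1# - P) * (X * Y))
          ≈⟨ solve 6 (λ N P c T X Y → (:1 :+ N) :* (c :* T :* (:1 :- P) :* (X :* Y))
               := c :* T :* (X :* ((:1 :- N :* P) :* Y) :- (P :* X :- N :* X) :* Y)) refl N P c T X Y ⟩
        c * T * (X * ((1# - N * P) * Y) - (P * X - N * X) * Y)
          ≈⟨ *-congˡ (+-congˡ (-‿cong (*-congʳ (+-congˡ (-‿cong (sym (pow-û (suc m) (suc t)))))))) ⟩
        c * T * (X * ((1# - N * P) * Y) - (P * X - P * D * X) * Y)
          ≈⟨ solve 7 (λ c T X N P D Y → c :* T :* (X :* ((:1 :- N :* P) :* Y) :- (P :* X :- P :* D :* X) :* Y)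
               := c :* (T :* (X :* ((:1 :- N :* P) :* Y))) :+ :- (c :* (P :* T :* (((:1 :- D) :* X) :* Y)))) refl c T X N P D Y ⟩
        c * (T * (X * ((1# - N * P) * Y))) + - (c * (P * T * (((1# - D) * X) * Y)))
          ≈⟨ +-cong
               (*-congˡ (*-cong (^-homo-* q t (tri t)) (*-congˡ (sym (trans (u-step _) (*-congʳ (+-congˡ (-‿cong NP))))))))
               (-‿cong (*-congˡ (*-congˡ (*-cong (sym (û-step (suc m) (suc t))) (sym uY))))) ⟩
        c * d m t + - (c * d m (suc t)) ∎
        where
        c = χ (suc t)
        N = q ^ suc m
        P = q ^ suc t
        T = q ^ tri (suc t)
        D = q ^ (m ℕ.∸ t)
        X = û m t
        Y = u (suc (suc (m ℕ.+ t)))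
        uY : u (suc m ℕ.+ suc t) ≈ Y
        uY = reflexive (≡.cong (λ k → u (suc k)) (ℕₚ.+-suc m t))
        NP : q ^ suc (suc (m ℕ.+ t)) ≈ N * P
        NP = trans (pow-≡ (≡.cong suc (≡.sym (ℕₚ.+-suc m t)))) (^-homo-* q (suc m) (suc t))

    -- Summation by parts moves the difference from `d` onto χ; the boundary terms vanish since χ(0)
    -- = 0 and `d m (suc m)` is zero.
    F-sum : ∀ m → (1# + q ^ suc m) * Σ (suc (suc m)) (λ r → α r * (û (suc m) r * u (suc m ℕ.+ r))) ≈ F m
    F-sum m = begin
      (1# + q ^ suc m) * Σ (suc (suc m)) g
        ≈⟨ *-congˡ (trans (Σ-head (suc m) g) (trans (+-congʳ g₀) (+-identityˡ _))) ⟩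
      (1# + q ^ suc m) * Σ (suc m) (λ t → g (suc t))
        ≈⟨ trans (Σ-*ˡ (suc m) _ _) (trans (Σ-cong (suc m) (split m)) (sym (Σ-+ (suc m) _ _))) ⟩
      Σ (suc m) (λ t → χ (suc t) * d m t) + Σ (suc m) (λ t → - (χ (suc t) * d m (suc t)))
        ≈⟨ +-congˡ (trans (sym (Σ-neg (suc m) _)) (trans (-‿cong shift) (Σ-neg (suc m) _))) ⟩
      Σ (suc m) (λ t → χ (suc t) * d m t) + Σ (suc m) (λ s → - (χ s * d m s))
        ≈⟨ trans (Σ-+ (suc m) _ _) (Σ-cong (suc m) (λ s →
             solve 5 (λ a c P T b → a :* (P :* T :* b) :+ :- (c :* (P :* T :* b)) := T :* ((a :- c) :* P) :* b)
               refl (χ (suc s)) (χ s) (q ^ s) (q ^ tri s) (b m s))) ⟩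
      F m ∎
      where
      g : ℕ → Carrier
      g r = α r * (û (suc m) r * u (suc m ℕ.+ r))
      g₀ : g 0 ≈ 0#
      g₀ = solve 1 (λ x → con 0ℤ :* :1 :* (:1 :- :1) :* x := con 0ℤ) refl _
      shift : Σ (suc m) (λ t → χ (suc t) * d m (suc t)) ≈ Σ (suc m) (λ s → χ s * d m s)
      shift = begin
        Σ m (λ t → χ (suc t) * d m (suc t)) + χ (suc m) * d m (suc m)
          ≈⟨ trans (+-congˡ (trans (*-congˡ (d-above m)) (zeroʳ _))) (+-comm _ 0#) ⟩
        0# + Σ m (λ t → χ (suc t) * d m (suc t)) ≈⟨ +-congʳ (sym (zeroˡ _)) ⟩
        χ 0 * d m 0 + Σ m (λ t → χ (suc t) * d m (suc t)) ≈⟨ sym (Σ-head m (λ s → χ s * d m s)) ⟩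
        Σ (suc m) (λ s → χ s * d m s) ∎

    -- `F-sum` leaves a factor 1 + q^(m+1). Multiplying by 1 - q^(m+1) completes it to 1 - q^(2m+2),
    -- which can be cancelled.
    character-pair : ∀ m → Σ (suc (suc m)) (λ r → α r * (û (suc m) r * u (suc m ℕ.+ r)))
      ≈ (1# - q ^ suc m) * Q m * u (suc (suc (m ℕ.+ m)))
    character-pair m = cancel (suc (m ℕ.+ m)) (begin
      (1# - q ^ suc (suc (m ℕ.+ m))) * S        ≈⟨ *-congʳ factor ⟩
      (1# - N) * (1# + N) * S                   ≈⟨ *-assoc _ _ _ ⟩
      (1# - N) * ((1# + N) * S)                 ≈⟨ *-congˡ (trans (F-sum m) (F-closed m)) ⟩
      (1# - N) * ((1# - 0#) * 1# * Q m * u (suc (m ℕ.+ m)))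
        ≈⟨ *-congˡ (*-congˡ (trans (u-step _) (*-congʳ factor))) ⟩
      (1# - N) * ((1# - 0#) * 1# * Q m * ((1# - N) * (1# + N) * V))
        ≈⟨ solve 3 (λ N Q V → (:1 :- N) :* ((:1 :- con 0ℤ) :* :1 :* Q :* ((:1 :- N) :* (:1 :+ N) :* V))
             := (:1 :- N) :* (:1 :+ N) :* ((:1 :- N) :* Q :* V)) refl N (Q m) V ⟩
      (1# - N) * (1# + N) * ((1# - N) * Q m * V) ≈⟨ *-congʳ (sym factor) ⟩
      (1# - q ^ suc (suc (m ℕ.+ m))) * ((1# - N) * Q m * V) ∎)
      where
      N = q ^ suc m
      V = u (suc (suc (m ℕ.+ m)))
      S = Σ (suc (suc m)) (λ r → α r * (û (suc m) r * u (suc m ℕ.+ r)))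
      factor : 1# - q ^ suc (suc (m ℕ.+ m)) ≈ (1# - N) * (1# + N)
      factor = begin
        1# - q ^ suc (suc (m ℕ.+ m))
          ≈⟨ +-congˡ (-‿cong (trans (pow-≡ (≡.cong suc (≡.sym (ℕₚ.+-suc m m)))) (^-homo-* q (suc m) (suc m)))) ⟩
        1# - N * N  ≈⟨ solve 1 (λ N → :1 :- N :* N := (:1 :- N) :* (:1 :+ N)) refl N ⟩
        (1# - N) * (1# + N) ∎

  α : ℕ → Carrier
  α r = UnitPair.α r + CharacterPair.α r

  β : ℕ → Carrier
  β zero    = 1#
  β (suc m) = (1# - q ^ suc m) * CharacterPair.Q m * u (suc (suc (m ℕ.+ m)))

  Bailey-pair : ∀ n → Σ (suc n) (λ r → α r * (û n r * u (n ℕ.+ r))) ≈ β n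
  Bailey-pair zero = solve 0 (con 0ℤ :+ (:1 :+ con 0ℤ :* :1 :* (:1 :- :1)) :* (:1 :* :1) := :1) refl
  Bailey-pair n@(suc m) = begin
    Σ (suc n) (λ r → α r * (û n r * u (n ℕ.+ r)))
      ≈⟨ trans (Σ-cong (suc n) (λ r → distribʳ _ _ _)) (sym (Σ-+ (suc n) _ _)) ⟩
    _ + _  ≈⟨ +-cong (UnitPair.unit-pair m) (CharacterPair.character-pair m) ⟩
    0# + β n ≈⟨ +-identityˡ _ ⟩
    β n ∎

  -- Expand β and interchange the sums. As (r+j)^2 = r^2 + j^2 + 2rj, column r is the limiting
  -- Vandermonde sum with M = N - r and s = 2r.
  Bailey-lemma : ∀ N → Σ (suc N) (λ n → q ^ (n ℕ.* n) * β n * û N n)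
    ≈ Σ (suc N) (λ r → q ^ (r ℕ.* r) * α r * (û N r * u (N ℕ.+ r)))
  Bailey-lemma N = begin
    Σ (suc N) (λ n → q ^ (n ℕ.* n) * β n * û N n)
      ≈⟨ Σ-cong (suc N) (λ n → trans (*-congʳ (*-congˡ (sym (Bailey-pair n)))) (trans
           (solve 3 (λ a b c → a :* b :* c := (a :* c) :* b) refl _ _ _) (Σ-*ˡ (suc n) _ _))) ⟩
    Σ (suc N) (λ n → Σ (suc n) (f n))           ≈⟨ Σ-triangle (suc N) f ⟩
    Σ (suc N) (λ r → Σ (suc N ℕ.∸ r) (λ j → f (r ℕ.+ j) r))
      ≈⟨ Σ-cong< (suc N) (λ { r (s≤s r≤N) → column r r≤N }) ⟩
    Σ (suc N) (λ r → q ^ (r ℕ.* r) * α r * (û N r * u (N ℕ.+ r))) ∎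
    where
    f : ℕ → ℕ → Carrier
    f n r = q ^ (n ℕ.* n) * û N n * (α r * (û n r * u (n ℕ.+ r)))
    û-shift : ∀ r M j → û (r ℕ.+ M) (r ℕ.+ j) ≡ û M j
    û-shift zero    M j = ≡.refl
    û-shift (suc r) M j = û-shift r M j
    column : ∀ r → r ≤ N → Σ (suc N ℕ.∸ r) (λ j → f (r ℕ.+ j) r) ≈ q ^ (r ℕ.* r) * α r * (û N r * u (N ℕ.+ r))
    column r r≤N = begin
      Σ (suc N ℕ.∸ r) (λ j → f (r ℕ.+ j) r)
        ≡⟨ ≡.cong (λ k → Σ k (λ j → f (r ℕ.+ j) r)) (ℕₚ.+-∸-assoc 1 r≤N) ⟩
      Σ (suc M) (λ j → f (r ℕ.+ j) r)
        ≈⟨ trans (Σ-cong (suc M) term) (sym (Σ-*ˡ (suc M) _ _)) ⟩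
      q ^ (r ℕ.* r) * α r * Σ (suc M) (λ j → q ^ (j ℕ.* j ℕ.+ (r ℕ.+ r) ℕ.* j) * (û M j * (u j * u (j ℕ.+ (r ℕ.+ r)))))
        ≈⟨ *-congˡ (limiting-Vandermonde M (r ℕ.+ r)) ⟩
      q ^ (r ℕ.* r) * α r * (u M * u (M ℕ.+ (r ℕ.+ r)))
        ≈⟨ *-congˡ (*-cong (reflexive (≡.trans (≡.sym (û-+ r M)) (≡.cong (λ k → û k r) N≡)))
             (reflexive (≡.cong u (≡.trans (≡.sym (ℕₚ.+-assoc M r r)) (≡.cong (ℕ._+ r) (ℕₚ.m∸n+n≡m r≤N)))))) ⟩
      q ^ (r ℕ.* r) * α r * (û N r * u (N ℕ.+ r)) ∎
      where
      M = N ℕ.∸ r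
      N≡ : r ℕ.+ M ≡ N
      N≡ = ℕₚ.m+[n∸m]≡n r≤N
      index : ∀ j → r ℕ.+ j ℕ.+ r ≡ j ℕ.+ (r ℕ.+ r)
      index j = ≡.trans (≡.cong (ℕ._+ r) (ℕₚ.+-comm r j)) (ℕₚ.+-assoc j r r)
      term : ∀ j → f (r ℕ.+ j) r
        ≈ q ^ (r ℕ.* r) * α r * (q ^ (j ℕ.* j ℕ.+ (r ℕ.+ r) ℕ.* j) * (û M j * (u j * u (j ℕ.+ (r ℕ.+ r)))))
      term j = begin
        q ^ ((r ℕ.+ j) ℕ.* (r ℕ.+ j)) * û N (r ℕ.+ j) * (α r * (û (r ℕ.+ j) r * u (r ℕ.+ j ℕ.+ r)))
          ≈⟨ *-cong (*-cong (trans (pow-≡ (Exponents.square-+ r j)) (^-homo-* q (r ℕ.* r) _))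
                     (reflexive (≡.trans (≡.cong (λ k → û k (r ℕ.+ j)) (≡.sym N≡)) (û-shift r M j))))
               (*-congˡ (*-cong (reflexive (û-+ r j)) (reflexive (≡.cong u (index j))))) ⟩
        q ^ (r ℕ.* r) * q ^ (j ℕ.* j ℕ.+ (r ℕ.+ r) ℕ.* j) * û M j * (α r * (u j * u (j ℕ.+ (r ℕ.+ r))))
          ≈⟨ solve 5 (λ a b c d e → a :* b :* c :* (d :* e) := a :* d :* (b :* (c :* e))) refl _ _ _ _ _ ⟩
        q ^ (r ℕ.* r) * α r * (q ^ (j ℕ.* j ℕ.+ (r ℕ.+ r) ℕ.* j) * (û M j * (u j * u (j ℕ.+ (r ℕ.+ r))))) ∎

  Π-u : ∀ n → Π n (λ j → 1# - q * q ^ j) * u n ≈ 1#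
  Π-u zero    = *-identityˡ 1#
  Π-u (suc n) = begin
    Π n (λ j → 1# - q * q ^ j) * (1# - q * q ^ n) * u (suc n) ≈⟨ *-assoc _ _ _ ⟩
    Π n (λ j → 1# - q * q ^ j) * ((1# - q * q ^ n) * u (suc n)) ≈⟨ *-congˡ (sym (u-step n)) ⟩
    Π n (λ j → 1# - q * q ^ j) * u n                            ≈⟨ Π-u n ⟩
    1# ∎

  -- Identifies `β` with the summand of the theorem. The factor 1 - q^(m+1) of β and the last factor
  -- 1 + q^(m+1) of (-q;q)_(m+1) extend (q;q)_(2m+1) to (q;q)_(2m+2), which `u` cancels; the other
  -- factors pair into 1 + q^(3j+3).
  β-quotient : ∀ m →
    β (suc m) * (Π (suc m) (λ j → 1# - - q * q ^ j) * Π (suc (m ℕ.+ m)) (λ j → 1# - q * q ^ j))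
    ≈ Π m (λ j → 1# - - (q ^ 3) * (q ^ 3) ^ j)
  β-quotient m = begin
    (1# - q * N) * Q * u (suc (suc (m ℕ.+ m))) * ((X * (1# - - q * N)) * Y)
      ≈⟨ solve 6 (λ q N Q U X Y → (:1 :- q :* N) :* Q :* U :* ((X :* (:1 :- :- q :* N)) :* Y)
           := (Q :* X) :* ((Y :* (:1 :- (q :* N) :* (q :* N))) :* U)) refl q N Q _ X Y ⟩
    (Q * X) * ((Y * (1# - (q * N) * (q * N))) * u (suc (suc (m ℕ.+ m))))
      ≈⟨ *-congˡ (trans (*-congʳ (*-congˡ (+-congˡ (-‿cong square)))) (Π-u (suc (suc (m ℕ.+ m))))) ⟩
    (Q * X) * 1#  ≈⟨ *-identityʳ _ ⟩
    Q * X         ≈⟨ trans (Π-* m _ _) (Π-cong m factor) ⟩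
    Π m (λ j → 1# - - (q ^ 3) * (q ^ 3) ^ j) ∎
    where
    N = q ^ m
    Q = CharacterPair.Q m
    X = Π m (λ j → 1# - - q * q ^ j)
    Y = Π (suc (m ℕ.+ m)) (λ j → 1# - q * q ^ j)
    square : (q * N) * (q * N) ≈ q * q ^ suc (m ℕ.+ m)
    square = trans (sym (^-homo-* q (suc m) (suc m))) (pow-≡ (≡.cong suc (ℕₚ.+-suc m m)))
    factor : ∀ j → (1# + - q * q ^ j + q * (q * (q ^ j * q ^ j))) * (1# - - q * q ^ j) ≈ 1# - - (q ^ 3) * (q ^ 3) ^ j
    factor j = begin
      (1# + - q * q ^ j + q * (q * (q ^ j * q ^ j))) * (1# - - q * q ^ j)
        ≈⟨ solve 2 (λ q P → (:1 :+ :- q :* P :+ q :* (q :* (P :* P))) :* (:1 :- :- q :* P)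
             := :1 :- :- (q :* (q :* (q :* :1))) :* (P :* (P :* (P :* :1)))) refl q (q ^ j) ⟩
      1# - - (q ^ 3) * (q ^ j) ^ 3
        ≈⟨ +-congˡ (-‿cong (*-congˡ (trans (^-assocʳ q j 3) (trans (pow-≡ (ℕₚ.*-comm j 3)) (sym (^-assocʳ q 3 j)))))) ⟩
      1# - - (q ^ 3) * (q ^ 3) ^ j ∎

  -- 1/(1 + q^(j+1)) as (1 - q^(j+1)) / (1 - q^(2j+2)); the shift in `inv` accounts for the index
  -- 2j+1.
  neg-factor-inverse : ℕ → Carrier
  neg-factor-inverse n = Π n (λ j → (1# - q * q ^ j) * inv (suc (j ℕ.+ j)))

  Π-neg-inverse : ∀ n → Π n (λ j → 1# - - q * q ^ j) * neg-factor-inverse n ≈ 1#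
  Π-neg-inverse n = trans (Π-* n _ _) (Π-1 n factor)
    where
    Π-1 : ∀ n {f} → (∀ j → f j ≈ 1#) → Π n f ≈ 1#
    Π-1 zero    eq = refl
    Π-1 (suc n) eq = trans (*-cong (Π-1 n eq) (eq n)) (*-identityˡ 1#)
    factor : ∀ j → (1# - - q * q ^ j) * ((1# - q * q ^ j) * inv (suc (j ℕ.+ j))) ≈ 1#
    factor j = begin
      (1# - - q * q ^ j) * ((1# - q * q ^ j) * v)
        ≈⟨ solve 3 (λ q P v → (:1 :- :- q :* P) :* ((:1 :- q :* P) :* v) := (:1 :- (q :* P) :* (q :* P)) :* v) refl q (q ^ j) v ⟩
      (1# - q ^ suc j * q ^ suc j) * v
        ≈⟨ *-congʳ (+-congˡ (-‿cong (trans (sym (^-homo-* q (suc j) (suc j))) (pow-≡ (≡.cong suc (ℕₚ.+-suc j j)))))) ⟩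
      (1# - q ^ suc (suc (j ℕ.+ j))) * v ≈⟨ inv-spec (suc (j ℕ.+ j)) ⟩
      1# ∎
      where v = inv (suc (j ℕ.+ j))

-- pent r = r (3r - 1) / 2, whose value at -r is pent r + r.
pent : ℕ → ℕ
pent r = r ℕ.* r ℕ.+ tri r

-- Exponents r(3r-1)/2 along residue classes modulo 6.

module PentExponents where

  open import Data.Nat.Base using (_+_; _*_)
  open import Data.Nat.Solver using (module +-*-Solver)
  open import Relation.Binary.PropositionalEquality
  open +-*-Solver
  open ≡-Reasoning

  -- Trades k^2 for `tri k`, after which the exponents below are linear in k and `tri k` and the
  -- solver can compare them.
  square : ∀ k → k * k ≡ 2 * tri k + k
  square zero    = refl
  square (suc k) = begin
    suc k * suc k                ≡⟨ solve 1 (λ k → (con 1 :+ k) :* (con 1 :+ k) := con 1 :+ con 2 :* k :+ k :* k) refl k ⟩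
    1 + 2 * k + k * k            ≡⟨ cong (1 + 2 * k +_) (square k) ⟩
    1 + 2 * k + (2 * tri k + k)
      ≡⟨ solve 2 (λ k T → con 1 :+ con 2 :* k :+ (con 2 :* T :+ k) := con 2 :* (k :+ T) :+ (con 1 :+ k)) refl k (tri k) ⟩
    2 * (k + tri k) + suc k      ∎

  tri-+ : ∀ a b → tri (a + b) ≡ tri a + tri b + a * b
  tri-+ zero    b = sym (solve 1 (λ x → con 0 :+ x :+ con 0 := x) refl (tri b))
  tri-+ (suc a) b = trans (cong (a + b +_) (tri-+ a b))
    (solve 4 (λ a b A B → a :+ b :+ (A :+ B :+ a :* b) := a :+ A :+ B :+ (con 1 :+ a) :* b) refl a b (tri a) (tri b))

  tri-double : ∀ k → tri (k * 2) ≡ 4 * tri k + k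
  tri-double zero    = refl
  tri-double (suc k) = trans (cong (λ t → 1 + k * 2 + (k * 2 + t)) (tri-double k))
    (solve 2 (λ k T → con 1 :+ k :* con 2 :+ (k :* con 2 :+ (con 4 :* T :+ k)) := con 4 :* (k :+ T) :+ (con 1 :+ k)) refl k (tri k))

  tri-sextuple : ∀ k → tri (k * 6) ≡ 36 * tri k + 15 * k
  tri-sextuple zero    = refl
  tri-sextuple (suc k) = trans (cong (λ t → 5 + k * 6 + (4 + k * 6 + (3 + k * 6 + (2 + k * 6 + (1 + k * 6 + (k * 6 + t)))))) (tri-sextuple k))
    (solve 2 (λ k T → let n = k :* con 6 in
      con 5 :+ n :+ (con 4 :+ n :+ (con 3 :+ n :+ (con 2 :+ n :+ (con 1 :+ n :+ (n :+ (con 36 :* T :+ con 15 :* k))))))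
      := con 36 :* (k :+ T) :+ con 15 :* (con 1 :+ k)) refl k (tri k))

  -- The second difference of `pent` is 3; steps of 6 multiply it by 36. This is the origin of the
  -- base q^108.
  pent-block : ∀ i k → pent (i + k * 6) ≡ pent i + 18 * (i * k) + 108 * tri k + 51 * k
  pent-block i k = begin
    (i + k * 6) * (i + k * 6) + tri (i + k * 6)
      ≡⟨ cong ((i + k * 6) * (i + k * 6) +_) (trans (tri-+ i (k * 6)) (cong (λ t → tri i + t + i * (k * 6)) (tri-sextuple k))) ⟩
    (i + k * 6) * (i + k * 6) + (tri i + (36 * T + 15 * k) + i * (k * 6))
      ≡⟨ solve 4 (λ i k I T →
           (i :+ k :* con 6) :* (i :+ k :* con 6) :+ (I :+ (con 36 :* T :+ con 15 :* k) :+ i :* (k :* con 6))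
           := con 36 :* (k :* k) :+ (i :* i :+ I :+ con 18 :* (i :* k) :+ con 36 :* T :+ con 15 :* k)) refl i k (tri i) T ⟩
    36 * (k * k) + (pent i + 18 * (i * k) + 36 * T + 15 * k)
      ≡⟨ cong (λ s → 36 * s + (pent i + 18 * (i * k) + 36 * T + 15 * k)) (square k) ⟩
    36 * (2 * T + k) + (pent i + 18 * (i * k) + 36 * T + 15 * k)
      ≡⟨ solve 4 (λ i k P T →
           con 36 :* (con 2 :* T :+ k) :+ (P :+ con 18 :* (i :* k) :+ con 36 :* T :+ con 15 :* k)
           := P :+ con 18 :* (i :* k) :+ con 108 :* T :+ con 51 :* k) refl i k (pent i) T ⟩
    pent i + 18 * (i * k) + 108 * T + 51 * k ∎
    where T = tri k

  -- The residues 0 and 3 modulo 6 form one class modulo 3, with second difference 3 · 9 = 27. A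
  -- block of length 6 therefore contains the theta indices 2k and 2k+1, each with two exponents.
  A₀ : ∀ k → 27 * tri (k * 2) + 12 * (k * 2) ≡ pent (k * 6)
  A₀ k = trans (cong (λ t → 27 * t + 12 * (k * 2)) (tri-double k)) (sym (trans (pent-block 0 k)
    (solve 2 (λ k T → con 108 :* T :+ con 51 :* k := con 27 :* (con 4 :* T :+ k) :+ con 12 :* (k :* con 2)) refl k (tri k))))

  A₁ : ∀ k → 27 * tri (k * 2) + (15 * suc (k * 2) + 27 * (k * 2)) ≡ pent (3 + k * 6) + (3 + k * 6)
  A₁ k = trans (cong (λ t → 27 * t + (15 * suc (k * 2) + 27 * (k * 2))) (tri-double k)) (sym (trans (cong (_+ (3 + k * 6)) (pent-block 3 k))
    (solve 2 (λ k T → con 12 :+ con 18 :* (con 3 :* k) :+ con 108 :* T :+ con 51 :* k :+ (con 3 :+ k :* con 6)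
       := con 27 :* (con 4 :* T :+ k) :+ (con 15 :* (con 1 :+ k :* con 2) :+ con 27 :* (k :* con 2))) refl k (tri k))))

  A₂ : ∀ k → 27 * tri (1 + k * 2) + 12 * (1 + k * 2) ≡ pent (3 + k * 6)
  A₂ k = trans (cong (λ t → 27 * (k * 2 + t) + 12 * (1 + k * 2)) (tri-double k)) (sym (trans (pent-block 3 k)
    (solve 2 (λ k T → con 12 :+ con 18 :* (con 3 :* k) :+ con 108 :* T :+ con 51 :* k
       := con 27 :* (k :* con 2 :+ (con 4 :* T :+ k)) :+ con 12 :* (con 1 :+ k :* con 2)) refl k (tri k))))

  A₃ : ∀ k → 27 * tri (1 + k * 2) + (15 * suc (1 + k * 2) + 27 * (1 + k * 2)) ≡ pent (6 + k * 6) + (6 + k * 6)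
  A₃ k = trans (cong (λ t → 27 * (k * 2 + t) + (15 * suc (1 + k * 2) + 27 * (1 + k * 2))) (tri-double k)) (sym (trans (cong (_+ (6 + k * 6)) (pent-block 6 k))
    (solve 2 (λ k T → con 51 :+ con 18 :* (con 6 :* k) :+ con 108 :* T :+ con 51 :* k :+ (con 6 :+ k :* con 6)
       := con 27 :* (k :* con 2 :+ (con 4 :* T :+ k)) :+ (con 15 :* (con 2 :+ k :* con 2) :+ con 27 :* (con 1 :+ k :* con 2))) refl k (tri k))))

  -- The class 5 modulo 6, met at r = -(1+6k) and at r = 5+6k. The offset 2 is its smallest
  -- exponent, at r = -1; likewise 7 below is that of the class 4, at r = -2.
  B₀ : ∀ k → 2 + (108 * tri k + 75 * k) ≡ pent (1 + k * 6) + (1 + k * 6)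
  B₀ k = sym (trans (cong (_+ (1 + k * 6)) (pent-block 1 k))
    (solve 2 (λ k T → con 1 :+ con 18 :* (con 1 :* k) :+ con 108 :* T :+ con 51 :* k :+ (con 1 :+ k :* con 6)
       := con 2 :+ (con 108 :* T :+ con 75 :* k)) refl k (tri k)))

  B₁ : ∀ k → 2 + (108 * tri k + (33 * suc k + 108 * k)) ≡ pent (5 + k * 6)
  B₁ k = sym (trans (pent-block 5 k)
    (solve 2 (λ k T → con 35 :+ con 18 :* (con 5 :* k) :+ con 108 :* T :+ con 51 :* k
       := con 2 :+ (con 108 :* T :+ (con 33 :* (con 1 :+ k) :+ con 108 :* k))) refl k (tri k)))

  C₀ : ∀ k → 7 + (108 * tri k + 93 * k) ≡ pent (2 + k * 6) + (2 + k * 6)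
  C₀ k = sym (trans (cong (_+ (2 + k * 6)) (pent-block 2 k))
    (solve 2 (λ k T → con 5 :+ con 18 :* (con 2 :* k) :+ con 108 :* T :+ con 51 :* k :+ (con 2 :+ k :* con 6)
       := con 7 :+ (con 108 :* T :+ con 93 :* k)) refl k (tri k)))

  C₁ : ∀ k → 7 + (108 * tri k + (15 * suc k + 108 * k)) ≡ pent (4 + k * 6)
  C₁ k = sym (trans (pent-block 4 k)
    (solve 2 (λ k T → con 22 :+ con 18 :* (con 4 :* k) :+ con 108 :* T :+ con 51 :* k
       := con 7 :+ (con 108 :* T :+ (con 15 :* (con 1 :+ k) :+ con 108 :* k))) refl k (tri k)))

-- Dissection of the series into three theta series.

module Dissection {a ℓ} (R : CommutativeRing a ℓ)
  (q : CommutativeRing.Carrier R) (inv : ℕ → CommutativeRing.Carrier R)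
  (inv-spec : Coefficients.InvertsOneMinusPowers R q inv) where

  open CommutativeRing R
  open import Data.Integer.Base using (0ℤ)
  open import Relation.Binary.PropositionalEquality as ≡ using (_≡_)
  open Exp semiring using (_^_; ^-homo-*; ^-assocʳ)
  open import Relation.Binary.Reasoning.Setoid setoid
  open import Algebra.Properties.Ring ring using (-‿involutive)
  open IntSolver R
  open Sums R
  open Coefficients R
  open QIdentities R q inv inv-spec

  -- The terms of index r and -r of ∑ ((-1)ʳ + χ(r)) q^(r(3r-1)/2), where χ is odd.
  τ σ : ℕ → Carrier
  τ r = (sgn r + χ r) * q ^ pent r
  σ r = (sgn r - χ r) * q ^ (pent r ℕ.+ r)

  summand-τσ : ∀ r → q ^ (suc r ℕ.* suc r) * α (suc r) ≈ τ (suc r) + σ (suc r)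
  summand-τσ r′ = begin
    q ^ (r ℕ.* r) * (sgn r * q ^ tri r * (1# + q ^ r) + χ r * q ^ tri r * (1# - q ^ r))
      ≈⟨ solve 5 (λ S T P g c → S :* (g :* T :* (:1 :+ P) :+ c :* T :* (:1 :- P))
           := (g :+ c) :* (S :* T) :+ (g :- c) :* (S :* T :* P)) refl (q ^ (r ℕ.* r)) (q ^ tri r) (q ^ r) (sgn r) (χ r) ⟩
    (sgn r + χ r) * (q ^ (r ℕ.* r) * q ^ tri r) + (sgn r - χ r) * (q ^ (r ℕ.* r) * q ^ tri r * q ^ r)
      ≈⟨ +-cong (*-congˡ (sym (^-homo-* q (r ℕ.* r) (tri r))))
           (*-congˡ (trans (*-congʳ (sym (^-homo-* q (r ℕ.* r) (tri r)))) (sym (^-homo-* q (pent r) r)))) ⟩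
    τ r + σ r ∎
    where r = suc r′

  -- Changes the folding from r with -r to r with -1-r, the one of `theta`. The price is the
  -- unpaired `τ n`, which tends to 0.
  Σ-summand : ∀ n → Σ (suc n) (λ r → q ^ (r ℕ.* r) * α r) ≈ Σ n (λ r → τ r + σ (suc r)) + τ n
  Σ-summand zero = solve 0 (con 0ℤ :+ :1 :* (:1 :+ con 0ℤ :* :1 :* (:1 :- :1)) := con 0ℤ :+ (:1 :+ con 0ℤ) :* :1) refl
  Σ-summand (suc n) = begin
    _ ≈⟨ +-cong (Σ-summand n) (summand-τσ n) ⟩
    Σ n (λ r → τ r + σ (suc r)) + τ n + (τ (suc n) + σ (suc n))
      ≈⟨ solve 4 (λ S a b c → S :+ a :+ (b :+ c) := S :+ (a :+ c) :+ b) refl _ _ _ _ ⟩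
    Σ (suc n) (λ r → τ r + σ (suc r)) + τ (suc n) ∎

  private
    Σ-sextuple : ∀ M f → Σ (M ℕ.* 6) f ≈ Σ M (λ k →
      f (k ℕ.* 6) + f (1 ℕ.+ k ℕ.* 6) + f (2 ℕ.+ k ℕ.* 6) + f (3 ℕ.+ k ℕ.* 6) + f (4 ℕ.+ k ℕ.* 6) + f (5 ℕ.+ k ℕ.* 6))
    Σ-sextuple zero    f = refl
    Σ-sextuple (suc M) f = trans
      (+-congʳ (+-congʳ (+-congʳ (+-congʳ (+-congʳ (+-congʳ (Σ-sextuple M f)))))))
      (solve 7 (λ S a b c d e g → S :+ a :+ b :+ c :+ d :+ e :+ g := S :+ (a :+ b :+ c :+ d :+ e :+ g)) refl _ _ _ _ _ _ _)

    Σ-double : ∀ M f → Σ (M ℕ.* 2) f ≈ Σ M (λ k → f (k ℕ.* 2) + f (1 ℕ.+ k ℕ.* 2))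
    Σ-double zero    f = refl
    Σ-double (suc M) f = trans (+-congʳ (+-congʳ (Σ-double M f))) (+-assoc _ _ _)

    sgn-double : ∀ k → sgn (k ℕ.* 2) ≈ 1#
    sgn-double zero    = refl
    sgn-double (suc k) = trans (-‿involutive _) (sgn-double k)

    sgn-sextuple : ∀ k → sgn (k ℕ.* 6) ≈ 1#
    sgn-sextuple zero    = refl
    sgn-sextuple (suc k) = trans (-‿involutive _) (trans (-‿involutive _) (trans (-‿involutive _) (sgn-sextuple k)))

    sgn-block : ∀ i k → sgn (i ℕ.+ k ℕ.* 6) ≈ sgn i
    sgn-block zero    k = sgn-sextuple k
    sgn-block (suc i) k = -‿cong (sgn-block i k)

    χ-block₀ : ∀ k → χ (k ℕ.* 6) ≡ 0#
    χ-block₀ zero    = ≡.refl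
    χ-block₀ (suc k) = χ-block₀ k

    χ-block₁ : ∀ k → χ (1 ℕ.+ k ℕ.* 6) ≡ 1#
    χ-block₁ zero    = ≡.refl
    χ-block₁ (suc k) = χ-block₁ k

    χ-block₂ : ∀ k → χ (2 ℕ.+ k ℕ.* 6) ≡ - 1#
    χ-block₂ zero    = ≡.refl
    χ-block₂ (suc k) = χ-block₂ k

    χ-block : ∀ i k → χ (i ℕ.+ k ℕ.* 6) ≈ χ i
    χ-block 0 k = reflexive (χ-block₀ k)
    χ-block 1 k = reflexive (χ-block₁ k)
    χ-block 2 k = reflexive (χ-block₂ k)
    χ-block (suc (suc (suc i))) k = χ-block i k

    τ-block : ∀ i k → τ (i ℕ.+ k ℕ.* 6) ≈ (sgn i + χ i) * q ^ pent (i ℕ.+ k ℕ.* 6)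
    τ-block i k = *-congʳ (+-cong (sgn-block i k) (χ-block i k))

    σ-block : ∀ i k → σ (i ℕ.+ k ℕ.* 6) ≈ (sgn i - χ i) * q ^ (pent (i ℕ.+ k ℕ.* 6) ℕ.+ (i ℕ.+ k ℕ.* 6))
    σ-block i k = *-congʳ (+-cong (sgn-block i k) (-‿cong (χ-block i k)))

    sgn-square : ∀ s → sgn s * sgn s ≈ 1#
    sgn-square zero    = *-identityˡ 1#
    sgn-square (suc s) = trans (solve 1 (λ x → :- x :* :- x := x :* x) refl (sgn s)) (sgn-square s)

    neg-^ : ∀ x s → (- x) ^ s ≈ sgn s * x ^ s
    neg-^ x zero    = sym (*-identityˡ 1#)
    neg-^ x (suc s) = trans (*-congˡ (neg-^ x s)) (solve 3 (λ x g y → :- x :* (g :* y) := :- g :* (x :* y)) refl x (sgn s) (x ^ s))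

    theta-pow : ∀ a b c s → theta (q ^ a) (q ^ b) (q ^ c) s
      ≈ sgn s * (q ^ (c ℕ.* tri s ℕ.+ a ℕ.* s) - q ^ (c ℕ.* tri s ℕ.+ (b ℕ.* suc s ℕ.+ c ℕ.* s)))
    theta-pow a b c s = begin
      (q ^ c) ^ tri s * (sgn s * ((q ^ a) ^ s - (q ^ b) ^ suc s * (q ^ c) ^ s))
        ≈⟨ *-cong (^-assocʳ q c (tri s)) (*-congˡ (+-cong (^-assocʳ q a s) (-‿cong (*-cong (^-assocʳ q b (suc s)) (^-assocʳ q c s))))) ⟩
      T * (sgn s * (X - Y * P))
        ≈⟨ solve 5 (λ T g X Y P → T :* (g :* (X :- Y :* P)) := g :* (T :* X :- T :* (Y :* P))) refl T (sgn s) X Y P ⟩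
      sgn s * (T * X - T * (Y * P))
        ≈⟨ *-congˡ (+-cong (sym (^-homo-* q (c ℕ.* tri s) (a ℕ.* s)))
             (-‿cong (trans (*-congˡ (sym (^-homo-* q (b ℕ.* suc s) (c ℕ.* s)))) (sym (^-homo-* q (c ℕ.* tri s) _))))) ⟩
      sgn s * (q ^ (c ℕ.* tri s ℕ.+ a ℕ.* s) - q ^ (c ℕ.* tri s ℕ.+ (b ℕ.* suc s ℕ.+ c ℕ.* s))) ∎
      where
      T = q ^ (c ℕ.* tri s)
      X = q ^ (a ℕ.* s)
      Y = q ^ (b ℕ.* suc s)
      P = q ^ (c ℕ.* s)

    -- The sign (-1)^s of the series cancels that of (-x)^s, and the odd extra power of -y cancels
    -- the minus sign between the two terms.
    theta-neg : ∀ x y p s → theta (- x) (- y) p s ≈ p ^ tri s * (x ^ s + y ^ suc s * p ^ s)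
    theta-neg x y p s = begin
      T * (g * ((- x) ^ s - (- y) ^ suc s * P))
        ≈⟨ *-congˡ (*-congˡ (+-cong (neg-^ x s) (-‿cong (*-congʳ (neg-^ y (suc s)))))) ⟩
      T * (g * (g * X - - g * Y * P))
        ≈⟨ solve 5 (λ T g X Y P → T :* (g :* (g :* X :- :- g :* Y :* P)) := (g :* g) :* (T :* (X :+ Y :* P))) refl T g X Y P ⟩
      g * g * (T * (X + Y * P)) ≈⟨ trans (*-congʳ (sgn-square s)) (*-identityˡ _) ⟩
      T * (X + Y * P) ∎
      where
      g = sgn s
      T = p ^ tri s
      X = x ^ s
      Y = y ^ suc s
      P = p ^ s

    theta-neg-pow : ∀ a b c e s → q ^ e * theta (- (q ^ a)) (- (q ^ b)) (q ^ c) s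
      ≈ q ^ (e ℕ.+ (c ℕ.* tri s ℕ.+ a ℕ.* s)) + q ^ (e ℕ.+ (c ℕ.* tri s ℕ.+ (b ℕ.* suc s ℕ.+ c ℕ.* s)))
    theta-neg-pow a b c e s = begin
      q ^ e * theta (- (q ^ a)) (- (q ^ b)) (q ^ c) s
        ≈⟨ *-congˡ (theta-neg _ _ _ s) ⟩
      q ^ e * ((q ^ c) ^ tri s * ((q ^ a) ^ s + (q ^ b) ^ suc s * (q ^ c) ^ s))
        ≈⟨ *-congˡ (*-cong (^-assocʳ q c (tri s)) (+-cong (^-assocʳ q a s) (*-cong (^-assocʳ q b (suc s)) (^-assocʳ q c s)))) ⟩
      q ^ e * (T * (X + Y * P))
        ≈⟨ solve 5 (λ E T X Y P → E :* (T :* (X :+ Y :* P)) := E :* (T :* X) :+ E :* (T :* (Y :* P))) refl _ T X Y P ⟩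
      q ^ e * (T * X) + q ^ e * (T * (Y * P))
        ≈⟨ +-cong (trans (*-congˡ (sym (^-homo-* q (c ℕ.* tri s) (a ℕ.* s)))) (sym (^-homo-* q e _)))
             (trans (*-congˡ (trans (*-congˡ (sym (^-homo-* q (b ℕ.* suc s) (c ℕ.* s)))) (sym (^-homo-* q (c ℕ.* tri s) _)))) (sym (^-homo-* q e _))) ⟩
      q ^ (e ℕ.+ (c ℕ.* tri s ℕ.+ a ℕ.* s)) + q ^ (e ℕ.+ (c ℕ.* tri s ℕ.+ (b ℕ.* suc s ℕ.+ c ℕ.* s))) ∎
      where
      T = q ^ (c ℕ.* tri s)
      X = q ^ (a ℕ.* s)
      Y = q ^ (b ℕ.* suc s)
      P = q ^ (c ℕ.* s)

  θA θB θC : ℕ → Carrier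
  θA = theta (q ^ 12) (q ^ 15) (q ^ 27)
  θB = theta (- (q ^ 75)) (- (q ^ 33)) (q ^ 108)
  θC = theta (- (q ^ 93)) (- (q ^ 15)) (q ^ 108)

  2ᴿ : Carrier
  2ᴿ = 1# + 1#

  dissection : ∀ M → Σ (M ℕ.* 6) (λ r → τ r + σ (suc r))
    ≈ Σ (M ℕ.* 2) θA - 2ᴿ * q ^ 2 * Σ M θB + 2ᴿ * q ^ 7 * Σ M θC
  dissection M = begin
    Σ (M ℕ.* 6) h ≈⟨ trans (Σ-sextuple M h) (Σ-cong M block) ⟩
    Σ M (λ k → (θA (k ℕ.* 2) + θA (1 ℕ.+ k ℕ.* 2)) + - (2ᴿ * q ^ 2 * θB k) + 2ᴿ * q ^ 7 * θC k)
      ≈⟨ trans (sym (Σ-+ M _ _)) (+-congʳ (sym (Σ-+ M _ _))) ⟩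
    Σ M (λ k → θA (k ℕ.* 2) + θA (1 ℕ.+ k ℕ.* 2)) + Σ M (λ k → - (2ᴿ * q ^ 2 * θB k)) + Σ M (λ k → 2ᴿ * q ^ 7 * θC k)
      ≈⟨ +-cong (+-cong (sym (Σ-double M θA)) (trans (sym (Σ-neg M _)) (-‿cong (sym (Σ-*ˡ M _ θB))))) (sym (Σ-*ˡ M _ θC)) ⟩
    Σ (M ℕ.* 2) θA - 2ᴿ * q ^ 2 * Σ M θB + 2ᴿ * q ^ 7 * Σ M θC ∎
    where
    h : ℕ → Carrier
    h r = τ r + σ (suc r)
    block : ∀ k → h (k ℕ.* 6) + h (1 ℕ.+ k ℕ.* 6) + h (2 ℕ.+ k ℕ.* 6) + h (3 ℕ.+ k ℕ.* 6) + h (4 ℕ.+ k ℕ.* 6) + h (5 ℕ.+ k ℕ.* 6)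
      ≈ (θA (k ℕ.* 2) + θA (1 ℕ.+ k ℕ.* 2)) + - (2ᴿ * q ^ 2 * θB k) + 2ᴿ * q ^ 7 * θC k
    block k = begin
      _ ≈⟨ +-cong (+-cong (+-cong (+-cong (+-cong
             (+-cong (τ-block 0 k) (σ-block 1 k)) (+-cong (τ-block 1 k) (σ-block 2 k))) (+-cong (τ-block 2 k) (σ-block 3 k)))
             (+-cong (τ-block 3 k) (σ-block 4 k))) (+-cong (τ-block 4 k) (σ-block 5 k))) (+-cong (τ-block 5 k) (σ-block 6 k)) ⟩
      -- The coefficients of τ at 0, ..., 5 are 1, 0, 0, -1, 2, -2, those of σ at 1, ..., 6 are -2,
      -- 2, -1, 0, 0, 1. They are entered in the unreduced form to which `sgn` and `χ` compute.
      _ ≈⟨ solve 12 (λ t₀ t₁ t₂ t₃ t₄ t₅ s₁ s₂ s₃ s₄ s₅ s₆ →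
             ((:1 :+ :0) :* t₀ :+ (:- :1 :- :1) :* s₁)
             :+ ((:- :1 :+ :1) :* t₁ :+ (:- :- :1 :- :- :1) :* s₂)
             :+ ((:- :- :1 :+ :- :1) :* t₂ :+ (:- :- :- :1 :- :0) :* s₃)
             :+ ((:- :- :- :1 :+ :0) :* t₃ :+ (:- :- :- :- :1 :- :1) :* s₄)
             :+ ((:- :- :- :- :1 :+ :1) :* t₄ :+ (:- :- :- :- :- :1 :- :- :1) :* s₅)
             :+ ((:- :- :- :- :- :1 :+ :- :1) :* t₅ :+ (:- :- :- :- :- :- :1 :- :0) :* s₆)
             := (:1 :* (t₀ :- s₃) :+ :- :1 :* (t₃ :- s₆)) :+ :- ((:1 :+ :1) :* (s₁ :+ t₅)) :+ (:1 :+ :1) :* (s₂ :+ t₄))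
             refl (t 0) (t 1) (t 2) (t 3) (t 4) (t 5) (s 1) (s 2) (s 3) (s 4) (s 5) (s 6) ⟩
      (1# * (t 0 - s 3) + - 1# * (t 3 - s 6)) + - (2ᴿ * (s 1 + t 5)) + 2ᴿ * (s 2 + t 4)
        ≈⟨ +-cong (+-cong (+-cong (sym eqA₀) (sym eqA₁)) (-‿cong (*-congˡ (sym eqB)))) (*-congˡ (sym eqC)) ⟩
      (θA (k ℕ.* 2) + θA (1 ℕ.+ k ℕ.* 2)) + - (2ᴿ * (q ^ 2 * θB k)) + 2ᴿ * (q ^ 7 * θC k)
        ≈⟨ +-cong (+-congˡ (-‿cong (sym (*-assoc _ _ _)))) (sym (*-assoc _ _ _)) ⟩
      (θA (k ℕ.* 2) + θA (1 ℕ.+ k ℕ.* 2)) + - (2ᴿ * q ^ 2 * θB k) + 2ᴿ * q ^ 7 * θC k ∎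
      where
      open PentExponents
      :0 : ∀ {n} → Polynomial n
      :0 = con 0ℤ
      t s : ℕ → Carrier
      t i = q ^ pent (i ℕ.+ k ℕ.* 6)
      s i = q ^ (pent (i ℕ.+ k ℕ.* 6) ℕ.+ (i ℕ.+ k ℕ.* 6))
      eqA₀ : θA (k ℕ.* 2) ≈ 1# * (t 0 - s 3)
      eqA₀ = trans (theta-pow 12 15 27 (k ℕ.* 2))
        (*-cong (sgn-double k) (+-cong (pow-≡ (A₀ k)) (-‿cong (pow-≡ (A₁ k)))))
      eqA₁ : θA (1 ℕ.+ k ℕ.* 2) ≈ - 1# * (t 3 - s 6)
      eqA₁ = trans (theta-pow 12 15 27 (1 ℕ.+ k ℕ.* 2))
        (*-cong (-‿cong (sgn-double k)) (+-cong (pow-≡ (A₂ k)) (-‿cong (pow-≡ (A₃ k)))))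
      eqB : q ^ 2 * θB k ≈ s 1 + t 5
      eqB = trans (theta-neg-pow 75 33 108 2 k) (+-cong (pow-≡ (B₀ k)) (pow-≡ (B₁ k)))
      eqC : q ^ 7 * θC k ≈ s 2 + t 4
      eqC = trans (theta-neg-pow 93 15 108 7 k) (+-cong (pow-≡ (C₀ k)) (pow-≡ (C₁ k)))

-- Rational estimates for powers and products.

module RationalBounds where

  open import Data.Integer.Base as ℤ using (+_)
  import Data.Integer.Properties as ℤₚ
  import Data.Nat.Properties as ℕₚ
  open import Data.Rational.Base as ℚ
  open import Data.Rational.Properties
  open import Data.Rational.Solver using (module +-*-Solver)
  import Data.Rational.Unnormalised.Base as ℚᵘ
  import Data.Rational.Unnormalised.Properties as ℚᵘₚ
  open import Relation.Binary.PropositionalEquality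
  open +-*-Solver

  0<1 : 0ℚ < 1ℚ
  0<1 = positive⁻¹ 1ℚ

  0≤1 : 0ℚ ≤ 1ℚ
  0≤1 = <⇒≤ 0<1

  0≤+ : ∀ {a b} → 0ℚ ≤ a → 0ℚ ≤ b → 0ℚ ≤ a + b
  0≤+ 0≤a 0≤b = +-mono-≤ {0ℚ} 0≤a 0≤b

  *-monoˡ : ∀ {a b c} → 0ℚ ≤ c → a ≤ b → c * a ≤ c * b
  *-monoˡ {c = c} 0≤c a≤b = *-monoˡ-≤-nonNeg c {{nonNegative 0≤c}} a≤b

  *-monoʳ : ∀ {a b c} → 0ℚ ≤ c → a ≤ b → a * c ≤ b * c
  *-monoʳ {c = c} 0≤c a≤b = *-monoʳ-≤-nonNeg c {{nonNegative 0≤c}} a≤b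

  *-mono : ∀ {a b c d} → 0ℚ ≤ a → a ≤ b → 0ℚ ≤ c → c ≤ d → a * c ≤ b * d
  *-mono 0≤a a≤b 0≤c c≤d = ≤-trans (*-monoʳ 0≤c a≤b) (*-monoˡ (≤-trans 0≤a a≤b) c≤d)

  0≤* : ∀ {a b} → 0ℚ ≤ a → 0ℚ ≤ b → 0ℚ ≤ a * b
  0≤* {a} {b} 0≤a 0≤b = subst (_≤ a * b) (*-zeroʳ a) (*-monoˡ 0≤a 0≤b)

  0<* : ∀ {a b} → 0ℚ < a → 0ℚ < b → 0ℚ < a * b
  0<* {a} {b} 0<a 0<b = subst (_< a * b) (*-zeroʳ a) (*-monoʳ-<-pos a {{positive 0<a}} 0<b)

  a≤a+b : ∀ a {b} → 0ℚ ≤ b → a ≤ a + b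
  a≤a+b a {b} 0≤b = subst (_≤ a + b) (+-identityʳ a) (+-monoʳ-≤ a 0≤b)

  a≤b+a : ∀ a {b} → 0ℚ ≤ b → a ≤ b + a
  a≤b+a a {b} 0≤b = subst (_≤ b + a) (+-identityˡ a) (+-monoˡ-≤ a 0≤b)

  a-b≤a : ∀ a {b} → 0ℚ ≤ b → a - b ≤ a
  a-b≤a a {b} 0≤b = subst (a - b ≤_) (+-identityʳ a) (+-monoʳ-≤ a (neg-antimono-≤ 0≤b))

  ≤⇒0≤- : ∀ {a b} → a ≤ b → 0ℚ ≤ b - a
  ≤⇒0≤- {a} {b} a≤b = subst (_≤ b - a) (+-inverseʳ a) (+-monoˡ-≤ (- a) a≤b)

  0≤-⇒≤ : ∀ {a b} → 0ℚ ≤ b - a → a ≤ b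
  0≤-⇒≤ {a} {b} p = subst₂ _≤_ (+-identityˡ a) (solve 2 (λ a b → b :- a :+ a := b) refl a b) (+-monoˡ-≤ a p)

  <⇒0<- : ∀ {a b} → a < b → 0ℚ < b - a
  <⇒0<- {a} {b} a<b = subst (_< b - a) (+-inverseʳ a) (+-monoˡ-< (- a) a<b)

  quotient : ∀ a {b} → 0ℚ < b → ∃[ c ] b * c ≡ a × (0ℚ ≤ a → 0ℚ ≤ c) × (0ℚ < a → 0ℚ < c)
  quotient a {b} 0<b = 1/ b * a
    , trans (sym (*-assoc b _ a)) (trans (cong (_* a) (*-inverseʳ b)) (*-identityˡ a))
    , 0≤* (<⇒≤ 0<1/b) , 0<* 0<1/b
    where
    instance
      b-pos : Positive b
      b-pos = positive 0<b
      b≢0 : NonZero b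
      b≢0 = pos⇒nonZero b
    0<1/b : 0ℚ < 1/ b
    0<1/b = positive⁻¹ (1/ b) {{1/pos⇒pos b}}

  -- δ = ε / (1 + K), where the 1 keeps the divisor positive at K = 0.
  shrink : ∀ {K ε} → 0ℚ ≤ K → 0ℚ < ε → ∃[ δ ] 0ℚ < δ × K * δ ≤ ε
  shrink {K} {ε} 0≤K 0<ε = δ , δ-pos 0<ε , ≤-trans (*-monoʳ (<⇒≤ (δ-pos 0<ε)) (a≤b+a K 0≤1)) (≤-reflexive eq)
    where
    d = quotient ε {1ℚ + K} (+-mono-<-≤ {0ℚ} 0<1 0≤K)
    δ = proj₁ d
    eq = proj₁ (proj₂ d)
    δ-pos = proj₂ (proj₂ (proj₂ d))

  multiple : ℕ → ℚ → ℚ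
  multiple zero    x = 0ℚ
  multiple (suc n) x = x + multiple n x

  private
    toℚᵘ-multiple : ∀ K x → toℚᵘ (multiple K x) ℚᵘ.≃ ℚᵘ.mkℚᵘ (+ K ℤ.* ↥ x) (ℚ.denominator-1 x)
    toℚᵘ-multiple zero    x@record{} = ℚᵘ.*≡* (cong (ℤ._* ↧ x) (sym (ℤₚ.*-zeroˡ (↥ x))))
    toℚᵘ-multiple (suc K) x@record{} = ℚᵘₚ.≃-trans (toℚᵘ-homo-+ x (multiple K x))
      (ℚᵘₚ.≃-trans (ℚᵘₚ.+-congʳ (toℚᵘ x) (toℚᵘ-multiple K x)) (ℚᵘ.*≡* (eq (↥ x) (+ K) (↧ x))))
      where
      open import Data.Integer.Solver using () renaming (module +-*-Solver to ℤS)
      eq : ∀ n k d → (n ℤ.* d ℤ.+ (k ℤ.* n) ℤ.* d) ℤ.* d ≡ (+ 1 ℤ.+ k) ℤ.* n ℤ.* (d ℤ.* d)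
      eq = ℤS.solve 3 (λ n k d → (n ℤS.:* d ℤS.:+ (k ℤS.:* n) ℤS.:* d) ℤS.:* d
        ℤS.:= (ℤS.con (+ 1) ℤS.:+ k) ℤS.:* n ℤS.:* (d ℤS.:* d)) refl

  -- The denominator of x is the witness: multiplied by it, x becomes its numerator, a positive
  -- integer.
  archimedean : ∀ {x} → 0ℚ < x → ∃[ K ] 1ℚ ≤ multiple K x
  archimedean {mkℚ (+ zero) d c} 0<x with positive 0<x
  ... | ()
  archimedean {mkℚ (ℤ.-[1+ n ]) d c} 0<x with positive 0<x
  ... | ()
  archimedean {x@(mkℚ (+ (suc n)) d c)} 0<x = suc d , toℚᵘ-cancel-≤
    (ℚᵘₚ.≤-respʳ-≃ (ℚᵘₚ.≃-sym (toℚᵘ-multiple (suc d) x)) (ℚᵘ.*≤* (ℤ.+≤+ bound)))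
    where
    bound : 1 ℕ.* suc d ℕ.≤ suc d ℕ.* suc n ℕ.* 1
    bound = subst₂ ℕ._≤_ (sym (ℕₚ.*-identityˡ (suc d))) (sym (ℕₚ.*-identityʳ _)) (ℕₚ.m≤m*n (suc d) (suc n))

  pow : ℚ → ℕ → ℚ
  pow ρ zero    = 1ℚ
  pow ρ (suc n) = ρ * pow ρ n

  module Geometric {ρ : ℚ} (0≤ρ : 0ℚ ≤ ρ) (ρ<1 : ρ < 1ℚ) where

    0<1-ρ : 0ℚ < 1ℚ - ρ
    0<1-ρ = <⇒0<- ρ<1

    ρ≤1 : ρ ≤ 1ℚ
    ρ≤1 = <⇒≤ ρ<1

    0≤pow : ∀ n → 0ℚ ≤ pow ρ n
    0≤pow zero    = 0≤1
    0≤pow (suc n) = 0≤* 0≤ρ (0≤pow n)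

    pow-suc≤ : ∀ n → pow ρ (suc n) ≤ pow ρ n
    pow-suc≤ n = subst (pow ρ (suc n) ≤_) (*-identityˡ _) (*-monoʳ (0≤pow n) ρ≤1)

    pow≤1 : ∀ n → pow ρ n ≤ 1ℚ
    pow≤1 zero    = ≤-refl
    pow≤1 (suc n) = ≤-trans (pow-suc≤ n) (pow≤1 n)

    pow-antitone : ∀ {m n} → m ℕ.≤ n → pow ρ n ≤ pow ρ m
    pow-antitone {n = n} ℕ.z≤n = pow≤1 n
    pow-antitone (ℕ.s≤s m≤n)   = *-monoˡ 0≤ρ (pow-antitone m≤n)

    0≤multiple : ∀ {x} K → 0ℚ ≤ x → 0ℚ ≤ multiple K x
    0≤multiple zero    0≤x = ≤-refl
    0≤multiple (suc K) 0≤x = 0≤+ 0≤x (0≤multiple K 0≤x)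

    -- Bernoulli's inequality for 1/ρ.
    pow-Bernoulli : ∀ K → pow ρ K * (1ℚ + multiple K (1ℚ - ρ)) ≤ 1ℚ
    pow-Bernoulli zero = ≤-refl
    pow-Bernoulli (suc K) = ≤-trans
      (subst (_≤ pow ρ K * (1ℚ + m)) (eq ρ (pow ρ K) m) (a-b≤a _ (0≤* (0≤pow K) (0≤* (<⇒≤ 0<1-ρ) (0≤+ (<⇒≤ 0<1-ρ) (0≤multiple K (<⇒≤ 0<1-ρ)))))))
      (pow-Bernoulli K)
      where
      m = multiple K (1ℚ - ρ)
      eq : ∀ ρ p m → p * (1ℚ + m) - p * ((1ℚ - ρ) * ((1ℚ - ρ) + m)) ≡ ρ * p * (1ℚ + ((1ℚ - ρ) + m))
      eq = solve 3 (λ ρ p m →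
        p :* (con 1ℚ :+ m) :- p :* ((con 1ℚ :- ρ) :* ((con 1ℚ :- ρ) :+ m))
        := ρ :* p :* (con 1ℚ :+ ((con 1ℚ :- ρ) :+ m))) refl

    multiple-* : ∀ K x y → multiple K (x * y) ≡ multiple K x * y
    multiple-* zero    x y = sym (*-zeroˡ y)
    multiple-* (suc K) x y = trans (cong (λ z → x * y + z) (multiple-* K x y)) (sym (*-distribʳ-+ y x _))

    -- Choose K with K (1-ρ) ε ≥ 1. Then ρ^K is at most ρ^K K (1-ρ) ε, and `pow-Bernoulli` bounds
    -- this by ε. No division by ρ occurs, so ρ = 0 is covered.
    pow-small : ∀ {ε} → 0ℚ < ε → ∃[ K ] pow ρ K ≤ ε
    pow-small {ε} 0<ε = K , (begin
      pow ρ K                ≡⟨ sym (*-identityʳ _) ⟩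
      pow ρ K * 1ℚ           ≤⟨ *-monoˡ (0≤pow K) (proj₂ found) ⟩
      pow ρ K * multiple K ((1ℚ - ρ) * ε) ≡⟨ cong (pow ρ K *_) (multiple-* K (1ℚ - ρ) ε) ⟩
      pow ρ K * (multiple K (1ℚ - ρ) * ε) ≡⟨ sym (*-assoc (pow ρ K) _ ε) ⟩
      pow ρ K * multiple K (1ℚ - ρ) * ε ≤⟨ *-monoʳ (<⇒≤ 0<ε) (≤-trans (*-monoˡ (0≤pow K) (a≤b+a _ 0≤1)) (pow-Bernoulli K)) ⟩
      1ℚ * ε                 ≡⟨ *-identityˡ ε ⟩
      ε                      ∎)
      where
      open ≤-Reasoning
      found = archimedean (0<* 0<1-ρ 0<ε)
      K = proj₁ found

    scaled-pow-small : ∀ {C ε} → 0ℚ ≤ C → 0ℚ < ε → ∃[ K ] C * pow ρ K ≤ ε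
    scaled-pow-small {C} 0≤C 0<ε = K , ≤-trans (*-monoˡ 0≤C (proj₂ small)) (proj₂ (proj₂ δ))
      where
      δ = shrink 0≤C 0<ε
      small = pow-small (proj₁ (proj₂ δ))
      K = proj₁ small

    geometric-scale : ∀ {C} → 0ℚ ≤ C → ∃[ C′ ] 0ℚ ≤ C′ × (1ℚ - ρ) * C′ ≡ C
    geometric-scale {C} 0≤C = proj₁ d , proj₁ (proj₂ (proj₂ d)) 0≤C , proj₁ (proj₂ d)
      where d = quotient C 0<1-ρ

    partialProduct : ℚ → ℕ → ℚ
    partialProduct C zero    = 1ℚ
    partialProduct C (suc n) = partialProduct C n * (1ℚ + C * pow ρ n)

    -- In place of the exponential: from an index K on, the terms sum to at most 1/2, and while a
    -- partial sum s has 2s ≤ 1 the product stays below 1 + 2s.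
    partialProduct-bounded : ∀ {C} → 0ℚ ≤ C → ∃[ B ] 0ℚ ≤ B × (∀ n → partialProduct C n ≤ B)
    partialProduct-bounded {C} 0≤C = P K * (1ℚ + 1ℚ) , 0≤* (0≤P K) (0≤+ 0≤1 0≤1) , λ n →
      ≤-trans (subst (λ k → P n ≤ P k) (ℕₚ.+-comm K n) (P-mono K n)) (≤-trans (tail n)
        (*-monoˡ (0≤P K) (+-monoʳ-≤ 1ℚ (2s≤1 n))))
      where
      open ≤-Reasoning
      P = partialProduct C
      scale = geometric-scale 0≤C
      C′ = proj₁ scale
      0≤C′ = proj₁ (proj₂ scale)
      C′-eq = proj₂ (proj₂ scale)
      small = scaled-pow-small 0≤C′ (positive⁻¹ ½)
      K = proj₁ small
      a : ℕ → ℚ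
      a n = C * pow ρ n
      0≤a : ∀ n → 0ℚ ≤ a n
      0≤a n = 0≤* 0≤C (0≤pow n)
      0≤P : ∀ n → 0ℚ ≤ P n
      0≤P zero    = 0≤1
      0≤P (suc n) = 0≤* (0≤P n) (0≤+ 0≤1 (0≤a n))
      P-mono : ∀ j n → P n ≤ P (j ℕ.+ n)
      P-mono zero    n = ≤-refl
      P-mono (suc j) n = ≤-trans (P-mono j n)
        (subst (_≤ P (suc j ℕ.+ n)) (*-identityʳ _) (*-monoˡ (0≤P (j ℕ.+ n)) (a≤a+b 1ℚ (0≤a (j ℕ.+ n)))))
      -- The sum of the j terms `a K`, ..., in closed form.
      s : ℕ → ℚ
      s j = C′ * (pow ρ K - pow ρ (j ℕ.+ K))
      s≤½ : ∀ j → s j ≤ ½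
      s≤½ j = ≤-trans (*-monoˡ 0≤C′ (a-b≤a _ (0≤pow (j ℕ.+ K)))) (proj₂ small)
      2s≤1 : ∀ j → s j + s j ≤ 1ℚ
      2s≤1 j = +-mono-≤ {s j} {½} {s j} {½} (s≤½ j) (s≤½ j)
      s-suc : ∀ j → s j + a (j ℕ.+ K) ≡ s (suc j)
      s-suc j = trans (cong (λ c → s j + c * pow ρ (j ℕ.+ K)) (sym C′-eq))
        (solve 4 (λ ρ c x y → c :* (x :- y) :+ (con 1ℚ :- ρ) :* c :* y := c :* (x :- ρ :* y)) refl ρ C′ (pow ρ K) (pow ρ (j ℕ.+ K)))
      step : ∀ s a → 0ℚ ≤ a → s + s ≤ 1ℚ → (1ℚ + (s + s)) * (1ℚ + a) ≤ 1ℚ + ((s + a) + (s + a))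
      step s a 0≤a 2s≤1 = 0≤-⇒≤ (subst (0ℚ ≤_)
        (solve 2 (λ s a → a :* (con 1ℚ :- (s :+ s))
          := con 1ℚ :+ ((s :+ a) :+ (s :+ a)) :- (con 1ℚ :+ (s :+ s)) :* (con 1ℚ :+ a)) refl s a)
        (0≤* 0≤a (≤⇒0≤- 2s≤1)))
      tail : ∀ j → P (j ℕ.+ K) ≤ P K * (1ℚ + (s j + s j))
      tail zero = ≤-reflexive (solve 3 (λ p c x → p := p :* (con 1ℚ :+ (c :* (x :- x) :+ c :* (x :- x)))) refl (P K) C′ (pow ρ K))
      tail (suc j) = begin
        P (j ℕ.+ K) * (1ℚ + a (j ℕ.+ K))                       ≤⟨ *-monoʳ (0≤+ 0≤1 (0≤a (j ℕ.+ K))) (tail j) ⟩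
        P K * (1ℚ + (s j + s j)) * (1ℚ + a (j ℕ.+ K))          ≡⟨ *-assoc (P K) _ _ ⟩
        P K * ((1ℚ + (s j + s j)) * (1ℚ + a (j ℕ.+ K)))        ≤⟨ *-monoˡ (0≤P K) (step (s j) (a (j ℕ.+ K)) (0≤a (j ℕ.+ K)) (2s≤1 j)) ⟩
        P K * (1ℚ + ((s j + a (j ℕ.+ K)) + (s j + a (j ℕ.+ K)))) ≡⟨ cong (λ z → P K * (1ℚ + (z + z))) (s-suc j) ⟩
        P K * (1ℚ + (s (suc j) + s (suc j)))                   ∎

-- The norm is given only through its rational upper bounds.
record BanachRing : Set (lsuc 0ℓ) where
  infix 4 ∥_∥≤_
  field
    commutativeRing : CommutativeRing 0ℓ 0ℓ
  open CommutativeRing commutativeRing public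
  field
    ∥_∥≤_      : Carrier → ℚ → Set
    ∥∥-resp    : ∀ {x y r} → x ≈ y → ∥ x ∥≤ r → ∥ y ∥≤ r
    ∥∥-weaken  : ∀ {x r s} → r ℚ.≤ s → ∥ x ∥≤ r → ∥ x ∥≤ s
    ∥∥-nonneg  : ∀ {x r} → ∥ x ∥≤ r → 0ℚ ℚ.≤ r
    ∥∥-+       : ∀ {x y r s} → ∥ x ∥≤ r → ∥ y ∥≤ s → ∥ x + y ∥≤ (r ℚ.+ s)
    ∥∥-*       : ∀ {x y r s} → ∥ x ∥≤ r → ∥ y ∥≤ s → ∥ x * y ∥≤ (r ℚ.* s)
    ∥∥-neg     : ∀ {x r} → ∥ x ∥≤ r → ∥ - x ∥≤ r
    ∥∥-0       : ∥ 0# ∥≤ 0ℚ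
    ∥∥-1       : ∥ 1# ∥≤ 1ℚ
    ∥∥-closed  : ∀ {x r} → 0ℚ ℚ.≤ r → (∀ ε → 0ℚ ℚ.< ε → ∥ x ∥≤ (r ℚ.+ ε)) → ∥ x ∥≤ r
    ∥∥-zero    : ∀ {x} → ∥ x ∥≤ 0ℚ → x ≈ 0#
    ∥∥-bounded : ∀ x → ∃[ r ] ∥ x ∥≤ r
    complete   : ∀ (f : ℕ → Carrier) →
      (∀ ε → 0ℚ ℚ.< ε → ∃[ N ] (∀ m n → N ℕ.≤ m → N ℕ.≤ n → ∥ f m - f n ∥≤ ε)) →
      ∃[ L ] (∀ ε → 0ℚ ℚ.< ε → ∃[ N ] (∀ n → N ℕ.≤ n → ∥ f n - L ∥≤ ε))

-- Limits, series and dominated convergence in a complete normed ring.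

module Limits (𝔹 : BanachRing) where

  open BanachRing 𝔹
  open import Data.Integer.Base using (0ℤ)
  import Data.Nat.Properties as ℕₚ
  import Data.Rational.Properties as ℚₚ
  open import Relation.Binary.PropositionalEquality as ≡ using (_≡_)
  open IntSolver commutativeRing
  open Sums commutativeRing
  open RationalBounds

  infix 4 _⇒_

  _⇒_ : (ℕ → Carrier) → Carrier → Set
  f ⇒ L = ∀ ε → 0ℚ ℚ.< ε → ∃[ N ] (∀ n → N ℕ.≤ n → ∥ f n - L ∥≤ ε)

  ∥∥-≡ : ∀ {x r s} → r ≡ s → ∥ x ∥≤ r → ∥ x ∥≤ s
  ∥∥-≡ ≡.refl p = p

  -- Lets an estimate end in any fixed multiple of ε.
  ⇒-scaled : ∀ {f L K} → 0ℚ ℚ.≤ K →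
    (∀ ε → 0ℚ ℚ.< ε → ∃[ N ] (∀ n → N ℕ.≤ n → ∥ f n - L ∥≤ (K ℚ.* ε))) → f ⇒ L
  ⇒-scaled {K = K} 0≤K p ε 0<ε =
    let δ , 0<δ , Kδ≤ε = shrink 0≤K 0<ε
        N , close = p δ 0<δ
    in N , λ n N≤n → ∥∥-weaken Kδ≤ε (close n N≤n)

  ⇒-cong : ∀ {f g L M} → (∀ n → f n ≈ g n) → L ≈ M → f ⇒ L → g ⇒ M
  ⇒-cong f≈g L≈M p ε 0<ε =
    let N , close = p ε 0<ε
    in N , λ n N≤n → ∥∥-resp (+-cong (f≈g n) (-‿cong L≈M)) (close n N≤n)

  ⇒-const : ∀ x → (λ _ → x) ⇒ x
  ⇒-const x ε 0<ε = 0 , λ n _ → ∥∥-resp (sym (-‿inverseʳ x)) (∥∥-weaken (ℚₚ.<⇒≤ 0<ε) ∥∥-0)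

  private
    2* : ∀ ε → ε ℚ.+ ε ≡ (1ℚ ℚ.+ 1ℚ) ℚ.* ε
    2* ε = ≡.sym (≡.trans (ℚₚ.*-distribʳ-+ ε 1ℚ 1ℚ) (≡.cong₂ ℚ._+_ (ℚₚ.*-identityˡ ε) (ℚₚ.*-identityˡ ε)))

    0≤2 : 0ℚ ℚ.≤ 1ℚ ℚ.+ 1ℚ
    0≤2 = 0≤+ 0≤1 0≤1

  ⇒-+ : ∀ {f g L M} → f ⇒ L → g ⇒ M → (λ n → f n + g n) ⇒ L + M
  ⇒-+ {f} {g} {L} {M} p r = ⇒-scaled 0≤2 λ ε 0<ε →
    let N , close = p ε 0<ε
        N′ , close′ = r ε 0<ε
    in N ℕ.⊔ N′ , λ n N≤n → ∥∥-≡ (2* ε) (∥∥-resp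
         (solve 4 (λ a b c d → a :- b :+ (c :- d) := a :+ c :- (b :+ d)) refl (f n) L (g n) M)
         (∥∥-+ (close n (ℕₚ.m⊔n≤o⇒m≤o N N′ N≤n)) (close′ n (ℕₚ.m⊔n≤o⇒n≤o N N′ N≤n))))

  ⇒-neg : ∀ {f L} → f ⇒ L → (λ n → - f n) ⇒ - L
  ⇒-neg {f} {L} p ε 0<ε =
    let N , close = p ε 0<ε
    in N , λ n N≤n → ∥∥-resp (solve 2 (λ a b → :- (a :- b) := :- a :- :- b) refl (f n) L) (∥∥-neg (close n N≤n))

  ⇒-* : ∀ {f g L M} → f ⇒ L → g ⇒ M → (λ n → f n * g n) ⇒ L * M
  ⇒-* {f} {g} {L} {M} p r = ⇒-scaled (0≤+ (0≤+ 0≤1 0≤l) 0≤m) λ ε 0<ε →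
    let N₀ , close = p ε 0<ε
        N₁ , close′ = r ε 0<ε
        -- A second bound on g - M, by 1, keeps the product (f - L) (g - M) linear in ε.
        N₂ , close″ = r 1ℚ 0<1
        N = N₀ ℕ.⊔ (N₁ ℕ.⊔ N₂)
    in N , λ n N≤n →
      let n≥N₀ = ℕₚ.m⊔n≤o⇒m≤o N₀ _ N≤n
          n≥N₁₂ = ℕₚ.m⊔n≤o⇒n≤o N₀ (N₁ ℕ.⊔ N₂) N≤n
          n≥N₁ = ℕₚ.m⊔n≤o⇒m≤o N₁ N₂ n≥N₁₂
          n≥N₂ = ℕₚ.m⊔n≤o⇒n≤o N₁ N₂ n≥N₁₂
      in ∥∥-≡ (eq ε l m) (∥∥-resp
           (solve 4 (λ f L g M → (f :- L) :* (g :- M) :+ L :* (g :- M) :+ (f :- L) :* M := f :* g :- L :* M) refl (f n) L (g n) M)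
           (∥∥-+ (∥∥-+ (∥∥-* (close n n≥N₀) (close″ n n≥N₂)) (∥∥-* (proj₂ (∥∥-bounded L)) (close′ n n≥N₁)))
                 (∥∥-* (close n n≥N₀) (proj₂ (∥∥-bounded M)))))
    where
    l = proj₁ (∥∥-bounded L)
    m = proj₁ (∥∥-bounded M)
    0≤l = ∥∥-nonneg (proj₂ (∥∥-bounded L))
    0≤m = ∥∥-nonneg (proj₂ (∥∥-bounded M))
    eq : ∀ ε l m → ε ℚ.* 1ℚ ℚ.+ l ℚ.* ε ℚ.+ ε ℚ.* m ≡ (1ℚ ℚ.+ l ℚ.+ m) ℚ.* ε
    eq = ℚS.solve 3 (λ ε l m → ε ℚS.:* ℚS.con 1ℚ ℚS.:+ l ℚS.:* ε ℚS.:+ ε ℚS.:* m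
      ℚS.:= (ℚS.con 1ℚ ℚS.:+ l ℚS.:+ m) ℚS.:* ε) ≡.refl
      where open import Data.Rational.Solver using () renaming (module +-*-Solver to ℚS)

  -≈0⇒≈ : ∀ {x y} → x - y ≈ 0# → x ≈ y
  -≈0⇒≈ {x} {y} eq = trans (solve 2 (λ x y → x := (x :- y) :+ y) refl x y) (trans (+-congʳ eq) (+-identityˡ y))

  ⇒-unique : ∀ {f L M} → f ⇒ L → f ⇒ M → L ≈ M
  ⇒-unique {f} {L} {M} p r = -≈0⇒≈ (∥∥-zero (∥∥-closed ℚₚ.≤-refl λ ε 0<ε →
    let δ , 0<δ , 2δ≤ε = shrink 0≤2 0<ε
        N , close = p δ 0<δ
        N′ , close′ = r δ 0<δ
        n = N ℕ.⊔ N′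
    in ∥∥-weaken (ℚₚ.≤-trans (ℚₚ.≤-reflexive (2* δ)) (ℚₚ.≤-trans 2δ≤ε (a≤b+a ε ℚₚ.≤-refl)))
         (∥∥-resp (solve 3 (λ f L M → :- (f :- L) :+ (f :- M) := L :- M) refl (f n) L M)
           (∥∥-+ (∥∥-neg (close n (ℕₚ.m≤m⊔n N N′))) (close′ n (ℕₚ.m≤n⊔m N N′))))))

  ⇒-subsequence : ∀ {f L} (φ : ℕ → ℕ) → (∀ n → n ℕ.≤ φ n) → f ⇒ L → (λ n → f (φ n)) ⇒ L
  ⇒-subsequence φ n≤φ p ε 0<ε =
    let N , close = p ε 0<ε in N , λ n N≤n → close (φ n) (ℕₚ.≤-trans N≤n (n≤φ n))

  ⇒-drop : ∀ {f L} k → (λ n → f (k ℕ.+ n)) ⇒ L → f ⇒ L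
  ⇒-drop {f} {L} k p ε 0<ε =
    let N , close = p ε 0<ε
    in k ℕ.+ N , λ n k+N≤n →
         ≡.subst (λ i → ∥ f i - L ∥≤ ε) (ℕₚ.m+[n∸m]≡n (ℕₚ.m+n≤o⇒m≤o k k+N≤n))
           (close (n ℕ.∸ k) (ℕₚ.m+n≤o⇒m≤o∸n N (≡.subst (ℕ._≤ n) (ℕₚ.+-comm k N) k+N≤n)))

  ⇒-bound : ∀ {f L r} → f ⇒ L → (∀ n → ∥ f n ∥≤ r) → ∥ L ∥≤ r
  ⇒-bound {f} {L} p b = ∥∥-closed (∥∥-nonneg (b 0)) λ ε 0<ε →
    let N , close = p ε 0<ε
    in ∥∥-resp (solve 2 (λ f L → f :- (f :- L) := L) refl (f N) L) (∥∥-+ (b N) (∥∥-neg (close N ℕₚ.≤-refl)))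

  ⇒-Σ : ∀ K {f : ℕ → ℕ → Carrier} {g} → (∀ n → (λ N → f N n) ⇒ g n) → (λ N → Σ K (f N)) ⇒ Σ K g
  ⇒-Σ zero    p = ⇒-const 0#
  ⇒-Σ (suc K) p = ⇒-+ (⇒-Σ K p) (p K)

  module Geometrically {ρ : ℚ} (0≤ρ : 0ℚ ℚ.≤ ρ) (ρ<1 : ρ ℚ.< 1ℚ) where

    open Geometric 0≤ρ ρ<1
    open Exp semiring using (_^_)

    ∥^∥ : ∀ {x} n → ∥ x ∥≤ ρ → ∥ x ^ n ∥≤ pow ρ n
    ∥^∥ zero    p = ∥∥-1
    ∥^∥ (suc n) p = ∥∥-* p (∥^∥ n p)

    null : ∀ {f C} → 0ℚ ℚ.≤ C → (∀ n → ∥ f n ∥≤ (C ℚ.* pow ρ n)) → f ⇒ 0#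
    null {f} 0≤C b ε 0<ε =
      let K , small = scaled-pow-small 0≤C 0<ε
      in K , λ n K≤n → ∥∥-resp (solve 1 (λ x → x := x :- con 0ℤ) refl (f n))
           (∥∥-weaken (ℚₚ.≤-trans (*-monoˡ 0≤C (pow-antitone K≤n)) small) (b n))

    module Series {h : ℕ → Carrier} {C : ℚ} (0≤C : 0ℚ ℚ.≤ C) (b : ∀ n → ∥ h n ∥≤ (C ℚ.* pow ρ n)) where

      C′ : ℚ
      C′ = proj₁ (geometric-scale 0≤C)

      0≤C′ : 0ℚ ℚ.≤ C′
      0≤C′ = proj₁ (proj₂ (geometric-scale 0≤C))

      private
        -- The bound is the exact geometric sum, since the weaker C′ ρ^K of `tail` would not carry
        -- the induction.
        block : ∀ j K → ∥ Σ (j ℕ.+ K) h - Σ K h ∥≤ (C′ ℚ.* (pow ρ K ℚ.- pow ρ (j ℕ.+ K)))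
        block zero K = ∥∥-≡ (≡.sym (≡.trans (≡.cong (C′ ℚ.*_) (ℚₚ.+-inverseʳ (pow ρ K))) (ℚₚ.*-zeroʳ C′)))
          (∥∥-resp (sym (-‿inverseʳ _)) ∥∥-0)
        block (suc j) K = ∥∥-≡ (≡.trans
            (≡.cong (λ c → C′ ℚ.* (pow ρ K ℚ.- pow ρ (j ℕ.+ K)) ℚ.+ c ℚ.* pow ρ (j ℕ.+ K)) (≡.sym (proj₂ (proj₂ (geometric-scale 0≤C)))))
            (eq ρ C′ (pow ρ K) (pow ρ (j ℕ.+ K))))
          (∥∥-resp (solve 3 (λ a b c → a :- b :+ c := a :+ c :- b) refl _ _ _) (∥∥-+ (block j K) (b (j ℕ.+ K))))
          where
          open import Data.Rational.Solver using () renaming (module +-*-Solver to ℚS)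
          eq : ∀ ρ c x y → c ℚ.* (x ℚ.- y) ℚ.+ (1ℚ ℚ.- ρ) ℚ.* c ℚ.* y ≡ c ℚ.* (x ℚ.- ρ ℚ.* y)
          eq = ℚS.solve 4 (λ ρ c x y → c ℚS.:* (x ℚS.:- y) ℚS.:+ (ℚS.con 1ℚ ℚS.:- ρ) ℚS.:* c ℚS.:* y
            ℚS.:= c ℚS.:* (x ℚS.:- ρ ℚS.:* y)) ≡.refl

      tail : ∀ {K n} → K ℕ.≤ n → ∥ Σ n h - Σ K h ∥≤ (C′ ℚ.* pow ρ K)
      tail {K} {n} K≤n = ≡.subst (λ i → ∥ Σ i h - Σ K h ∥≤ (C′ ℚ.* pow ρ K)) (ℕₚ.m∸n+n≡m K≤n)
        (∥∥-weaken (*-monoˡ 0≤C′ (a-b≤a _ (0≤pow (n ℕ.∸ K ℕ.+ K)))) (block (n ℕ.∸ K) K))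

      private
        limit : ∃[ L ] (λ n → Σ n h) ⇒ L
        limit = complete (λ n → Σ n h) λ ε 0<ε →
          let δ , 0<δ , 2δ≤ε = shrink 0≤2 0<ε
              K , small = scaled-pow-small 0≤C′ 0<δ
          in K , λ m n K≤m K≤n → ∥∥-weaken (ℚₚ.≤-trans (ℚₚ.≤-reflexive (2* δ)) 2δ≤ε)
               (∥∥-resp (solve 3 (λ a b c → a :- c :+ :- (b :- c) := a :- b) refl (Σ m h) (Σ n h) (Σ K h))
                 (∥∥-+ (∥∥-weaken small (tail K≤m)) (∥∥-neg (∥∥-weaken small (tail K≤n)))))

      total : Carrier
      total = proj₁ limit

      sums⇒total : (λ n → Σ n h) ⇒ total
      sums⇒total = proj₂ limit

      remainder : ∀ K → ∥ total - Σ K h ∥≤ (C′ ℚ.* pow ρ K)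
      remainder K = ⇒-bound {λ n → Σ (K ℕ.+ n) h - Σ K h}
        (⇒-+ (⇒-subsequence (K ℕ.+_) (λ n → ℕₚ.m≤n+m n K) sums⇒total) (⇒-const (- Σ K h)))
        (λ n → tail (ℕₚ.m≤m+n K n))

    -- Cut at a K with C′ ρ^K ≤ ε. Both tails are at most ε, that of `f N` uniformly in N, and the
    -- first K terms converge one by one. The limits g inherit the geometric bound, so their tail is
    -- controlled as well.
    Tannery : ∀ {f : ℕ → ℕ → Carrier} {g : ℕ → Carrier} {C L} → 0ℚ ℚ.≤ C →
      (∀ N n → ∥ f N n ∥≤ (C ℚ.* pow ρ n)) → (∀ n → (λ N → f N n) ⇒ g n) →
      (λ n → Σ n g) ⇒ L → (λ N → Σ (suc N) (f N)) ⇒ L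
    Tannery {f} {g} {C} {L} 0≤C b p S⇒L = ⇒-scaled {K = 1ℚ ℚ.+ 1ℚ ℚ.+ 1ℚ} (0≤+ 0≤2 0≤1) λ ε 0<ε →
      let K , small = scaled-pow-small G.0≤C′ 0<ε
          N , close = ⇒-Σ K p ε 0<ε
      in K ℕ.⊔ N , λ n n≥ →
        let K≤n = ℕₚ.m⊔n≤o⇒m≤o K N n≥
            N≤n = ℕₚ.m⊔n≤o⇒n≤o K N n≥
        in ∥∥-≡ (3* ε) (∥∥-resp
             (solve 4 (λ a b c d → a :- b :+ (b :- c) :+ (c :- d) := a :- d) refl (Σ (suc n) (f n)) (Σ K (f n)) (Σ K g) L)
             (∥∥-+ (∥∥-+ (∥∥-weaken small (Series.tail 0≤C (b n) (ℕₚ.m≤n⇒m≤1+n K≤n))) (close n N≤n))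
                   (∥∥-weaken small (∥∥-resp (neg-diff K) (∥∥-neg (G.remainder K))))))
      where
      module G = Series 0≤C (λ n → ⇒-bound (p n) (λ N → b N n))
      neg-diff : ∀ K → - (G.total - Σ K g) ≈ Σ K g - L
      neg-diff K = trans (solve 2 (λ a b → :- (a :- b) := b :- a) refl G.total (Σ K g))
        (+-congˡ (-‿cong (⇒-unique G.sums⇒total S⇒L)))
      3* : ∀ ε → ε ℚ.+ ε ℚ.+ ε ≡ (1ℚ ℚ.+ 1ℚ ℚ.+ 1ℚ) ℚ.* ε
      3* ε = ≡.sym (≡.trans (ℚₚ.*-distribʳ-+ ε (1ℚ ℚ.+ 1ℚ) 1ℚ) (≡.cong₂ ℚ._+_ (≡.sym (2* ε)) (ℚₚ.*-identityˡ ε)))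

    -- Stated for any f with the recursion of a product, so that it covers `u` as well as `Π`.
    product-bounded : ∀ {f a : ℕ → Carrier} {C} → 0ℚ ℚ.≤ C → f 0 ≈ 1# → (∀ n → f (suc n) ≈ f n * a n) →
      (∀ n → ∥ a n ∥≤ (1ℚ ℚ.+ C ℚ.* pow ρ n)) → ∃[ B ] 0ℚ ℚ.≤ B × (∀ n → ∥ f n ∥≤ B)
    product-bounded {f} {a} {C} 0≤C f₀ f₊ b =
      let B , 0≤B , P≤B = partialProduct-bounded 0≤C
      in B , 0≤B , λ n → ∥∥-weaken (P≤B n) (bound n)
      where
      bound : ∀ n → ∥ f n ∥≤ partialProduct C n
      bound zero    = ∥∥-resp (sym f₀) ∥∥-1
      bound (suc n) = ∥∥-resp (sym (f₊ n)) (∥∥-* (bound n) (b n))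

    converges : ∀ {f : ℕ → Carrier} {C} → 0ℚ ℚ.≤ C →
      (∀ n → ∥ f (suc n) - f n ∥≤ (C ℚ.* pow ρ n)) → ∃[ L ] f ⇒ L
    converges {f} 0≤C b = f 0 + S.total , ⇒-cong telescope refl (⇒-+ (⇒-const (f 0)) S.sums⇒total)
      where
      module S = Series 0≤C b
      telescope : ∀ n → f 0 + Σ n (λ k → f (suc k) - f k) ≈ f n
      telescope zero    = +-identityʳ (f 0)
      telescope (suc n) = trans (sym (+-assoc (f 0) _ _)) (trans (+-congʳ (telescope n))
        (solve 2 (λ a b → a :+ (b :- a) := b) refl (f n) (f (suc n))))

-- Infinite q-products and the triple product identity.

module QAnalysis (𝔹 : BanachRing) {ρ : ℚ} (0≤ρ : 0ℚ ℚ.≤ ρ) (ρ<1 : ρ ℚ.< 1ℚ) where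

  open BanachRing 𝔹
  open import Data.Integer.Base using (0ℤ)
  import Data.Nat.Properties as ℕₚ
  import Data.Rational.Properties as ℚₚ
  open import Relation.Binary.PropositionalEquality as ≡ using (_≡_)
  open import Relation.Binary.Reasoning.Setoid setoid
  open IntSolver commutativeRing
  open Sums commutativeRing
  open Coefficients commutativeRing
  open RationalBounds
  open Geometric 0≤ρ ρ<1
  open Limits 𝔹
  open Geometrically 0≤ρ ρ<1
  open Exp semiring using (_^_)

  pow≤ρ : ∀ n → pow ρ (suc n) ℚ.≤ ρ
  pow≤ρ n = ℚₚ.≤-trans (*-monoˡ 0≤ρ (pow≤1 n)) (ℚₚ.≤-reflexive (ℚₚ.*-identityʳ ρ))

  ∥^suc∥ : ∀ {x} n → ∥ x ∥≤ ρ → ∥ x ^ suc n ∥≤ ρ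
  ∥^suc∥ n bx = ∥∥-weaken (pow≤ρ n) (∥^∥ (suc n) bx)

  κ : ℚ
  κ = proj₁ (geometric-scale 0≤1)

  0≤κ : 0ℚ ℚ.≤ κ
  0≤κ = proj₁ (proj₂ (geometric-scale 0≤1))

  -- The geometric series in x. The bound κ = 1/(1-ρ) does not depend on x, hence is shared by the
  -- inverses of all 1 - p^(n+1).
  Neumann : ∀ {x} → ∥ x ∥≤ ρ → ∃[ y ] (1# - x) * y ≈ 1# × ∥ y ∥≤ κ
  Neumann {x} bx = S.total , inverse , bound
    where
    bₙ : ∀ n → ∥ x ^ n ∥≤ (1ℚ ℚ.* pow ρ n)
    bₙ n = ∥∥-≡ (≡.sym (ℚₚ.*-identityˡ _)) (∥^∥ n bx)
    module S = Series {h = x ^_} 0≤1 bₙ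
    partial : ∀ n → (1# - x) * Σ n (x ^_) ≈ 1# - x ^ n
    partial zero    = solve 1 (λ x → (:1 :- x) :* con 0ℤ := :1 :- :1) refl x
    partial (suc n) = trans (distribˡ _ _ _) (trans (+-congʳ (partial n))
      (solve 2 (λ x p → :1 :- p :+ (:1 :- x) :* p := :1 :- x :* p) refl x (x ^ n)))
    inverse : (1# - x) * S.total ≈ 1#
    inverse = ⇒-unique (⇒-* (⇒-const (1# - x)) S.sums⇒total)
      (⇒-cong (λ n → sym (partial n)) (solve 0 (:1 :+ :- con 0ℤ := :1) refl) (⇒-+ (⇒-const 1#) (⇒-neg (null 0≤1 bₙ))))
    bound : ∥ S.total ∥≤ κ
    bound = ∥∥-≡ (ℚₚ.*-identityʳ κ) (∥∥-resp (solve 1 (λ x → x :- con 0ℤ := x) refl S.total) (S.remainder 0))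

  sgn-bound : ∀ n → ∥ sgn n ∥≤ 1ℚ
  sgn-bound zero    = ∥∥-1
  sgn-bound (suc n) = ∥∥-neg (sgn-bound n)

  χ-bound : ∀ n → ∥ χ n ∥≤ 1ℚ
  χ-bound 0 = ∥∥-weaken 0≤1 ∥∥-0
  χ-bound 1 = ∥∥-1
  χ-bound 2 = ∥∥-neg ∥∥-1
  χ-bound (suc (suc (suc n))) = χ-bound n

  module Base (p : Carrier) (bp : ∥ p ∥≤ ρ) where

    inv : ℕ → Carrier
    inv n = proj₁ (Neumann (∥^suc∥ n bp))

    inv-spec : ∀ n → (1# - p ^ suc n) * inv n ≈ 1#
    inv-spec n = proj₁ (proj₂ (Neumann (∥^suc∥ n bp)))

    open QIdentities commutativeRing p inv inv-spec public

    p^inv : ∀ n → ∥ p ^ suc n * inv n ∥≤ (κ ℚ.* pow ρ n)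
    p^inv n = ∥∥-weaken
      (ℚₚ.≤-trans (*-monoʳ 0≤κ (pow-suc≤ n)) (ℚₚ.≤-reflexive (ℚₚ.*-comm (pow ρ n) κ)))
      (∥∥-* (∥^∥ (suc n) bp) (proj₂ (proj₂ (Neumann (∥^suc∥ n bp)))))

    -- Shows the factors of `u` as 1 plus a geometrically small term, the form that
    -- `product-bounded` and `converges` need.
    inv≈ : ∀ n → inv n ≈ 1# + p ^ suc n * inv n
    inv≈ n = trans (solve 2 (λ P y → y := (:1 :- P) :* y :+ P :* y) refl (p ^ suc n) (inv n)) (+-congʳ (inv-spec n))

    private
      u-bounded : ∃[ B ] 0ℚ ℚ.≤ B × (∀ n → ∥ u n ∥≤ B)
      u-bounded = product-bounded 0≤κ refl (λ _ → refl)
        (λ n → ∥∥-resp (sym (inv≈ n)) (∥∥-+ ∥∥-1 (p^inv n)))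

    Bᵤ : ℚ
    Bᵤ = proj₁ u-bounded

    0≤Bᵤ : 0ℚ ℚ.≤ Bᵤ
    0≤Bᵤ = proj₁ (proj₂ u-bounded)

    u-bound : ∀ n → ∥ u n ∥≤ Bᵤ
    u-bound = proj₂ (proj₂ u-bounded)

    û-bound : ∀ m s → ∥ û m s ∥≤ Bᵤ
    û-bound m       zero    = u-bound m
    û-bound zero    (suc s) = ∥∥-weaken 0≤Bᵤ ∥∥-0
    û-bound (suc m) (suc s) = û-bound m s

    private
      u-limit : ∃[ L ] u ⇒ L
      u-limit = converges {C = Bᵤ ℚ.* κ} (0≤* 0≤Bᵤ 0≤κ) λ n →
        ∥∥-≡ (≡.sym (ℚₚ.*-assoc Bᵤ κ (pow ρ n)))
          (∥∥-resp (trans (solve 2 (λ u x → u :* x := u :* (:1 :+ x) :- u) refl (u n) (p ^ suc n * inv n))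
                          (+-congʳ (*-congˡ (sym (inv≈ n)))))
            (∥∥-* (u-bound n) (p^inv n)))

    E∞ : Carrier
    E∞ = proj₁ u-limit

    u⇒E∞ : u ⇒ E∞
    u⇒E∞ = proj₂ u-limit

    û⇒E∞ : ∀ s → (λ n → û n s) ⇒ E∞
    û⇒E∞ s = ⇒-drop s (⇒-cong (λ n → reflexive (≡.sym (û-+ s n))) refl u⇒E∞)

    poch : Carrier → ℕ → Carrier
    poch x n = Π n (λ j → 1# - x * p ^ j)

    poch-limit : ∀ {x} → ∥ x ∥≤ 1ℚ → ∃[ L ] poch x ⇒ L
    poch-limit {x} bx = converges {C = B} 0≤B λ n →
      ∥∥-resp (solve 2 (λ P x → P :* :- x := P :* (:1 :- x) :- P) refl (poch x n) (x * p ^ n))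
        (∥∥-* (b n) (∥∥-neg (bxₙ n)))
      where
      bxₙ : ∀ n → ∥ x * p ^ n ∥≤ pow ρ n
      bxₙ n = ∥∥-≡ (ℚₚ.*-identityˡ _) (∥∥-* bx (∥^∥ n bp))
      bounded = product-bounded {f = poch x} 0≤1 refl (λ _ → refl)
        (λ n → ∥∥-+ ∥∥-1 (∥∥-neg (∥∥-≡ (≡.sym (ℚₚ.*-identityˡ _)) (bxₙ n))))
      B = proj₁ bounded
      0≤B = proj₁ (proj₂ bounded)
      b = proj₂ (proj₂ bounded)

    poch-p-limit : ∃[ L ] poch p ⇒ L
    poch-p-limit = poch-limit (∥∥-weaken ρ≤1 bp)

    D∞ : Carrier
    D∞ = proj₁ poch-p-limit

    poch⇒D∞ : poch p ⇒ D∞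
    poch⇒D∞ = proj₂ poch-p-limit

    -- The reciprocals `u` converge along with the products, so (p;p)_∞ gets its inverse as a limit.
    D∞E∞ : D∞ * E∞ ≈ 1#
    D∞E∞ = ⇒-unique (⇒-* poch⇒D∞ u⇒E∞) (⇒-cong (λ n → sym (Π-u n)) refl (⇒-const 1#))

    -- Both factors `û` and `u` are bounded by `Bᵤ` and tend to 1/(p;p)_∞, so Tannery's theorem
    -- applies. The index φ is N + s + 1 for the triple product and N + s for the Bailey lemma.
    weighted-limit : ∀ {w : ℕ → Carrier} {C L} (φ : ℕ → ℕ → ℕ) → (∀ s n → n ℕ.≤ φ n s) → 0ℚ ℚ.≤ C →
      (∀ s → ∥ w s ∥≤ (C ℚ.* pow ρ s)) → (λ n → Σ n w) ⇒ L →
      (λ N → Σ (suc N) (λ s → w s * (û N s * u (φ N s)))) ⇒ L * (E∞ * E∞)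
    weighted-limit {w} {C} φ n≤φ 0≤C bw S⇒L = Tannery
      {C = C ℚ.* (Bᵤ ℚ.* Bᵤ)} (0≤* 0≤C (0≤* 0≤Bᵤ 0≤Bᵤ))
      (λ N s → ∥∥-≡ (eq C (pow ρ s) (Bᵤ ℚ.* Bᵤ)) (∥∥-* (bw s) (∥∥-* (û-bound N s) (u-bound (φ N s)))))
      (λ s → ⇒-* (⇒-const (w s)) (⇒-* (û⇒E∞ s) (⇒-subsequence (λ n → φ n s) (n≤φ s) u⇒E∞)))
      (⇒-cong (λ n → Σ-*ʳ n (E∞ * E∞) w) refl (⇒-* S⇒L (⇒-const (E∞ * E∞))))
      where
      open import Data.Rational.Solver using () renaming (module +-*-Solver to ℚS)
      eq : ∀ c p b → c ℚ.* p ℚ.* b ≡ c ℚ.* b ℚ.* p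
      eq = ℚS.solve 3 (λ c p b → c ℚS.:* p ℚS.:* b ℚS.:= c ℚS.:* b ℚS.:* p) ≡.refl

    module Jacobi {x y : Carrier} (bx : ∥ x ∥≤ ρ) (by : ∥ y ∥≤ ρ) (xy : x * y ≈ p) where

      private
        2ℚ = 1ℚ ℚ.+ 1ℚ

        0≤2 : 0ℚ ℚ.≤ 2ℚ
        0≤2 = 0≤+ 0≤1 0≤1

        theta-bound : ∀ s → ∥ theta x y p s ∥≤ (2ℚ ℚ.* pow ρ s)
        theta-bound s = ∥∥-≡ (eq (pow ρ s))
          (∥∥-* (∥∥-weaken (pow≤1 (tri s)) (∥^∥ (tri s) bp)) (∥∥-* (sgn-bound s)
            (∥∥-+ (∥^∥ s bx) (∥∥-neg (∥∥-* (∥∥-weaken (pow≤1 (suc s)) (∥^∥ (suc s) by)) (∥^∥ s bp))))))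
          where
          open import Data.Rational.Solver using () renaming (module +-*-Solver to ℚS)
          eq : ∀ p → 1ℚ ℚ.* (1ℚ ℚ.* (p ℚ.+ 1ℚ ℚ.* p)) ≡ (1ℚ ℚ.+ 1ℚ) ℚ.* p
          eq = ℚS.solve 1 (λ p → ℚS.con 1ℚ ℚS.:* (ℚS.con 1ℚ ℚS.:* (p ℚS.:+ ℚS.con 1ℚ ℚS.:* p))
            ℚS.:= (ℚS.con 1ℚ ℚS.:+ ℚS.con 1ℚ) ℚS.:* p) ≡.refl

        module S = Series 0≤2 theta-bound

      X∞ : ∃[ L ] poch x ⇒ L
      X∞ = poch-limit (∥∥-weaken ρ≤1 bx)

      Y∞ : ∃[ L ] poch y ⇒ L
      Y∞ = poch-limit (∥∥-weaken ρ≤1 by)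

      -- The finite identity tends to X Y E = W E^2 with E = 1/D; multiply by D^2. The trailing 1
      -- matches the `foldr` of the statement.
      triple-product : (λ n → Σ n (theta x y p)) ⇒ proj₁ X∞ * (proj₁ Y∞ * (D∞ * 1#))
      triple-product = ⇒-cong (λ _ → refl) (begin
        W                             ≈⟨ solve 1 (λ W → W := W :* (:1 :* :1)) refl W ⟩
        W * (1# * 1#)                 ≈⟨ *-congˡ (*-cong (sym D∞E∞) (sym D∞E∞)) ⟩
        W * ((D∞ * E∞) * (D∞ * E∞))   ≈⟨ solve 3 (λ W D E → W :* ((D :* E) :* (D :* E)) := W :* (E :* E) :* (D :* D)) refl W D∞ E∞ ⟩
        W * (E∞ * E∞) * (D∞ * D∞)     ≈⟨ *-congʳ (sym limits) ⟩
        X * Y * E∞ * (D∞ * D∞)        ≈⟨ solve 4 (λ X Y D E → X :* Y :* E :* (D :* D) := X :* (Y :* (D :* (D :* E)))) refl X Y D∞ E∞ ⟩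
        X * (Y * (D∞ * (D∞ * E∞)))    ≈⟨ *-congˡ (*-congˡ (*-congˡ D∞E∞)) ⟩
        X * (Y * (D∞ * 1#))           ∎) S.sums⇒total
        where
        W = S.total
        X = proj₁ X∞
        Y = proj₁ Y∞
        limits : X * Y * E∞ ≈ W * (E∞ * E∞)
        limits = ⇒-unique
          (⇒-* (⇒-* (proj₂ X∞) (⇒-subsequence suc ℕₚ.n≤1+n (proj₂ Y∞)))
               (⇒-subsequence (λ m → suc (m ℕ.+ m)) (λ m → ℕₚ.m≤n⇒m≤1+n (ℕₚ.m≤m+n m m)) u⇒E∞))
          (⇒-cong (λ m → sym (TripleProduct.finite-triple-product x y xy m)) refl
            (weighted-limit (λ m s → suc (m ℕ.+ s)) (λ s m → ℕₚ.m≤n⇒m≤1+n (ℕₚ.m≤m+n m s)) 0≤2 theta-bound S.sums⇒total))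

-- The limit of the Bailey lemma and its evaluation.

module SeriesIdentity (𝔹 : BanachRing) {ρ : ℚ} (0≤ρ : 0ℚ ℚ.≤ ρ) (ρ<1 : ρ ℚ.< 1ℚ)
  (q : BanachRing.Carrier 𝔹) (bq : BanachRing.∥_∥≤_ 𝔹 q ρ) where

  open BanachRing 𝔹
  import Data.Nat.Properties as ℕₚ
  import Data.Rational.Properties as ℚₚ
  open import Relation.Nullary.Decidable using (toWitness)
  open import Relation.Binary.PropositionalEquality as ≡ using (_≡_)
  open import Relation.Binary.Reasoning.Setoid setoid
  open IntSolver commutativeRing
  open Sums commutativeRing
  open Coefficients commutativeRing
  open RationalBounds
  open Geometric 0≤ρ ρ<1
  open Limits 𝔹
  open Geometrically 0≤ρ ρ<1
  open QAnalysis 𝔹 0≤ρ ρ<1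
  open Exp semiring using (_^_; ^-homo-*)
  open Base q bq public
  open Dissection commutativeRing q inv inv-spec

  private
    2ℚ = 1ℚ ℚ.+ 1ℚ

    0≤2 : 0ℚ ℚ.≤ 2ℚ
    0≤2 = 0≤+ 0≤1 0≤1

    q^≤1 : ∀ n → ∥ q ^ n ∥≤ 1ℚ
    q^≤1 n = ∥∥-weaken (pow≤1 n) (∥^∥ n bq)

    q^≤pow : ∀ {m n} → m ℕ.≤ n → ∥ q ^ n ∥≤ pow ρ m
    q^≤pow {n = n} m≤n = ∥∥-weaken (pow-antitone m≤n) (∥^∥ n bq)

    n≤n*n : ∀ n → n ℕ.≤ n ℕ.* n
    n≤n*n zero    = ℕ.z≤n
    n≤n*n (suc n) = ℕₚ.m≤m*n (suc n) (suc n)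

    Q-bounded : ∃[ B ] 0ℚ ℚ.≤ B × (∀ n → ∥ CharacterPair.Q n ∥≤ B)
    Q-bounded = product-bounded 0≤2 refl (λ _ → refl) λ j → ∥∥-≡ (eq (pow ρ j)) (∥∥-+
      (∥∥-+ ∥∥-1 (∥∥-resp (solve 2 (λ a b → :- (a :* b) := :- a :* b) refl q (q ^ j)) (∥∥-neg (q^≤pow (ℕₚ.n≤1+n j)))))
      (∥∥-resp (solve 2 (λ a b → b :* (a :* (a :* b)) := a :* (a :* (b :* b))) refl q (q ^ j))
        (∥∥-* (∥^∥ j bq) (q^≤1 (suc (suc j))))))
      where
      open import Data.Rational.Solver using () renaming (module +-*-Solver to ℚS)
      eq : ∀ p → 1ℚ ℚ.+ p ℚ.+ p ℚ.* 1ℚ ≡ 1ℚ ℚ.+ (1ℚ ℚ.+ 1ℚ) ℚ.* p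
      eq = ℚS.solve 1 (λ p → ℚS.con 1ℚ ℚS.:+ p ℚS.:+ p ℚS.:* ℚS.con 1ℚ ℚS.:= ℚS.con 1ℚ ℚS.:+ (ℚS.con 1ℚ ℚS.:+ ℚS.con 1ℚ) ℚS.:* p) ≡.refl

    BQ = proj₁ Q-bounded
    0≤BQ = proj₁ (proj₂ Q-bounded)

    Bβ : ℚ
    Bβ = 1ℚ ℚ.+ 2ℚ ℚ.* BQ ℚ.* Bᵤ

    0≤2BQBᵤ : 0ℚ ℚ.≤ 2ℚ ℚ.* BQ ℚ.* Bᵤ
    0≤2BQBᵤ = 0≤* (0≤* 0≤2 0≤BQ) 0≤Bᵤ

    0≤Bβ : 0ℚ ℚ.≤ Bβ
    0≤Bβ = 0≤+ 0≤1 0≤2BQBᵤ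

    β-bound : ∀ n → ∥ β n ∥≤ Bβ
    β-bound zero    = ∥∥-weaken (a≤a+b 1ℚ 0≤2BQBᵤ) ∥∥-1
    β-bound (suc m) = ∥∥-weaken (a≤b+a _ 0≤1)
      (∥∥-* (∥∥-* (∥∥-+ ∥∥-1 (∥∥-neg (q^≤1 (suc m)))) (proj₂ (proj₂ Q-bounded) m)) (u-bound (suc (suc (m ℕ.+ m)))))

    α-bound : ∀ r → ∥ α r ∥≤ (1ℚ ℚ.* 1ℚ ℚ.* 2ℚ ℚ.+ 1ℚ ℚ.* 1ℚ ℚ.* 2ℚ)
    α-bound r = ∥∥-+ (unit r) (∥∥-* (∥∥-* (χ-bound r) (q^≤1 (tri r))) (∥∥-+ ∥∥-1 (∥∥-neg (q^≤1 r))))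
      where
      unit : ∀ r → ∥ UnitPair.α r ∥≤ (1ℚ ℚ.* 1ℚ ℚ.* 2ℚ)
      unit zero    = ∥∥-weaken (toWitness {a? = 1ℚ ℚₚ.≤? 1ℚ ℚ.* 1ℚ ℚ.* 2ℚ} _) ∥∥-1
      unit (suc r) = ∥∥-* (∥∥-* (sgn-bound (suc r)) (q^≤1 (tri (suc r)))) (∥∥-+ ∥∥-1 (q^≤1 (suc r)))

    -- As n ≤ n^2, the factor q^(n^2) supplies the geometric decay; α and β only have to be bounded.
    square-bound : ∀ {B} (f : ℕ → Carrier) → (∀ n → ∥ f n ∥≤ B) → ∀ n → ∥ q ^ (n ℕ.* n) * f n ∥≤ (B ℚ.* pow ρ n)
    square-bound {B} f bf n = ∥∥-≡ (ℚₚ.*-comm (pow ρ n) B) (∥∥-* (q^≤pow (n≤n*n n)) (bf n))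

    Bα : ℚ
    Bα = 1ℚ ℚ.* 1ℚ ℚ.* 2ℚ ℚ.+ 1ℚ ℚ.* 1ℚ ℚ.* 2ℚ

    0≤Bα : 0ℚ ℚ.≤ Bα
    0≤Bα = ∥∥-nonneg (α-bound 0)

    module LHS = Series 0≤Bβ (square-bound β β-bound)
    module RHS = Series 0≤Bα (square-bound α α-bound)

  T∞ Θ∞ : Carrier
  T∞ = LHS.total
  Θ∞ = RHS.total

  T⇒ : (λ n → Σ n (λ k → q ^ (k ℕ.* k) * β k)) ⇒ T∞
  T⇒ = LHS.sums⇒total

  -- As N grows, `Bailey-lemma` becomes T E = Θ E^2 with E = 1/D; multiply by D^2.
  Bailey-limit : T∞ * D∞ ≈ Θ∞
  Bailey-limit = begin
    T∞ * D∞                         ≈⟨ solve 1 (λ x → x := x :* :1) refl (T∞ * D∞) ⟩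
    T∞ * D∞ * 1#                    ≈⟨ *-congˡ (sym D∞E∞) ⟩
    T∞ * D∞ * (D∞ * E∞)             ≈⟨ solve 3 (λ T D E → T :* D :* (D :* E) := T :* E :* (D :* D)) refl T∞ D∞ E∞ ⟩
    T∞ * E∞ * (D∞ * D∞)             ≈⟨ *-congʳ limits ⟩
    Θ∞ * (E∞ * E∞) * (D∞ * D∞)      ≈⟨ solve 3 (λ T D E → T :* (E :* E) :* (D :* D) := T :* ((D :* E) :* (D :* E))) refl Θ∞ D∞ E∞ ⟩
    Θ∞ * ((D∞ * E∞) * (D∞ * E∞))    ≈⟨ *-congˡ (*-cong D∞E∞ D∞E∞) ⟩
    Θ∞ * (1# * 1#)                  ≈⟨ solve 1 (λ x → x :* (:1 :* :1) := x) refl Θ∞ ⟩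
    Θ∞                              ∎
    where
    open import Data.Rational.Solver using () renaming (module +-*-Solver to ℚS)
    eq : ∀ c p b → c ℚ.* p ℚ.* b ≡ c ℚ.* b ℚ.* p
    eq = ℚS.solve 3 (λ c p b → c ℚS.:* p ℚS.:* b ℚS.:= c ℚS.:* b ℚS.:* p) ≡.refl
    limits : T∞ * E∞ ≈ Θ∞ * (E∞ * E∞)
    limits = ⇒-unique
      (Tannery {C = Bβ ℚ.* Bᵤ} (0≤* 0≤Bβ 0≤Bᵤ)
        (λ N n → ∥∥-≡ (eq Bβ (pow ρ n) Bᵤ) (∥∥-* (square-bound β β-bound n) (û-bound N n)))
        (λ n → ⇒-* (⇒-const (q ^ (n ℕ.* n) * β n)) (û⇒E∞ n))
        (⇒-cong (λ n → Σ-*ʳ n E∞ _) refl (⇒-* T⇒ (⇒-const E∞))))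
      (⇒-cong (λ N → sym (Bailey-lemma N)) refl
        (weighted-limit ℕ._+_ (λ s n → ℕₚ.m≤m+n n s) 0≤Bα (square-bound α α-bound) RHS.sums⇒total))

  private
    τ⇒0 : τ ⇒ 0#
    τ⇒0 = null 0≤2 (λ r → ∥∥-* (∥∥-+ (sgn-bound r) (χ-bound r))
      (q^≤pow (ℕₚ.≤-trans (n≤n*n r) (ℕₚ.m≤m+n (r ℕ.* r) (tri r)))))

    neg* : ∀ a b → - (q ^ suc a) * - (q ^ suc b) ≈ q ^ (suc a ℕ.+ suc b)
    neg* a b = trans (solve 2 (λ x y → :- x :* :- y := x :* y) refl _ _) (sym (^-homo-* q (suc a) (suc b)))

  module BaseA = Base (q ^ 27) (∥^suc∥ 26 bq)
  module BaseB = Base (q ^ 108) (∥^suc∥ 107 bq)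
  module JacobiA = BaseA.Jacobi {q ^ 12} {q ^ 15} (∥^suc∥ 11 bq) (∥^suc∥ 14 bq) (sym (^-homo-* q 12 15))
  module JacobiB = BaseB.Jacobi {x = - (q ^ 75)} {y = - (q ^ 33)} (∥∥-neg (∥^suc∥ 74 bq)) (∥∥-neg (∥^suc∥ 32 bq)) (neg* 74 32)
  module JacobiC = BaseB.Jacobi {x = - (q ^ 93)} {y = - (q ^ 15)} (∥∥-neg (∥^suc∥ 92 bq)) (∥∥-neg (∥^suc∥ 14 bq)) (neg* 92 14)

  A∞ B∞ C∞ : Carrier
  A∞ = proj₁ JacobiA.X∞ * (proj₁ JacobiA.Y∞ * (BaseA.D∞ * 1#))
  B∞ = proj₁ JacobiB.X∞ * (proj₁ JacobiB.Y∞ * (BaseB.D∞ * 1#))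
  C∞ = proj₁ JacobiC.X∞ * (proj₁ JacobiC.Y∞ * (BaseB.D∞ * 1#))

  -- Two limits of one sequence, the partial sums with 6M+1 terms: there `dissection` is exact and
  -- only the vanishing `τ (M ℕ.* 6)` is left over.
  Θ∞≈ : Θ∞ ≈ A∞ - 2ᴿ * q ^ 2 * B∞ + 2ᴿ * q ^ 7 * C∞
  Θ∞≈ = ⇒-unique
    (⇒-cong (λ M → trans (Σ-summand (M ℕ.* 6)) (+-congʳ (dissection M))) refl
      (⇒-subsequence (λ M → suc (M ℕ.* 6)) (λ M → ℕₚ.m≤n⇒m≤1+n (ℕₚ.m≤m*n M 6)) RHS.sums⇒total))
    (⇒-cong (λ _ → refl) (+-identityʳ _)
      (⇒-+ (⇒-+ (⇒-+ (⇒-subsequence (ℕ._* 2) (λ M → ℕₚ.m≤m*n M 2) JacobiA.triple-product)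
                     (⇒-neg (⇒-* (⇒-const (2ᴿ * q ^ 2)) JacobiB.triple-product)))
                (⇒-* (⇒-const (2ᴿ * q ^ 7)) JacobiC.triple-product))
           (⇒-subsequence (ℕ._* 6) (λ M → ℕₚ.m≤m*n M 6) τ⇒0)))

  T∞D∞ : T∞ * D∞ ≈ A∞ - 2ᴿ * q ^ 2 * B∞ + 2ᴿ * q ^ 7 * C∞
  T∞D∞ = trans Bailey-limit Θ∞≈

-- The result in the form of the statement, over an abstract ring.

module Solutions (𝔹 : BanachRing) where

  open BanachRing 𝔹
  open import Algebra.Definitions.RawSemiring (Semiring.rawSemiring semiring) using (sum; product)
  open import Data.Fin.Base using (toℕ)
  import Data.Nat.Properties as ℕₚ
  import Relation.Binary.PropositionalEquality as ≡
  open import Relation.Binary.Reasoning.Setoid setoid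
  open IntSolver commutativeRing
  open Sums commutativeRing
  open Limits 𝔹
  open Exp semiring using (_^_)

  qProduct : Carrier → Carrier → ℕ → Carrier
  qProduct x p n = product {n} (λ i → 1# - x * p ^ toℕ i)

  partialSum : (ℕ → Carrier) → ℕ → Carrier
  partialSum t n = sum {n} (λ i → t (suc (toℕ i)))

  denominator : Carrier → ℕ → Carrier
  denominator q n = qProduct (- q) q n * qProduct q q (2 ℕ.* n ℕ.∸ 1)

  record Solution (q : Carrier) : Set where
    field
      t : ℕ → Carrier
      S A₁ A₂ A₃ B₁ B₂ B₃ C₁ C₂ D : Carrier
      quotient    : ∀ m → t (suc m) * denominator q (suc m) ≈ q ^ (suc m ℕ.^ 2) * qProduct (- (q ^ 3)) (q ^ 3) m
      invertible  : ∀ m → ∃[ y ] denominator q (suc m) * y ≈ 1#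
      sum⇒S       : partialSum t ⇒ S
      ⇒A₁         : qProduct (q ^ 12) (q ^ 27) ⇒ A₁
      ⇒A₂         : qProduct (q ^ 15) (q ^ 27) ⇒ A₂
      ⇒A₃         : qProduct (q ^ 27) (q ^ 27) ⇒ A₃
      ⇒B₁         : qProduct (- (q ^ 33)) (q ^ 108) ⇒ B₁
      ⇒B₂         : qProduct (- (q ^ 75)) (q ^ 108) ⇒ B₂
      ⇒B₃         : qProduct (q ^ 108) (q ^ 108) ⇒ B₃
      ⇒C₁         : qProduct (- (q ^ 15)) (q ^ 108) ⇒ C₁
      ⇒C₂         : qProduct (- (q ^ 93)) (q ^ 108) ⇒ C₂
      ⇒D          : qProduct q q ⇒ D
      D-invertible : ∃[ E ] D * E ≈ 1#
      identity    : (1# + S) * D ≈ A₁ * (A₂ * (A₃ * 1#))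
                      - (1# + 1#) * q ^ 2 * (B₁ * (B₂ * (B₃ * 1#)))
                      + (1# + 1#) * q ^ 7 * (C₁ * (C₂ * (B₃ * 1#)))

  solution : ∀ {ρ} → 0ℚ ℚ.≤ ρ → ρ ℚ.< 1ℚ → ∀ q → ∥ q ∥≤ ρ → Solution q
  solution 0≤ρ ρ<1 q bq = record
    -- T∞ contains the term n = 0, equal to 1, whereas S starts at n = 1.
    { t = term ; S = T∞ - 1#
    ; quotient = quotient′
    ; invertible = λ m → neg-factor-inverse (suc m) * u (suc (m ℕ.+ m)) , invertible′ m
    ; sum⇒S = ⇒-cong shift refl (⇒-+ (⇒-subsequence suc ℕₚ.n≤1+n T⇒) (⇒-const (- 1#)))
    ; ⇒A₁ = limit (proj₂ JacobiA.X∞) ; ⇒A₂ = limit (proj₂ JacobiA.Y∞) ; ⇒A₃ = limit BaseA.poch⇒D∞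
    ; ⇒B₁ = limit (proj₂ JacobiB.Y∞) ; ⇒B₂ = limit (proj₂ JacobiB.X∞) ; ⇒B₃ = limit BaseB.poch⇒D∞
    ; ⇒C₁ = limit (proj₂ JacobiC.Y∞) ; ⇒C₂ = limit (proj₂ JacobiC.X∞)
    ; ⇒D = limit poch⇒D∞
    ; D-invertible = E∞ , D∞E∞
    ; identity = trans (*-congʳ (solve 1 (λ T → :1 :+ (T :- :1) := T) refl T∞))
        (trans T∞D∞ (+-cong (+-congˡ (-‿cong (*-congˡ (swap _ _ _)))) (*-congˡ (swap _ _ _))))
    }
    where
    open SeriesIdentity 𝔹 0≤ρ ρ<1 q bq

    term : ℕ → Carrier
    term n = q ^ (n ℕ.* n) * β n

    -- In the theta series B and C the larger exponent belongs to x, but the stated products list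
    -- the smaller one first.
    swap : ∀ x y z → x * (y * z) ≈ y * (x * z)
    swap = solve 3 (λ x y z → x :* (y :* z) := y :* (x :* z)) refl

    limit : ∀ {x p L} → (λ n → Π n (λ j → 1# - x * p ^ j)) ⇒ L → qProduct x p ⇒ L
    limit {x} {p} = ⇒-cong (λ n → sym (product≈Π n (λ j → 1# - x * p ^ j))) refl

    shift : ∀ N → Σ (suc N) term - 1# ≈ partialSum term N
    shift N = trans (trans (+-congʳ (Σ-head N term)) (solve 1 (λ x → :1 :* :1 :+ x :- :1 := x) refl _))
      (sym (sum≈Σ N (λ j → term (suc j))))

    P₁ P₂ : ℕ → Carrier
    P₁ m = Π (suc m) (λ j → 1# - - q * q ^ j)
    P₂ m = Π (suc (m ℕ.+ m)) (λ j → 1# - q * q ^ j)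

    denominator≈ : ∀ m → denominator q (suc m) ≈ P₁ m * P₂ m
    denominator≈ m = *-cong (product≈Π (suc m) (λ j → 1# - - q * q ^ j)) (begin
      -- The form to which 2 (m+1) ∸ 1 computes.
      qProduct q q (m ℕ.+ suc (m ℕ.+ 0))
        ≡⟨ ≡.cong (qProduct q q) (≡.trans (ℕₚ.+-suc m (m ℕ.+ 0)) (≡.cong (λ k → suc (m ℕ.+ k)) (ℕₚ.+-identityʳ m))) ⟩
      qProduct q q (suc (m ℕ.+ m))  ≈⟨ product≈Π (suc (m ℕ.+ m)) (λ j → 1# - q * q ^ j) ⟩
      P₂ m ∎)

    quotient′ : ∀ m → term (suc m) * denominator q (suc m) ≈ q ^ (suc m ℕ.^ 2) * qProduct (- (q ^ 3)) (q ^ 3) m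
    quotient′ m = begin
      q ^ (n ℕ.* n) * β n * denominator q n   ≈⟨ *-assoc _ _ _ ⟩
      q ^ (n ℕ.* n) * (β n * denominator q n)
        ≈⟨ *-cong (pow-≡ (≡.cong (n ℕ.*_) (≡.sym (ℕₚ.*-identityʳ n))))
             (trans (*-congˡ (denominator≈ m)) (trans (β-quotient m) (sym (product≈Π m (λ j → 1# - - (q ^ 3) * (q ^ 3) ^ j))))) ⟩
      q ^ (n ℕ.^ 2) * qProduct (- (q ^ 3)) (q ^ 3) m ∎
      where n = suc m

    invertible′ : ∀ m → denominator q (suc m) * (neg-factor-inverse (suc m) * u (suc (m ℕ.+ m))) ≈ 1#
    invertible′ m = begin
      denominator q (suc m) * (neg-factor-inverse (suc m) * u (suc (m ℕ.+ m))) ≈⟨ *-congʳ (denominator≈ m) ⟩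
      P₁ m * P₂ m * (neg-factor-inverse (suc m) * u (suc (m ℕ.+ m)))
        ≈⟨ solve 4 (λ a b c d → a :* b :* (c :* d) := (a :* c) :* (b :* d)) refl (P₁ m) (P₂ m) _ _ ⟩
      (P₁ m * neg-factor-inverse (suc m)) * (P₂ m * u (suc (m ℕ.+ m)))
        ≈⟨ *-cong (Π-neg-inverse (suc m)) (Π-u (suc (m ℕ.+ m))) ⟩
      1# * 1#  ≈⟨ *-identityʳ 1# ⟩
      1# ∎

-- The modulus of Gaussian rationals, handled through squares.

module GaussianRationals where

  open import Data.Rational.Base
  open import Data.Rational.Properties
  open import Data.Rational.Solver using (module +-*-Solver)
  open import Data.Sum.Base using ([_,_]′)
  open import Relation.Binary.PropositionalEquality
  open +-*-Solver
  open RationalBounds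

  norm² : ℚ → ℚ → ℚ
  norm² a b = a * a + b * b

  0≤square : ∀ a → 0ℚ ≤ a * a
  0≤square a = [ (λ 0≤a → 0≤* 0≤a 0≤a)
               , (λ a≤0 → subst (0ℚ ≤_) (solve 1 (λ a → (:- a) :* (:- a) := a :* a) refl a)
                    (0≤* (neg-antimono-≤ a≤0) (neg-antimono-≤ a≤0))) ]′ (≤-total 0ℚ a)

  0≤norm² : ∀ a b → 0ℚ ≤ norm² a b
  0≤norm² a b = 0≤+ (0≤square a) (0≤square b)

  square-mono : ∀ {a b} → 0ℚ ≤ a → a ≤ b → a * a ≤ b * b
  square-mono 0≤a a≤b = *-mono 0≤a a≤b 0≤a a≤b

  -- Takes the place of the square root in the modulus estimates.
  square-cancel : ∀ {a b} → 0ℚ ≤ b → a * a ≤ b * b → a ≤ b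
  square-cancel {a} {b} 0≤b aa≤bb = [ (λ a≤b → a≤b) , impossible ]′ (≤-total a b)
    where
    impossible : b ≤ a → a ≤ b
    impossible b≤a = ≮⇒≥ λ b<a → <-irrefl refl (<-≤-trans
      (≤-<-trans (*-monoˡ 0≤b b≤a) (*-monoˡ-<-pos a {{positive (≤-<-trans 0≤b b<a)}} b<a)) aa≤bb)

  ∣∣-square : ∀ a → ∣ a ∣ * ∣ a ∣ ≡ a * a
  ∣∣-square a = trans (sym (∣p*q∣≡∣p∣*∣q∣ a a)) (0≤p⇒∣p∣≡p (0≤square a))

  ∣∣≤ : ∀ {a r} → 0ℚ ≤ r → a * a ≤ r * r → ∣ a ∣ ≤ r
  ∣∣≤ {a} 0≤r aa≤rr = square-cancel 0≤r (≤-trans (≤-reflexive (∣∣-square a)) aa≤rr)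

  ∣re∣≤ : ∀ {a b r} → 0ℚ ≤ r → norm² a b ≤ r * r → ∣ a ∣ ≤ r
  ∣re∣≤ {a} {b} 0≤r p = ∣∣≤ 0≤r (≤-trans (a≤a+b _ (0≤square b)) p)

  ∣im∣≤ : ∀ {a b r} → 0ℚ ≤ r → norm² a b ≤ r * r → ∣ b ∣ ≤ r
  ∣im∣≤ {a} {b} 0≤r p = ∣∣≤ 0≤r (≤-trans (a≤b+a _ (0≤square a)) p)

  norm²≤ : ∀ {a b r s} → ∣ a ∣ ≤ r → ∣ b ∣ ≤ s → norm² a b ≤ (r + s) * (r + s)
  norm²≤ {a} {b} {r} {s} p p′ = ≤-trans
    (+-mono-≤ (subst (_≤ r * r) (∣∣-square a) (square-mono (0≤∣p∣ a) p)) (subst (_≤ s * s) (∣∣-square b) (square-mono (0≤∣p∣ b) p′)))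
    (subst (r * r + s * s ≤_) (solve 2 (λ r s → r :* r :+ s :* s :+ (r :* s :+ r :* s) := (r :+ s) :* (r :+ s)) refl r s)
      (a≤a+b _ (0≤+ 0≤rs 0≤rs)))
    where
    0≤rs : 0ℚ ≤ r * s
    0≤rs = 0≤* (≤-trans (0≤∣p∣ a) p) (≤-trans (0≤∣p∣ b) p′)

  -- By Lagrange's identity, adding (ad - bc)^2 to (ac + bd)^2 gives the product of the norms.
  Cauchy–Schwarz : ∀ {a b c d r s} → 0ℚ ≤ r → 0ℚ ≤ s → norm² a b ≤ r * r → norm² c d ≤ s * s → a * c + b * d ≤ r * s
  Cauchy–Schwarz {a} {b} {c} {d} {r} {s} 0≤r 0≤s p p′ = square-cancel (0≤* 0≤r 0≤s) (begin
    (a * c + b * d) * (a * c + b * d)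
      ≤⟨ a≤a+b _ (0≤square (a * d - b * c)) ⟩
    (a * c + b * d) * (a * c + b * d) + (a * d - b * c) * (a * d - b * c)
      ≡⟨ solve 4 (λ a b c d → (a :* c :+ b :* d) :* (a :* c :+ b :* d) :+ (a :* d :- b :* c) :* (a :* d :- b :* c)
           := (a :* a :+ b :* b) :* (c :* c :+ d :* d)) refl a b c d ⟩
    norm² a b * norm² c d ≤⟨ *-mono (0≤norm² a b) p (0≤norm² c d) p′ ⟩
    r * r * (s * s)       ≡⟨ solve 2 (λ r s → r :* r :* (s :* s) := (r :* s) :* (r :* s)) refl r s ⟩
    (r * s) * (r * s)     ∎)
    where open ≤-Reasoning

  norm²-+ : ∀ {a b c d r s} → 0ℚ ≤ r → 0ℚ ≤ s → norm² a b ≤ r * r → norm² c d ≤ s * s →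
    norm² (a + c) (b + d) ≤ (r + s) * (r + s)
  norm²-+ {a} {b} {c} {d} {r} {s} 0≤r 0≤s p p′ = begin
    norm² (a + c) (b + d)
      ≡⟨ solve 4 (λ a b c d → (a :+ c) :* (a :+ c) :+ (b :+ d) :* (b :+ d)
           := (a :* a :+ b :* b) :+ (c :* c :+ d :* d) :+ ((a :* c :+ b :* d) :+ (a :* c :+ b :* d))) refl a b c d ⟩
    norm² a b + norm² c d + ((a * c + b * d) + (a * c + b * d))
      ≤⟨ +-mono-≤ (+-mono-≤ p p′) (+-mono-≤ cs cs) ⟩
    r * r + s * s + (r * s + r * s)
      ≡⟨ solve 2 (λ r s → r :* r :+ s :* s :+ (r :* s :+ r :* s) := (r :+ s) :* (r :+ s)) refl r s ⟩
    (r + s) * (r + s) ∎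
    where
    open ≤-Reasoning
    cs : a * c + b * d ≤ r * s
    cs = Cauchy–Schwarz {a} {b} {c} {d} 0≤r 0≤s p p′

  -- The two-squares identity of Brahmagupta and Fibonacci, that is, multiplicativity of the
  -- modulus.
  norm²-* : ∀ a b c d → norm² (a * c - b * d) (a * d + b * c) ≡ norm² a b * norm² c d
  norm²-* = solve 4 (λ a b c d → (a :* c :- b :* d) :* (a :* c :- b :* d) :+ (a :* d :+ b :* c) :* (a :* d :+ b :* c)
    := (a :* a :+ b :* b) :* (c :* c :+ d :* d)) refl

  min-with-1 : ∀ {ε} → 0ℚ < ε → ∃[ δ ] 0ℚ < δ × δ ≤ ε × δ ≤ 1ℚ
  min-with-1 {ε} 0<ε = [ (λ ε≤1 → ε , 0<ε , ≤-refl , ε≤1) , (λ 1≤ε → 1ℚ , 0<1 , 1≤ε , ≤-refl) ]′ (≤-total ε 1ℚ)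

  halve : ∀ {ε} → 0ℚ < ε → ∃[ δ ] 0ℚ < δ × δ + δ ≤ ε
  halve {ε} 0<ε = proj₁ d , proj₁ (proj₂ d) , ≤-trans (≤-reflexive (eq (proj₁ d))) (proj₂ (proj₂ d))
    where
    d = shrink {1ℚ + 1ℚ} (0≤+ 0≤1 0≤1) 0<ε
    eq : ∀ δ → δ + δ ≡ (1ℚ + 1ℚ) * δ
    eq = solve 1 (λ δ → δ :+ δ := (con 1ℚ :+ con 1ℚ) :* δ) refl

-- Bounds on the modulus of complex numbers given by sequences.

module NormBounds where

  open import Data.Rational.Base
  open import Data.Rational.Properties
  open import Data.Rational.Solver using (module +-*-Solver)
  open import Relation.Binary.PropositionalEquality
  import Data.Nat.Properties as ℕₚ
  open +-*-Solver
  open RationalBounds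
  open GaussianRationals

  -- The modulus of the complex number a + i b is at most r.
  record Bounded (a b : ℕ → ℚ) (r : ℚ) : Set where
    constructor mkBounded
    field
      nonneg     : 0ℚ ≤ r
      eventually : ∀ ε → 0ℚ < ε → ∃[ N ] (∀ n → N ℕ.≤ n → norm² (a n) (b n) ≤ (r + ε) * (r + ε))

  open Bounded public

  Bounded-resp : ∀ {a b c d r} → (∀ n → a n ≡ c n) → (∀ n → b n ≡ d n) → Bounded a b r → Bounded c d r
  Bounded-resp {r = r} a≡c b≡d p = mkBounded (nonneg p) λ ε 0<ε →
    let N , le = eventually p ε 0<ε
    in N , λ n N≤n → subst₂ (λ x y → norm² x y ≤ (r + ε) * (r + ε)) (a≡c n) (b≡d n) (le n N≤n)

  Bounded-exact : ∀ {a b r} → 0ℚ ≤ r → ∃[ N ] (∀ n → N ℕ.≤ n → norm² (a n) (b n) ≤ r * r) → Bounded a b r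
  Bounded-exact {r = r} 0≤r (N , le) = mkBounded 0≤r λ ε 0<ε →
    N , λ n N≤n → ≤-trans (le n N≤n) (square-mono 0≤r (a≤a+b r (<⇒≤ 0<ε)))

  Bounded-weaken : ∀ {a b r s} → r ≤ s → Bounded a b r → Bounded a b s
  Bounded-weaken r≤s p = mkBounded (≤-trans (nonneg p) r≤s) λ ε 0<ε →
    let N , le = eventually p ε 0<ε
    in N , λ n N≤n → ≤-trans (le n N≤n) (square-mono (0≤+ (nonneg p) (<⇒≤ 0<ε)) (+-monoˡ-≤ ε r≤s))

  Bounded-+ : ∀ {a b c d r s} → Bounded a b r → Bounded c d s →
    Bounded (λ n → a n + c n) (λ n → b n + d n) (r + s)
  Bounded-+ {a} {b} {c} {d} {r} {s} p p′ = mkBounded (0≤+ (nonneg p) (nonneg p′)) λ ε 0<ε →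
    let δ , 0<δ , 2δ≤ε = halve 0<ε
        N , le = eventually p δ 0<δ
        N′ , le′ = eventually p′ δ 0<δ
        0≤r+δ = 0≤+ (nonneg p) (<⇒≤ 0<δ)
        0≤s+δ = 0≤+ (nonneg p′) (<⇒≤ 0<δ)
    in N ℕ.⊔ N′ , λ n N≤n → ≤-trans
      (norm²-+ {a n} {b n} {c n} {d n} 0≤r+δ 0≤s+δ (le n (ℕₚ.m⊔n≤o⇒m≤o N N′ N≤n)) (le′ n (ℕₚ.m⊔n≤o⇒n≤o N N′ N≤n)))
      (square-mono (0≤+ 0≤r+δ 0≤s+δ) (≤-trans (≤-reflexive (eq r s δ)) (+-monoʳ-≤ (r + s) 2δ≤ε)))
    where
    eq : ∀ r s δ → (r + δ) + (s + δ) ≡ (r + s) + (δ + δ)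
    eq = solve 3 (λ r s δ → (r :+ δ) :+ (s :+ δ) := (r :+ s) :+ (δ :+ δ)) refl

  -- With slack δ ≤ 1 on both factors, (r+δ)(s+δ) exceeds rs by at most (r+s+1) δ, whence the
  -- constant K.
  Bounded-* : ∀ {a b c d r s} → Bounded a b r → Bounded c d s →
    Bounded (λ n → a n * c n - b n * d n) (λ n → a n * d n + b n * c n) (r * s)
  Bounded-* {a} {b} {c} {d} {r} {s} p p′ = mkBounded (0≤* 0≤r 0≤s) λ ε 0<ε →
    let η , 0<η , Kη≤ε = shrink 0≤K 0<ε
        δ , 0<δ , δ≤η , δ≤1 = min-with-1 0<η
        0≤δ = <⇒≤ 0<δ
        N , le = eventually p δ 0<δ
        N′ , le′ = eventually p′ δ 0<δ
        0≤r+δ = 0≤+ 0≤r 0≤δ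
        0≤s+δ = 0≤+ 0≤s 0≤δ
        [r+δ][s+δ]≤ = ≤-trans (≤-reflexive (expand r s δ)) (+-monoʳ-≤ (r * s)
          (≤-trans (*-monoʳ 0≤δ (+-monoʳ-≤ (r + s) δ≤1)) (≤-trans (*-monoˡ 0≤K δ≤η) Kη≤ε)))
    in N ℕ.⊔ N′ , λ n N≤n → begin
      norm² (a n * c n - b n * d n) (a n * d n + b n * c n) ≡⟨ norm²-* (a n) (b n) (c n) (d n) ⟩
      norm² (a n) (b n) * norm² (c n) (d n)
        ≤⟨ *-mono (0≤norm² (a n) (b n)) (le n (ℕₚ.m⊔n≤o⇒m≤o N N′ N≤n)) (0≤norm² (c n) (d n)) (le′ n (ℕₚ.m⊔n≤o⇒n≤o N N′ N≤n)) ⟩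
      (r + δ) * (r + δ) * ((s + δ) * (s + δ))  ≡⟨ regroup (r + δ) (s + δ) ⟩
      (r + δ) * (s + δ) * ((r + δ) * (s + δ))  ≤⟨ square-mono (0≤* 0≤r+δ 0≤s+δ) [r+δ][s+δ]≤ ⟩
      (r * s + ε) * (r * s + ε) ∎
    where
    open ≤-Reasoning
    0≤r = nonneg p
    0≤s = nonneg p′
    K = r + s + 1ℚ
    0≤K : 0ℚ ≤ K
    0≤K = 0≤+ (0≤+ 0≤r 0≤s) 0≤1
    expand : ∀ r s δ → (r + δ) * (s + δ) ≡ r * s + (r + s + δ) * δ
    expand = solve 3 (λ r s δ → (r :+ δ) :* (s :+ δ) := r :* s :+ (r :+ s :+ δ) :* δ) refl
    regroup : ∀ x y → x * x * (y * y) ≡ x * y * (x * y)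
    regroup = solve 2 (λ x y → x :* x :* (y :* y) := x :* y :* (x :* y)) refl

  Bounded-neg : ∀ {a b r} → Bounded a b r → Bounded (λ n → - a n) (λ n → - b n) r
  Bounded-neg {a} {b} {r} p = mkBounded (nonneg p) λ ε 0<ε →
    let N , le = eventually p ε 0<ε
    in N , λ n N≤n → subst (_≤ (r + ε) * (r + ε)) (eq (a n) (b n)) (le n N≤n)
    where
    eq : ∀ a b → norm² a b ≡ norm² (- a) (- b)
    eq = solve 2 (λ a b → a :* a :+ b :* b := (:- a) :* (:- a) :+ (:- b) :* (:- b)) refl

  Bounded-closed : ∀ {a b r} → 0ℚ ≤ r → (∀ ε → 0ℚ < ε → Bounded a b (r + ε)) → Bounded a b r
  Bounded-closed {r = r} 0≤r p = mkBounded 0≤r λ ε 0<ε →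
    let δ , 0<δ , 2δ≤ε = halve 0<ε
        N , le = eventually (p δ 0<δ) δ 0<δ
    in N , λ n N≤n → ≤-trans (le n N≤n)
      (square-mono (0≤+ (0≤+ 0≤r (<⇒≤ 0<δ)) (<⇒≤ 0<δ))
        (≤-trans (≤-reflexive (+-assoc r δ δ)) (+-monoʳ-≤ r 2δ≤ε)))

  Bounded⇒∣re∣ : ∀ {a b r} ε → 0ℚ < ε → Bounded a b r → ∃[ N ] (∀ n → N ℕ.≤ n → ∣ a n ∣ ≤ r + ε)
  Bounded⇒∣re∣ {a} {b} ε 0<ε p = let N , le = eventually p ε 0<ε
    in N , λ n N≤n → ∣re∣≤ {a n} {b n} (0≤+ (nonneg p) (<⇒≤ 0<ε)) (le n N≤n)

  Bounded⇒∣im∣ : ∀ {a b r} ε → 0ℚ < ε → Bounded a b r → ∃[ N ] (∀ n → N ℕ.≤ n → ∣ b n ∣ ≤ r + ε)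
  Bounded⇒∣im∣ {a} {b} ε 0<ε p = let N , le = eventually p ε 0<ε
    in N , λ n N≤n → ∣im∣≤ {a n} {b n} (0≤+ (nonneg p) (<⇒≤ 0<ε)) (le n N≤n)

  ∣∣⇒Bounded : ∀ {a b r s} →
    ∃[ N ] (∀ n → N ℕ.≤ n → ∣ a n ∣ ≤ r) → ∃[ N ] (∀ n → N ℕ.≤ n → ∣ b n ∣ ≤ s) → Bounded a b (r + s)
  ∣∣⇒Bounded {a} {b} (N , p) (N′ , p′) = Bounded-exact
    (0≤+ (≤-trans (0≤∣p∣ (a N)) (p N ℕₚ.≤-refl)) (≤-trans (0≤∣p∣ (b N′)) (p′ N′ ℕₚ.≤-refl)))
    (N ℕ.⊔ N′ , λ n N≤n → norm²≤ {a n} {b n} (p n (ℕₚ.m⊔n≤o⇒m≤o N N′ N≤n)) (p′ n (ℕₚ.m⊔n≤o⇒n≤o N N′ N≤n)))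

open import Defs

-- Completeness of the reals.

module RealCompleteness where

  open import Data.Rational.Base using (_≤_; _<_; ∣_∣)
  open import Data.Rational.Properties
  open import Data.Rational.Solver using (module +-*-Solver)
  open import Relation.Binary.PropositionalEquality
  import Data.Nat.Properties as ℕₚ
  open RationalBounds

  private
    0≤½ : 0ℚ ≤ ½
    0≤½ = <⇒≤ (positive⁻¹ ½)

    ½<1 : ½ < 1ℚ
    ½<1 = subst (½ <_) (trans (sym (*-distribʳ-+ 1ℚ ½ ½)) refl) (subst (_< ½ ℚ.+ ½) (+-identityʳ ½) (+-monoʳ-< ½ (positive⁻¹ ½)))

    0<pow : ∀ n → 0ℚ < pow ½ n
    0<pow zero    = 0<1
    0<pow (suc n) = 0<* (positive⁻¹ ½) (0<pow n)

    open Geometric 0≤½ ½<1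

    swap-diff : ∀ a b {ε} → ∣ a ℚ.- b ∣ ≤ ε → ∣ b ℚ.- a ∣ ≤ ε
    swap-diff a b = subst (_≤ _) (trans (sym (∣-p∣≡∣p∣ (a ℚ.- b))) (cong ∣_∣ (eq a b)))
      where
      open +-*-Solver
      eq : ∀ a b → ℚ.- (a ℚ.- b) ≡ b ℚ.- a
      eq = solve 2 (λ a b → :- (a :- b) := b :- a) refl

    triangle₃ : ∀ a b c d {ε} → ∣ a ℚ.- b ∣ ≤ ε → ∣ b ℚ.- c ∣ ≤ ε → ∣ c ℚ.- d ∣ ≤ ε → ∣ a ℚ.- d ∣ ≤ (1ℚ ℚ.+ 1ℚ ℚ.+ 1ℚ) ℚ.* ε
    triangle₃ a b c d {ε} p r t = ≤-trans (≤-reflexive (cong ∣_∣ (eq a b c d)))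
      (≤-trans (∣p+q∣≤∣p∣+∣q∣ (a ℚ.- b ℚ.+ (b ℚ.- c)) (c ℚ.- d)) (≤-trans (+-mono-≤ (≤-trans (∣p+q∣≤∣p∣+∣q∣ (a ℚ.- b) (b ℚ.- c)) (+-mono-≤ p r)) t)
        (≤-reflexive (eq′ ε))))
      where
      open +-*-Solver
      eq : ∀ a b c d → a ℚ.- d ≡ a ℚ.- b ℚ.+ (b ℚ.- c) ℚ.+ (c ℚ.- d)
      eq = solve 4 (λ a b c d → a :- d := a :- b :+ (b :- c) :+ (c :- d)) refl
      eq′ : ∀ ε → ε ℚ.+ ε ℚ.+ ε ≡ (1ℚ ℚ.+ 1ℚ ℚ.+ 1ℚ) ℚ.* ε
      eq′ = solve 1 (λ ε → ε :+ ε :+ ε := (con 1ℚ :+ con 1ℚ :+ con 1ℚ) :* ε) refl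

    0≤3 : 0ℚ ≤ 1ℚ ℚ.+ 1ℚ ℚ.+ 1ℚ
    0≤3 = 0≤+ (0≤+ 0≤1 0≤1) 0≤1

  CauchySequence : (ℕ → ℝ) → Set
  CauchySequence f = ∀ ε → 0ℚ < ε → ∃[ N ] (∀ m n → N ℕ.≤ m → N ℕ.≤ n →
    ∃[ K ] (∀ k → K ℕ.≤ k → ∣ seq (f m) k ℚ.- seq (f n) k ∣ ≤ ε))

  module Limit (f : ℕ → ℝ) (cf : CauchySequence f) where

    private
      index : ℕ → ℕ
      index j = proj₁ (cauchy (f j) (pow ½ j) (0<pow j))

    -- The j-th rational approximates f j with error less than 2⁻ʲ.
    diagonal : ℕ → ℚ
    diagonal j = seq (f j) (index j)

    private
      approximates : ∀ j n → index j ℕ.≤ n → ∣ diagonal j ℚ.- seq (f j) n ∣ ≤ pow ½ j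
      approximates j n i≤n = <⇒≤ (proj₂ (cauchy (f j) (pow ½ j) (0<pow j)) (index j) n ℕₚ.≤-refl i≤n)

      -- `Cauchy` asks for a strict inequality while the estimates give ≤, so they aim at a smaller
      -- bound.
      half-less : ∀ {ε} → 0ℚ < ε → ∃[ δ ] 0ℚ < δ × δ < ε
      half-less {ε} 0<ε = ½ ℚ.* ε , 0<* (positive⁻¹ ½) 0<ε
        , subst (½ ℚ.* ε <_) (*-identityˡ ε) (*-monoˡ-<-pos ε {{ℚ.positive 0<ε}} ½<1)

      ⊔₁ : ∀ a b {n} → a ℕ.⊔ b ℕ.≤ n → a ℕ.≤ n
      ⊔₁ a b = ℕₚ.m⊔n≤o⇒m≤o a b

      ⊔₂ : ∀ a b {n} → a ℕ.⊔ b ℕ.≤ n → b ℕ.≤ n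
      ⊔₂ a b = ℕₚ.m⊔n≤o⇒n≤o a b

    -- Two diagonal entries are compared through `f m` and `f n` at a common index k, late enough
    -- for both approximations and for the closeness of `f m` and `f n`.
    diagonal-cauchy : Cauchy diagonal
    diagonal-cauchy ε 0<ε =
      let ε′ , 0<ε′ , ε′<ε = half-less 0<ε
          δ , 0<δ , 3δ≤ε′ = shrink 0≤3 0<ε′
          N , close = cf δ 0<δ
          J , small = pow-small 0<δ
      in N ℕ.⊔ J , λ m n N≤m N≤n →
        let K , near = close m n (⊔₁ N J N≤m) (⊔₁ N J N≤n)
            k = index m ℕ.⊔ (index n ℕ.⊔ K)
            tiny : ∀ {j} → N ℕ.⊔ J ℕ.≤ j → pow ½ j ≤ δ
            tiny = λ le → ≤-trans (pow-antitone (⊔₂ N J le)) small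
        in ≤-<-trans (≤-trans (triangle₃ (diagonal m) (seq (f m) k) (seq (f n) k) (diagonal n)
             (≤-trans (approximates m k (ℕₚ.m≤m⊔n (index m) _)) (tiny N≤m))
             (near k (ℕₚ.≤-trans (ℕₚ.m≤n⊔m (index n) K) (ℕₚ.m≤n⊔m (index m) _)))
             (swap-diff (diagonal n) _ (≤-trans (approximates n k (ℕₚ.≤-trans (ℕₚ.m≤m⊔n (index n) K) (ℕₚ.m≤n⊔m (index m) _))) (tiny N≤n))))
             3δ≤ε′) ε′<ε

    limit : ℝ
    limit = record { seq = diagonal ; cauchy = diagonal-cauchy }

    -- From `f n` at k to `f n` at a later index l, across to `f k` at l, and back to the diagonal
    -- entry k. The index l depends on k, but the bound on k does not depend on l.
    converges : ∀ ε → 0ℚ < ε → ∃[ N ] (∀ n → N ℕ.≤ n →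
      ∃[ K ] (∀ k → K ℕ.≤ k → ∣ seq (f n) k ℚ.- diagonal k ∣ ≤ ε))
    converges ε 0<ε =
      let δ , 0<δ , 3δ≤ε = shrink 0≤3 0<ε
          N , close = cf δ 0<δ
          J , small = pow-small 0<δ
      in N , λ n N≤n →
        let M , settled = cauchy (f n) δ 0<δ
        in M ℕ.⊔ (N ℕ.⊔ J) , λ k k≥ →
          let M≤k = ⊔₁ M (N ℕ.⊔ J) k≥
              NJ≤k = ⊔₂ M (N ℕ.⊔ J) k≥
              K , near = close n k N≤n (⊔₁ N J NJ≤k)
              l = M ℕ.⊔ (index k ℕ.⊔ K)
          in ≤-trans (triangle₃ (seq (f n) k) (seq (f n) l) (seq (f k) l) (diagonal k)
               (<⇒≤ (settled k l M≤k (ℕₚ.m≤m⊔n M _)))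
               (near l (ℕₚ.≤-trans (ℕₚ.m≤n⊔m (index k) K) (ℕₚ.m≤n⊔m M _)))
               (swap-diff (diagonal k) _ (≤-trans (approximates k l (ℕₚ.≤-trans (ℕₚ.m≤m⊔n (index k) K) (ℕₚ.m≤n⊔m M _)))
                 (≤-trans (pow-antitone (⊔₂ N J NJ≤k)) small))))
               3δ≤ε

-- The complex numbers as a complete normed ring.

module ComplexBanach where

  open import Level using (0ℓ)
  open import Data.Rational.Properties
  open import Data.Rational.Solver using (module +-*-Solver)
  open import Relation.Binary.PropositionalEquality
  open import Relation.Binary.Bundles using (Setoid)
  open import Relation.Binary.Structures using (IsEquivalence)
  import Data.Nat.Properties as ℕₚ
  open RationalBounds
  open GaussianRationals
  open NormBounds

  infix 4 ∥_∥≤_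

  ∥_∥≤_ : ℂ → ℚ → Set
  ∥ z ∥≤ r = Bounded (seq (re z)) (seq (im z)) r

  -- The ring operations act index by index, so the ring laws hold exactly at each index and need no
  -- ε.
  ptwise : ∀ z w → (∀ n → seq (re z) n ≡ seq (re w) n) → (∀ n → seq (im z) n ≡ seq (im w) n) → z ≈ w
  ptwise z w p r = near (re z) (re w) p , near (im z) (im w) r
    where
    near : ∀ (x y : ℝ) → (∀ n → seq x n ≡ seq y n) → x ≈ℝ y
    near x y eq ε 0<ε = 0 , λ n _ → subst (ℚ._< ε)
      (sym (cong ℚ.∣_∣ (trans (cong (ℚ._- seq y n) (eq n)) (+-inverseʳ (seq y n))))) 0<ε

  -- Together with `0⇒≈` this turns equality into a norm bound, so symmetry, transitivity and the
  -- congruences follow from the norm rules.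
  ≈⇒0 : ∀ z w → z ≈ w → ∥ z - w ∥≤ 0ℚ
  ≈⇒0 z w (p , r) = Bounded-closed ≤-refl λ ε 0<ε →
    let δ , 0<δ , 2δ≤ε = halve 0<ε
        N , le = p δ 0<δ
        N′ , le′ = r δ 0<δ
    in Bounded-weaken (≤-trans 2δ≤ε (≤-reflexive (sym (+-identityˡ ε))))
         (∣∣⇒Bounded (N , λ n N≤n → <⇒≤ (le n N≤n)) (N′ , λ n N≤n → <⇒≤ (le′ n N≤n)))

  0⇒≈ : ∀ z w → ∥ z - w ∥≤ 0ℚ → z ≈ w
  0⇒≈ z w p = (λ ε 0<ε →
      let δ , 0<δ , 2δ≤ε = halve 0<ε
          N , le = Bounded⇒∣re∣ δ 0<δ p
      in N , λ n N≤n → ≤-<-trans (le n N≤n) (0+δ<ε 0<δ 2δ≤ε))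
    , (λ ε 0<ε →
      let δ , 0<δ , 2δ≤ε = halve 0<ε
          N , le = Bounded⇒∣im∣ δ 0<δ p
      in N , λ n N≤n → ≤-<-trans (le n N≤n) (0+δ<ε 0<δ 2δ≤ε))
    where
    0+δ<ε : ∀ {δ ε} → 0ℚ ℚ.< δ → δ ℚ.+ δ ℚ.≤ ε → 0ℚ ℚ.+ δ ℚ.< ε
    0+δ<ε {δ} 0<δ 2δ≤ε = <-≤-trans (+-monoˡ-< δ 0<δ) 2δ≤ε

  ∥∥-resp : ∀ z w {r} → z ≈ w → ∥ z ∥≤ r → ∥ w ∥≤ r
  ∥∥-resp z w {r} z≈w p = subst (∥ w ∥≤_) (+-identityʳ r)
    (Bounded-resp (λ n → eq (seq (re z) n) (seq (re w) n)) (λ n → eq (seq (im z) n) (seq (im w) n))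
      (Bounded-+ p (Bounded-neg (≈⇒0 z w z≈w))))
    where
    open +-*-Solver
    eq : ∀ a b → a ℚ.+ ℚ.- (a ℚ.- b) ≡ b
    eq = solve 2 (λ a b → a :+ :- (a :- b) := b) refl

  ≈-isEquivalence : IsEquivalence _≈_
  ≈-isEquivalence = record
    { refl  = λ {z} → ptwise z z (λ _ → refl) (λ _ → refl)
    ; sym   = λ {z} {w} p → 0⇒≈ w z (Bounded-resp (λ n → neg (seq (re z) n) (seq (re w) n)) (λ n → neg (seq (im z) n) (seq (im w) n))
                (Bounded-neg (≈⇒0 z w p)))
    ; trans = λ {z} {w} {v} p r → 0⇒≈ z v (subst (∥ z - v ∥≤_) (+-identityˡ 0ℚ) (Bounded-resp
                (λ n → add (seq (re z) n) (seq (re w) n) (seq (re v) n)) (λ n → add (seq (im z) n) (seq (im w) n) (seq (im v) n))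
                (Bounded-+ (≈⇒0 z w p) (≈⇒0 w v r))))
    }
    where
    open +-*-Solver
    neg : ∀ a b → ℚ.- (a ℚ.- b) ≡ b ℚ.- a
    neg = solve 2 (λ a b → :- (a :- b) := b :- a) refl
    add : ∀ a b c → a ℚ.- b ℚ.+ (b ℚ.- c) ≡ a ℚ.- c
    add = solve 3 (λ a b c → a :- b :+ (b :- c) := a :- c) refl

  bounded : ∀ z → ∃[ r ] ∥ z ∥≤ r
  bounded z = _ , ∣∣⇒Bounded (component (re z)) (component (im z))
    where
    component : ∀ x → ∃[ N ] (∀ n → N ℕ.≤ n → ℚ.∣ seq x n ∣ ℚ.≤ 1ℚ ℚ.+ ℚ.∣ seq x (proj₁ (cauchy x 1ℚ 0<1)) ∣)
    component x = N , λ n N≤n → ≤-trans (≤-reflexive (cong ℚ.∣_∣ (eq (seq x n) (seq x N))))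
      (≤-trans (∣p+q∣≤∣p∣+∣q∣ (seq x n ℚ.- seq x N) (seq x N))
        (+-monoˡ-≤ ℚ.∣ seq x N ∣ (<⇒≤ (proj₂ (cauchy x 1ℚ 0<1) n N N≤n ℕₚ.≤-refl))))
      where
      N = proj₁ (cauchy x 1ℚ 0<1)
      open +-*-Solver
      eq : ∀ a b → a ≡ a ℚ.- b ℚ.+ b
      eq = solve 2 (λ a b → a := a :- b :+ b) refl

  ℂ-+-cong : ∀ {z z′ w w′} → z ≈ z′ → w ≈ w′ → z + w ≈ z′ + w′
  ℂ-+-cong {z} {z′} {w} {w′} p r = 0⇒≈ (z + w) (z′ + w′) (subst (∥ (z + w) - (z′ + w′) ∥≤_) (+-identityˡ 0ℚ) (Bounded-resp
    (λ n → eq (seq (re z) n) (seq (re z′) n) (seq (re w) n) (seq (re w′) n))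
    (λ n → eq (seq (im z) n) (seq (im z′) n) (seq (im w) n) (seq (im w′) n))
    (Bounded-+ (≈⇒0 z z′ p) (≈⇒0 w w′ r))))
    where
    open +-*-Solver
    eq : ∀ a a′ b b′ → a ℚ.- a′ ℚ.+ (b ℚ.- b′) ≡ a ℚ.+ b ℚ.- (a′ ℚ.+ b′)
    eq = solve 4 (λ a a′ b b′ → a :- a′ :+ (b :- b′) := a :+ b :- (a′ :+ b′)) refl

  ℂ--‿cong : ∀ {z w} → z ≈ w → - z ≈ - w
  ℂ--‿cong {z} {w} p = 0⇒≈ (- z) (- w) (Bounded-resp
    (λ n → eq (seq (re z) n) (seq (re w) n)) (λ n → eq (seq (im z) n) (seq (im w) n)) (Bounded-neg (≈⇒0 z w p)))
    where
    open +-*-Solver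
    eq : ∀ a b → ℚ.- (a ℚ.- b) ≡ ℚ.- a ℚ.- ℚ.- b
    eq = solve 2 (λ a b → :- (a :- b) := :- a :- :- b) refl

  -- z w - z′ w′ = z (w - w′) + (z - z′) w′, with z and w′ bounded and the differences of norm zero.
  ℂ-*-cong : ∀ {z z′ w w′} → z ≈ z′ → w ≈ w′ → z * w ≈ z′ * w′
  ℂ-*-cong {z} {z′} {w} {w′} p r = 0⇒≈ (z * w) (z′ * w′) (subst (∥ (z * w) - (z′ * w′) ∥≤_)
    (trans (cong₂ ℚ._+_ (*-zeroʳ (proj₁ (bounded z))) (*-zeroˡ (proj₁ (bounded w′)))) (+-identityˡ 0ℚ))
    (Bounded-resp
      (λ n → real (seq (re z) n) (seq (im z) n) (seq (re z′) n) (seq (im z′) n) (seq (re w) n) (seq (im w) n) (seq (re w′) n) (seq (im w′) n))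
      (λ n → imag (seq (re z) n) (seq (im z) n) (seq (re z′) n) (seq (im z′) n) (seq (re w) n) (seq (im w) n) (seq (re w′) n) (seq (im w′) n))
      (Bounded-+ (Bounded-* (proj₂ (bounded z)) (≈⇒0 w w′ r)) (Bounded-* (≈⇒0 z z′ p) (proj₂ (bounded w′))))))
    where
    open +-*-Solver
    real : ∀ a b a′ b′ c d c′ d′ →
      a ℚ.* (c ℚ.- c′) ℚ.- b ℚ.* (d ℚ.- d′) ℚ.+ ((a ℚ.- a′) ℚ.* c′ ℚ.- (b ℚ.- b′) ℚ.* d′)
      ≡ a ℚ.* c ℚ.- b ℚ.* d ℚ.- (a′ ℚ.* c′ ℚ.- b′ ℚ.* d′)
    real = solve 8 (λ a b a′ b′ c d c′ d′ →
      a :* (c :- c′) :- b :* (d :- d′) :+ ((a :- a′) :* c′ :- (b :- b′) :* d′)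
      := a :* c :- b :* d :- (a′ :* c′ :- b′ :* d′)) refl
    imag : ∀ a b a′ b′ c d c′ d′ →
      a ℚ.* (d ℚ.- d′) ℚ.+ b ℚ.* (c ℚ.- c′) ℚ.+ ((a ℚ.- a′) ℚ.* d′ ℚ.+ (b ℚ.- b′) ℚ.* c′)
      ≡ a ℚ.* d ℚ.+ b ℚ.* c ℚ.- (a′ ℚ.* d′ ℚ.+ b′ ℚ.* c′)
    imag = solve 8 (λ a b a′ b′ c d c′ d′ →
      a :* (d :- d′) :+ b :* (c :- c′) :+ ((a :- a′) :* d′ :+ (b :- b′) :* c′)
      := a :* d :+ b :* c :- (a′ :* d′ :+ b′ :* c′)) refl

  private
    open import Algebra.Definitions _≈_

    ℂ-*-assoc : Associative _*_
    ℂ-*-assoc x y z = ptwise (x * y * z) (x * (y * z))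
      (λ n → real (seq (re x) n) (seq (im x) n) (seq (re y) n) (seq (im y) n) (seq (re z) n) (seq (im z) n))
      (λ n → imag (seq (re x) n) (seq (im x) n) (seq (re y) n) (seq (im y) n) (seq (re z) n) (seq (im z) n))
      where
      open +-*-Solver
      real : ∀ a b c d e f →
        (a ℚ.* c ℚ.- b ℚ.* d) ℚ.* e ℚ.- (a ℚ.* d ℚ.+ b ℚ.* c) ℚ.* f
        ≡ a ℚ.* (c ℚ.* e ℚ.- d ℚ.* f) ℚ.- b ℚ.* (c ℚ.* f ℚ.+ d ℚ.* e)
      real = solve 6 (λ a b c d e f →
        (a :* c :- b :* d) :* e :- (a :* d :+ b :* c) :* f
        := a :* (c :* e :- d :* f) :- b :* (c :* f :+ d :* e)) refl
      imag : ∀ a b c d e f →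
        (a ℚ.* c ℚ.- b ℚ.* d) ℚ.* f ℚ.+ (a ℚ.* d ℚ.+ b ℚ.* c) ℚ.* e
        ≡ a ℚ.* (c ℚ.* f ℚ.+ d ℚ.* e) ℚ.+ b ℚ.* (c ℚ.* e ℚ.- d ℚ.* f)
      imag = solve 6 (λ a b c d e f →
        (a :* c :- b :* d) :* f :+ (a :* d :+ b :* c) :* e
        := a :* (c :* f :+ d :* e) :+ b :* (c :* e :- d :* f)) refl

    ℂ-*-comm : Commutative _*_
    ℂ-*-comm x y = ptwise (x * y) (y * x)
      (λ n → real (seq (re x) n) (seq (im x) n) (seq (re y) n) (seq (im y) n))
      (λ n → imag (seq (re x) n) (seq (im x) n) (seq (re y) n) (seq (im y) n))
      where
      open +-*-Solver
      real : ∀ a b c d → a ℚ.* c ℚ.- b ℚ.* d ≡ c ℚ.* a ℚ.- d ℚ.* b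
      real = solve 4 (λ a b c d → a :* c :- b :* d := c :* a :- d :* b) refl
      imag : ∀ a b c d → a ℚ.* d ℚ.+ b ℚ.* c ≡ c ℚ.* b ℚ.+ d ℚ.* a
      imag = solve 4 (λ a b c d → a :* d :+ b :* c := c :* b :+ d :* a) refl

    ℂ-*-identityˡ : LeftIdentity 1# _*_
    ℂ-*-identityˡ x = ptwise (1# * x) x
      (λ n → real (seq (re x) n) (seq (im x) n)) (λ n → imag (seq (re x) n) (seq (im x) n))
      where
      open +-*-Solver
      real : ∀ a b → 1ℚ ℚ.* a ℚ.- 0ℚ ℚ.* b ≡ a
      real = solve 2 (λ a b → con 1ℚ :* a :- con 0ℚ :* b := a) refl
      imag : ∀ a b → 1ℚ ℚ.* b ℚ.+ 0ℚ ℚ.* a ≡ b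
      imag = solve 2 (λ a b → con 1ℚ :* b :+ con 0ℚ :* a := b) refl

    ℂ-distribʳ : _DistributesOverʳ_ _*_ _+_
    ℂ-distribʳ x y z = ptwise ((y + z) * x) (y * x + z * x)
      (λ n → real (seq (re x) n) (seq (im x) n) (seq (re y) n) (seq (im y) n) (seq (re z) n) (seq (im z) n))
      (λ n → imag (seq (re x) n) (seq (im x) n) (seq (re y) n) (seq (im y) n) (seq (re z) n) (seq (im z) n))
      where
      open +-*-Solver
      real : ∀ a b c d e f → (c ℚ.+ e) ℚ.* a ℚ.- (d ℚ.+ f) ℚ.* b ≡ c ℚ.* a ℚ.- d ℚ.* b ℚ.+ (e ℚ.* a ℚ.- f ℚ.* b)
      real = solve 6 (λ a b c d e f → (c :+ e) :* a :- (d :+ f) :* b := c :* a :- d :* b :+ (e :* a :- f :* b)) refl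
      imag : ∀ a b c d e f → (c ℚ.+ e) ℚ.* b ℚ.+ (d ℚ.+ f) ℚ.* a ≡ c ℚ.* b ℚ.+ d ℚ.* a ℚ.+ (e ℚ.* b ℚ.+ f ℚ.* a)
      imag = solve 6 (λ a b c d e f → (c :+ e) :* b :+ (d :+ f) :* a := c :* b :+ d :* a :+ (e :* b :+ f :* a)) refl

  open import Algebra.Structures _≈_ using (IsCommutativeRing; IsAbelianGroup)
  import Algebra.Consequences.Setoid as Consequences

  ℂ-+-isAbelianGroup : IsAbelianGroup _+_ 0# (-_)
  ℂ-+-isAbelianGroup = record
    { isGroup = record
      { isMonoid = record
        { isSemigroup = record
          { isMagma = record
            { isEquivalence = ≈-isEquivalence
            ; ∙-cong = λ {z} {z′} {w} {w′} → ℂ-+-cong {z} {z′} {w} {w′} }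
          ; assoc = λ x y z → ptwise (x + y + z) (x + (y + z))
              (λ n → +-assoc (seq (re x) n) (seq (re y) n) (seq (re z) n))
              (λ n → +-assoc (seq (im x) n) (seq (im y) n) (seq (im z) n)) }
        ; identity = (λ x → ptwise (0# + x) x (λ n → +-identityˡ (seq (re x) n)) (λ n → +-identityˡ (seq (im x) n)))
                   , (λ x → ptwise (x + 0#) x (λ n → +-identityʳ (seq (re x) n)) (λ n → +-identityʳ (seq (im x) n))) }
      ; inverse = (λ x → ptwise (- x + x) 0# (λ n → +-inverseˡ (seq (re x) n)) (λ n → +-inverseˡ (seq (im x) n)))
                , (λ x → ptwise (x - x) 0# (λ n → +-inverseʳ (seq (re x) n)) (λ n → +-inverseʳ (seq (im x) n)))
      ; ⁻¹-cong = λ {z} {w} → ℂ--‿cong {z} {w} }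
    ; comm = λ x y → ptwise (x + y) (y + x)
        (λ n → +-comm (seq (re x) n) (seq (re y) n)) (λ n → +-comm (seq (im x) n) (seq (im y) n)) }

  private
    ℂ-setoid : Setoid 0ℓ 0ℓ
    ℂ-setoid = record { isEquivalence = ≈-isEquivalence }
    open Consequences ℂ-setoid using (comm∧idˡ⇒id; comm∧distrʳ⇒distr)

  ℂ-isCommutativeRing : IsCommutativeRing _+_ _*_ (-_) 0# 1#
  ℂ-isCommutativeRing = record
    { isRing = record
      { +-isAbelianGroup = ℂ-+-isAbelianGroup
      ; *-cong = λ {z} {z′} {w} {w′} → ℂ-*-cong {z} {z′} {w} {w′}
      ; *-assoc = ℂ-*-assoc
      ; *-identity = comm∧idˡ⇒id {_∙_ = _*_} ℂ-*-comm {e = 1#} ℂ-*-identityˡ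
      ; distrib = comm∧distrʳ⇒distr {_∙_ = _*_} {_◦_ = _+_} (λ {z} {z′} {w} {w′} → ℂ-+-cong {z} {z′} {w} {w′}) ℂ-*-comm ℂ-distribʳ }
    ; *-comm = ℂ-*-comm }

  ℂ-commutativeRing : CommutativeRing 0ℓ 0ℓ
  ℂ-commutativeRing = record { isCommutativeRing = ℂ-isCommutativeRing }

  complete : ∀ (f : ℕ → ℂ) →
    (∀ ε → 0ℚ ℚ.< ε → ∃[ N ] (∀ m n → N ℕ.≤ m → N ℕ.≤ n → ∥ f m - f n ∥≤ ε)) →
    ∃[ L ] (∀ ε → 0ℚ ℚ.< ε → ∃[ N ] (∀ n → N ℕ.≤ n → ∥ f n - L ∥≤ ε))
  complete f cf = Re.limit +i Im.limit , λ ε 0<ε →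
    let δ , 0<δ , 2δ≤ε = halve 0<ε
        N , close = Re.converges δ 0<δ
        N′ , close′ = Im.converges δ 0<δ
    in N ℕ.⊔ N′ , λ n N≤n → Bounded-weaken 2δ≤ε (∣∣⇒Bounded
         (close n (ℕₚ.m⊔n≤o⇒m≤o N N′ N≤n)) (close′ n (ℕₚ.m⊔n≤o⇒n≤o N N′ N≤n)))
    where
    open RealCompleteness
    cauchy-re : CauchySequence (λ n → re (f n))
    cauchy-re ε 0<ε =
      let δ , 0<δ , 2δ≤ε = halve 0<ε
          N , close = cf δ 0<δ
      in N , λ m n N≤m N≤n →
        let K , le = Bounded⇒∣re∣ δ 0<δ (close m n N≤m N≤n)
        in K , λ k K≤k → ≤-trans (le k K≤k) 2δ≤ε
    cauchy-im : CauchySequence (λ n → im (f n))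
    cauchy-im ε 0<ε =
      let δ , 0<δ , 2δ≤ε = halve 0<ε
          N , close = cf δ 0<δ
      in N , λ m n N≤m N≤n →
        let K , le = Bounded⇒∣im∣ δ 0<δ (close m n N≤m N≤n)
        in K , λ k K≤k → ≤-trans (le k K≤k) 2δ≤ε
    module Re = Limit (λ n → re (f n)) cauchy-re
    module Im = Limit (λ n → im (f n)) cauchy-im

  ∥1∥ : ∥ 1# ∥≤ 1ℚ
  ∥1∥ = Bounded-exact 0≤1 (0 , λ _ _ → ≤-refl)

  ∥0∥ : ∥ 0# ∥≤ 0ℚ
  ∥0∥ = Bounded-exact ≤-refl (0 , λ _ _ → ≤-refl)

  ℂ-Banach : BanachRing
  ℂ-Banach = record
    { commutativeRing = ℂ-commutativeRing
    ; ∥_∥≤_      = ∥_∥≤_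
    ; ∥∥-resp    = λ {z} {w} → ∥∥-resp z w
    ; ∥∥-weaken  = Bounded-weaken
    ; ∥∥-nonneg  = nonneg
    ; ∥∥-+       = Bounded-+
    ; ∥∥-*       = Bounded-*
    ; ∥∥-neg     = Bounded-neg
    ; ∥∥-0       = ∥0∥
    ; ∥∥-1       = ∥1∥
    ; ∥∥-closed  = Bounded-closed
    ; ∥∥-zero    = λ {z} p → 0⇒≈ z 0# (Bounded-resp
        (λ n → sym (+-identityʳ (seq (re z) n))) (λ n → sym (+-identityʳ (seq (im z) n))) p)
    ; ∥∥-bounded = bounded
    ; complete   = complete
    }

-- From norm bounds to the stated notions of disc, limit and apartness.

module Bridge where

  open import Data.Rational.Properties
  open import Data.Rational.Solver using (module +-*-Solver)
  open import Relation.Binary.PropositionalEquality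
  import Data.Nat.Properties as ℕₚ
  open RationalBounds
  open GaussianRationals
  open NormBounds
  open ComplexBanach
  open Limits ℂ-Banach using (_⇒_)

  -- The strict order on reals needs a fixed positive gap. Eventually |z| ≤ 2δ, and 4δ^2 + δ^2 <
  -- 9δ^2 leaves the gap δ^2.
  ∥∥⇒∣∣< : ∀ z {δ r} → 0ℚ ℚ.< δ → (δ ℚ.+ δ) ℚ.+ δ ℚ.≤ r → ∥ z ∥≤ δ → ∣ z ∣< r
  ∥∥⇒∣∣< z {δ} {r} 0<δ 3δ≤r p = <-≤-trans 0<3δ 3δ≤r , δ ℚ.* δ , 0<* 0<δ 0<δ ,
    proj₁ near , λ n N≤n → <-≤-trans
      (≤-<-trans (+-monoˡ-≤ (δ ℚ.* δ) (proj₂ near n N≤n)) gap)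
      (square-mono (<⇒≤ 0<3δ) 3δ≤r)
    where
    near = eventually p δ 0<δ
    0<2δ : 0ℚ ℚ.< δ ℚ.+ δ
    0<2δ = +-mono-< {0ℚ} 0<δ 0<δ
    0<3δ : 0ℚ ℚ.< (δ ℚ.+ δ) ℚ.+ δ
    0<3δ = +-mono-< {0ℚ} 0<2δ 0<δ
    gap : (δ ℚ.+ δ) ℚ.* (δ ℚ.+ δ) ℚ.+ δ ℚ.* δ ℚ.< ((δ ℚ.+ δ) ℚ.+ δ) ℚ.* ((δ ℚ.+ δ) ℚ.+ δ)
    gap = subst₂ ℚ._<_ (+-identityʳ _) (eq δ)
      (+-monoʳ-< ((δ ℚ.+ δ) ℚ.* (δ ℚ.+ δ) ℚ.+ δ ℚ.* δ) (0<* 0<2δ 0<2δ))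
      where
      open +-*-Solver
      eq : ∀ δ → (δ ℚ.+ δ) ℚ.* (δ ℚ.+ δ) ℚ.+ δ ℚ.* δ ℚ.+ (δ ℚ.+ δ) ℚ.* (δ ℚ.+ δ) ≡ ((δ ℚ.+ δ) ℚ.+ δ) ℚ.* ((δ ℚ.+ δ) ℚ.+ δ)
      eq = solve 1 (λ δ → (δ :+ δ) :* (δ :+ δ) :+ δ :* δ :+ (δ :+ δ) :* (δ :+ δ) := ((δ :+ δ) :+ δ) :* ((δ :+ δ) :+ δ)) refl

  ⇒⟶ : ∀ f L → f ⇒ L → f ⟶ L
  ⇒⟶ f L p ε 0<ε =
    let δ , 0<δ , 3δ≤ε = shrink {1ℚ ℚ.+ 1ℚ ℚ.+ 1ℚ} (0≤+ (0≤+ 0≤1 0≤1) 0≤1) 0<ε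
        N , close = p δ 0<δ
    in N , λ n N≤n → ∥∥⇒∣∣< (f n - L) 0<δ (≤-trans (≤-reflexive (eq δ)) 3δ≤ε) (close n N≤n)
    where
    open +-*-Solver
    eq : ∀ δ → (δ ℚ.+ δ) ℚ.+ δ ≡ (1ℚ ℚ.+ 1ℚ ℚ.+ 1ℚ) ℚ.* δ
    eq = solve 1 (λ δ → (δ :+ δ) :+ δ := (con 1ℚ :+ con 1ℚ :+ con 1ℚ) :* δ) refl

  -- If |q|^2 + ε < 1 eventually, then ρ = 1 - ε/2 works, since its square is at least 1 - ε; it is
  -- nonnegative because ε ≤ 1.
  radius : ∀ q → ∣ q ∣< 1ℚ → ∃[ ρ ] 0ℚ ℚ.≤ ρ × ρ ℚ.< 1ℚ × ∥ q ∥≤ ρ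
  radius q (_ , ε , 0<ε , N , below) = ρ , 0≤ρ , ρ<1 , Bounded-exact 0≤ρ (N , λ n N≤n → le n N≤n)
    where
    h = ½ ℚ.* ε
    0<h : 0ℚ ℚ.< h
    0<h = 0<* (positive⁻¹ ½) 0<ε
    2h≡ε : h ℚ.+ h ≡ ε
    2h≡ε = trans (sym (*-distribʳ-+ ε ½ ½)) (*-identityˡ ε)
    ρ = 1ℚ ℚ.- h
    ε≤1 : ε ℚ.≤ 1ℚ
    ε≤1 = ≤-trans (a≤b+a ε (0≤norm² (seq (re q) N) (seq (im q) N)))
      (≤-trans (<⇒≤ (below N ℕₚ.≤-refl)) (≤-reflexive (*-identityˡ 1ℚ)))
    0≤ρ : 0ℚ ℚ.≤ ρ
    0≤ρ = ≤⇒0≤- (≤-trans (a≤a+b h (<⇒≤ 0<h)) (≤-trans (≤-reflexive 2h≡ε) ε≤1))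
    ρ<1 : ρ ℚ.< 1ℚ
    ρ<1 = subst (ρ ℚ.<_) (+-identityʳ 1ℚ) (+-monoʳ-< 1ℚ (neg-antimono-< 0<h))
    le : ∀ n → N ℕ.≤ n → norm² (seq (re q) n) (seq (im q) n) ℚ.≤ ρ ℚ.* ρ
    le n N≤n = 0≤-⇒≤ (subst (0ℚ ℚ.≤_) (eq h x)
      (0≤+ (≤⇒0≤- (subst (λ e → x ℚ.+ e ℚ.≤ 1ℚ ℚ.* 1ℚ) (sym 2h≡ε) (<⇒≤ (below n N≤n)))) (0≤square h)))
      where
      x = norm² (seq (re q) n) (seq (im q) n)
      open +-*-Solver
      eq : ∀ h x → 1ℚ ℚ.* 1ℚ ℚ.- (x ℚ.+ (h ℚ.+ h)) ℚ.+ h ℚ.* h ≡ (1ℚ ℚ.- h) ℚ.* (1ℚ ℚ.- h) ℚ.- x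
      eq = solve 2 (λ h x → con 1ℚ :* con 1ℚ :- (x :+ (h :+ h)) :+ h :* h := (con 1ℚ :- h) :* (con 1ℚ :- h) :- x) refl

  -- From |z|² |y|² = |z y|² > 1/4 eventually, with |y|² bounded.
  invertible⇒#0 : ∀ z y → z * y ≈ 1# → z #0
  invertible⇒#0 z y (real , _) = δ , 0<δ , N₁ ℕ.⊔ N₂ , λ n N≤n → away n (ℕₚ.m⊔n≤o⇒m≤o N₁ N₂ N≤n) (ℕₚ.m⊔n≤o⇒n≤o N₁ N₂ N≤n)
    where
    b = proj₁ (bounded y)
    B = b ℚ.+ 1ℚ
    M = B ℚ.* B
    0≤B : 0ℚ ℚ.≤ B
    0≤B = 0≤+ (nonneg (proj₂ (bounded y))) 0≤1
    0≤M : 0ℚ ℚ.≤ M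
    0≤M = 0≤* 0≤B 0≤B
    ¼ = ½ ℚ.* ½
    small = shrink 0≤M (0<* (positive⁻¹ ½) (positive⁻¹ ½))
    δ = proj₁ small
    0<δ = proj₁ (proj₂ small)
    Mδ≤¼ : M ℚ.* δ ℚ.≤ ¼
    Mδ≤¼ = proj₂ (proj₂ small)
    N₁ = proj₁ (eventually (proj₂ (bounded y)) 1ℚ 0<1)
    N₂ = proj₁ (real ½ (positive⁻¹ ½))
    away : ∀ n → N₁ ℕ.≤ n → N₂ ℕ.≤ n → 0ℚ ℚ.+ δ ℚ.< norm² (seq (re z) n) (seq (im z) n)
    away n N₁≤n N₂≤n = subst (ℚ._< norm² (seq (re z) n) (seq (im z) n)) (sym (+-identityˡ δ))
      (≰⇒> λ X≤δ → <-irrefl refl (begin-strict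
        ¼                                           <⟨ ¼<cc ⟩
        c ℚ.* c                                     ≤⟨ a≤a+b _ (0≤square d) ⟩
        norm² c d                                   ≡⟨ norm²-* (seq (re z) n) (seq (im z) n) (seq (re y) n) (seq (im y) n) ⟩
        norm² (seq (re z) n) (seq (im z) n) ℚ.* norm² (seq (re y) n) (seq (im y) n)
          ≤⟨ *-mono (0≤norm² (seq (re z) n) (seq (im z) n)) X≤δ (0≤norm² (seq (re y) n) (seq (im y) n))
               (proj₂ (eventually (proj₂ (bounded y)) 1ℚ 0<1) n N₁≤n) ⟩
        δ ℚ.* M                                     ≡⟨ *-comm δ M ⟩
        M ℚ.* δ                                     ≤⟨ Mδ≤¼ ⟩
        ¼                                           ∎))
      where
      open ≤-Reasoning
      c = seq (re (z * y)) n
      d = seq (im (z * y)) n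
      ½<c : ½ ℚ.< c
      ½<c = subst₂ ℚ._<_ (eq₁ c) (eq₂ c) (+-monoˡ-< (c ℚ.- ½) (≤-<-trans (≤-trans (p≤∣p∣ (1ℚ ℚ.- c)) (≤-reflexive (flip c))) (proj₂ (real ½ (positive⁻¹ ½)) n N₂≤n)))
        where
        open +-*-Solver
        p≤∣p∣ : ∀ p → p ℚ.≤ ℚ.∣ p ∣
        p≤∣p∣ p = square-cancel (0≤∣p∣ p) (≤-reflexive (sym (∣∣-square p)))
        flip : ∀ c → ℚ.∣ 1ℚ ℚ.- c ∣ ≡ ℚ.∣ c ℚ.- 1ℚ ∣
        flip c = trans (cong ℚ.∣_∣ (eq c)) (∣-p∣≡∣p∣ (c ℚ.- 1ℚ))
          where
          eq : ∀ c → 1ℚ ℚ.- c ≡ ℚ.- (c ℚ.- 1ℚ)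
          eq = solve 1 (λ c → con 1ℚ :- c := :- (c :- con 1ℚ)) refl
        eq₁ : ∀ c → 1ℚ ℚ.- c ℚ.+ (c ℚ.- ½) ≡ ½
        eq₁ = solve 1 (λ c → con 1ℚ :- c :+ (c :- con ½) := con ½) refl
        eq₂ : ∀ c → ½ ℚ.+ (c ℚ.- ½) ≡ c
        eq₂ = solve 1 (λ c → con ½ :+ (c :- con ½) := c) refl
      ¼<cc : ¼ ℚ.< c ℚ.* c
      ¼<cc = ≤-<-trans (*-monoˡ (<⇒≤ (positive⁻¹ ½)) (<⇒≤ ½<c))
        (*-monoˡ-<-pos c {{ℚ.positive (<-trans (positive⁻¹ ½) ½<c)}} ½<c)

-- Instantiation at the complex numbers.

module Transfer where

  open import Data.List.Relation.Binary.Pointwise using ([]; _∷_)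
  open Bridge
  open Solutions ComplexBanach.ℂ-Banach
  open Limits ComplexBanach.ℂ-Banach using (_⇒_)
  module R = BanachRing ComplexBanach.ℂ-Banach
  open import Algebra.Properties.Semiring.Exp R.semiring using () renaming (_^_ to _^ᴿ_)

  -- Stated for variable exponents: at numerals, converting between two forms
  -- of the same power of q would unfold it into its real and imaginary parts.
  limit : ∀ q m n L → qProduct (q ^ᴿ m) (q ^ᴿ n) ⇒ L → ⟨ q ^ m ⨾ q ^ n ⟩ ⟶ L
  limit q m n L = ⇒⟶ ⟨ q ^ m ⨾ q ^ n ⟩ L

  limit-neg : ∀ q m n L → qProduct (R.- (q ^ᴿ m)) (q ^ᴿ n) ⇒ L → ⟨ - (q ^ m) ⨾ q ^ n ⟩ ⟶ L
  limit-neg q m n L = ⇒⟶ ⟨ - (q ^ m) ⨾ q ^ n ⟩ L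

  quotient : ∀ q x n e f k → x R.* denominator q n R.≈ q ^ᴿ e R.* qProduct (R.- (q ^ᴿ f)) (q ^ᴿ f) k →
    x * (⟨ - q ⨾ q ⟩ n * ⟨ q ⨾ q ⟩ (2 ℕ.* n ℕ.∸ 1)) ≈ q ^ e * ⟨ - (q ^ f) ⨾ q ^ f ⟩ k
  quotient q x n e f k p = p

  denominator#0 : ∀ q n y → denominator q n R.* y R.≈ R.1# → (⟨ - q ⨾ q ⟩ n * ⟨ q ⨾ q ⟩ (2 ℕ.* n ℕ.∸ 1)) #0
  denominator#0 q n y = invertible⇒#0 (⟨ - q ⨾ q ⟩ n * ⟨ q ⨾ q ⟩ (2 ℕ.* n ℕ.∸ 1)) y

  identity : ∀ q e f S D A₁ A₂ A₃ B₁ B₂ B₃ C₁ C₂ →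
    (R.1# R.+ S) R.* D R.≈ A₁ R.* (A₂ R.* (A₃ R.* R.1#))
      R.- (R.1# R.+ R.1#) R.* q ^ᴿ e R.* (B₁ R.* (B₂ R.* (B₃ R.* R.1#)))
      R.+ (R.1# R.+ R.1#) R.* q ^ᴿ f R.* (C₁ R.* (C₂ R.* (B₃ R.* R.1#))) →
    (1# + S) * D ≈ A₁ * (A₂ * (A₃ * 1#)) - 2# * q ^ e * (B₁ * (B₂ * (B₃ * 1#))) + 2# * q ^ f * (C₁ * (C₂ * (B₃ * 1#)))
  identity q e f S D A₁ A₂ A₃ B₁ B₂ B₃ C₁ C₂ p = p

  product₃ : ∀ X Y Z → (X * (Y * (Z * 1#))) ≈ foldr _*_ 1# (X ∷ Y ∷ Z ∷ [])
  product₃ X Y Z = R.refl {X * (Y * (Z * 1#))}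

  product₁ : ∀ X → X ≈ foldr _*_ 1# (X ∷ [])
  product₁ X = R.sym {X * 1#} {X} (R.*-identityʳ X)

  module Answer (q : ℂ) (s : Solution q) where

    module s = Solution s

    quotients : (n : ℕ) → 1 ℕ.≤ n →
      s.t n is (q ^ (n ℕ.^ 2) * ⟨ - (q ^ 3) ⨾ q ^ 3 ⟩ (n ℕ.∸ 1)) ÷ (⟨ - q ⨾ q ⟩ n * ⟨ q ⨾ q ⟩ (2 ℕ.* n ℕ.∸ 1))
    quotients (suc m) _ = denominator#0 q (suc m) (proj₁ (s.invertible m)) (proj₂ (s.invertible m))
      , quotient q (s.t (suc m)) (suc m) (suc m ℕ.^ 2) 3 m (s.quotient m)

    series : s.S is∑₁ s.t
    series = ⇒⟶ (partialSum s.t) s.S s.sum⇒S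

    A B C : ℂ
    A = s.A₁ * (s.A₂ * (s.A₃ * 1#))
    B = s.B₁ * (s.B₂ * (s.B₃ * 1#))
    C = s.C₁ * (s.C₂ * (s.B₃ * 1#))

    A-product : A is⟨ q ^ 12 ∷ q ^ 15 ∷ q ^ 27 ∷ [] ⨾ q ^ 27 ⟩∞
    A-product = s.A₁ ∷ s.A₂ ∷ s.A₃ ∷ []
      , limit q 12 27 s.A₁ s.⇒A₁ ∷ limit q 15 27 s.A₂ s.⇒A₂ ∷ limit q 27 27 s.A₃ s.⇒A₃ ∷ [] , product₃ s.A₁ s.A₂ s.A₃

    B-product : B is⟨ - (q ^ 33) ∷ - (q ^ 75) ∷ q ^ 108 ∷ [] ⨾ q ^ 108 ⟩∞
    B-product = s.B₁ ∷ s.B₂ ∷ s.B₃ ∷ []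
      , limit-neg q 33 108 s.B₁ s.⇒B₁ ∷ limit-neg q 75 108 s.B₂ s.⇒B₂ ∷ limit q 108 108 s.B₃ s.⇒B₃ ∷ [] , product₃ s.B₁ s.B₂ s.B₃

    C-product : C is⟨ - (q ^ 15) ∷ - (q ^ 93) ∷ q ^ 108 ∷ [] ⨾ q ^ 108 ⟩∞
    C-product = s.C₁ ∷ s.C₂ ∷ s.B₃ ∷ []
      , limit-neg q 15 108 s.C₁ s.⇒C₁ ∷ limit-neg q 93 108 s.C₂ s.⇒C₂ ∷ limit q 108 108 s.B₃ s.⇒B₃ ∷ [] , product₃ s.C₁ s.C₂ s.B₃

    D-product : s.D is⟨ q ∷ [] ⨾ q ⟩∞
    D-product = s.D ∷ [] , ⇒⟶ ⟨ q ⨾ q ⟩ s.D s.⇒D ∷ [] , product₁ s.D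

    value : (1# + s.S) is (A - 2# * q ^ 2 * B + 2# * q ^ 7 * C) ÷ s.D
    value = invertible⇒#0 s.D (proj₁ s.D-invertible) (proj₂ s.D-invertible)
      , identity q 2 7 s.S s.D s.A₁ s.A₂ s.A₃ s.B₁ s.B₂ s.B₃ s.C₁ s.C₂ s.identity


theorem3p2 : (q : ℂ) → ∣ q ∣< 1ℚ →
    ∃[ t ] ∃[ S ] ∃[ A ] ∃[ B ] ∃[ C ] ∃[ D ]
    ((n : ℕ) → 1 ℕ.≤ n →
    t n is (q ^ (n ℕ.^ 2) * ⟨ - (q ^ 3) ⨾ q ^ 3 ⟩ (n ℕ.∸ 1))
    ÷ (⟨ - q ⨾ q ⟩ n * ⟨ q ⨾ q ⟩ (2 ℕ.* n ℕ.∸ 1)))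
    × S is∑₁ t
    × A is⟨ q ^ 12 ∷ q ^ 15 ∷ q ^ 27 ∷ [] ⨾ q ^ 27 ⟩∞
    × B is⟨ - (q ^ 33) ∷ - (q ^ 75) ∷ q ^ 108 ∷ [] ⨾ q ^ 108 ⟩∞
    × C is⟨ - (q ^ 15) ∷ - (q ^ 93) ∷ q ^ 108 ∷ [] ⨾ q ^ 108 ⟩∞
    × D is⟨ q ∷ [] ⨾ q ⟩∞
    × (1# + S) is (A - 2# * q ^ 2 * B + 2# * q ^ 7 * C) ÷ D
theorem3p2 q ∣q∣<1 =
  s.t , s.S , A , B , C , s.D , quotients , series , A-product , B-product , C-product , D-product , value
  where
  r = Bridge.radius q ∣q∣<1
  open Transfer.Answer q
    (Solutions.solution ComplexBanach.ℂ-Banach (proj₁ (proj₂ r)) (proj₁ (proj₂ (proj₂ r))) q (proj₂ (proj₂ (proj₂ r))))
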